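{- Let $r\ge 3$ be a fixed integer. Then there exist positive constants $c_r$ and $c_r'$ (depending only on $r$) such that for all sufficiently large $N$: (a) $\mathrm{ex}_r(N, \mathcal{C}_{<5}) \geq c_r \cdot N^{10/7}$, and (b) $\mathrm{ex}_r(N, \mathcal{C}_{<6}) \geq c_r'\cdot N^{4/3}$.
   Context: An $r$-uniform hypergraph on a finite vertex set $X$ is a collection of $r$-element subsets (edges) of $X$. A Berge cycle of length $k\ge 2$ in a hypergraph is a sequence of $k$ distinct vertices $v_1,\dots,v_k$ and $k$ distinct edges $E_1,\dots,E_k$ such that $\{v_i,v_{i+1}\}\subseteq E_i$ for all $i$, indices read modulo $k$. $\mathcal{C}_{<g}$ denotes the family of Berge cycles of lengths $2,3,\dots,g-1$; a hypergraph is $\mathcal{C}_{<g}$-free if it contains no Berge cycle of length $k$ for any $2\le k\le g-1$. $\mathrm{ex}_r(N,\mathcal{C}_{<g})$ denotes the maximum number of edges in an $N$-vertex $r$-uniform $\mathcal{C}_{<g}$-free hypergraph. -}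

module Defs where

open import Data.Nat using (ℕ; zero; suc; _≤_; _<_; _*_; _^_)
open import Data.Nat.DivMod using (_mod_)
open import Data.Fin using (Fin; toℕ)
open import Data.Fin.Subset using (Subset; _∈_; ∣_∣)
open import Data.Product using (Σ; _×_)
open import Relation.Binary.PropositionalEquality using (_≡_)
open import Relation.Nullary using (¬_)
open import Data.Empty using (⊥)
open import Function.Definitions using (Injective)

record Hypergraph (r N : ℕ) : Set where
  field
    m        : ℕ
    edge     : Fin m → Subset N
    distinct : Injective _≡_ _≡_ edge
    uniform  : ∀ i → ∣ edge i ∣ ≡ r
open Hypergraph public

next : {n : ℕ} → Fin (suc n) → Fin (suc n)
next {n} i = suc (toℕ i) mod (suc n)

BergeCycle : {r N : ℕ} → Hypergraph r N → (k : ℕ) → Set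
BergeCycle H zero = ⊥   -- length 0 never arises (k ≥ 2)
BergeCycle {N = N} H (suc k) =
  Σ (Fin (suc k) → Fin N) λ v →
  Σ (Fin (suc k) → Fin (m H)) λ e →
    Injective _≡_ _≡_ v × Injective _≡_ _≡_ e ×
    (∀ i → v i ∈ edge H (e i)) × (∀ i → v (next i) ∈ edge H (e i))

CycFree : {r N : ℕ} → Hypergraph r N → (g : ℕ) → Set
CycFree H g = ∀ k → 2 ≤ k → k < g → ¬ BergeCycle H k

-- ex_r(N, C_{<g}) ≥ t  (ex is a maximum, so this holds iff some
-- N-vertex r-uniform C_{<g}-free hypergraph has at least t edges)
ExAtLeast : (r N g t : ℕ) → Set
ExAtLeast r N g t = Σ (Hypergraph r N) λ H → CycFree H g × t ≤ m H

{-# OPTIONS --safe #-}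

-- Let E = F_p[θ]/(θ³ - θ - c) be a cubic field with adjoint x♯ and norm N(x) = x x♯, and fix r
-- slopes a in F_p. A hyperedge consists of one vertex for each slope a. For (a), the hyperedges
-- are the tuples (u, v, w, z) with u, v, w in E and z in F_p, and the vertex is (v + a u, w + a
-- u♯, z + a N(u)); this gives p^10 edges on r p^7 vertices. Consecutive edges of a cycle differ
-- by x_i = Δu, and closing up a triangle or a quadrilateral forces b x_1♯ x_2 = b' x_4♯ x_3 and
-- its rotations, where b, b' are differences of slopes; hence x_1 x_3 = x_2 x_4, so x_1 = -x_2
-- or x_1 = -x_4, and two pairs of slopes have the same sum. The slopes 3^i exclude this. For
-- (b), E² is viewed as a plane: a cycle is a polygon whose sides have the given slopes, and the
-- tuples and vertices get a further coordinate in F_p so that the E-valued area of the polygon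
-- and its first moments in F_p vanish. Taking the level of the side i as height 0, the height of
-- the opposite corner times the area minus the moment is
--   d_{i-2} d_{i-1} x_{i-1}♯ x_{i-2} + d_i d_{i+1} x_{i+1}♯ x_{i+2} = 0,   d_j = a_j - a_{j+1}.
-- For polygons with fewer than five sides one of the terms vanishes and the other does not; for
-- pentagons the product of the five equations reads Π = -Π. This gives p^11 edges on r p^8
-- vertices, and 11/8 > 4/3. Finally, for every i there is a prime p with 4^(4+i) < p ≤ 4^(6+i),
-- by Chebyshev's estimate of the central binomial coefficient.
module Submission where

-- An edge carries one more element of E than a vertex does, hence three more coordinates, so `D`
-- coordinates per vertex yield the exponent 1 + 3/D. The task is therefore to close polygons with
-- few coordinates, and the cubic norm suits it: a coordinate in E costs three, but norms and traces
-- are scalars and cost one.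
--
-- The cycle is read dually. Its edges are the corners of a polygon, placed at their `u`; its
-- vertices are the sides, and the class of a vertex is the slope of the side. Equal coordinates at
-- a shared vertex make sums around the polygon telescope. The remaining relations are combined
-- until only two monomials in the sides are left, and in a field a nonzero monomial cannot vanish.
--
-- E is modelled by triples of integers up to congruence. Its identities hold exactly over the
-- integers, for every c; only the absence of zero divisors depends on c, and it follows from t³ - t
-- never taking the value c modulo p. Such a c exists for every p, since t³ - t has the same value
-- at 0 and 1. Primes are needed only up to a constant factor, which is absorbed by the constants of
-- the theorem.

module Primes where
  open import Data.Nat
  open import Data.Nat.Properties
  open import Data.Nat.Divisibility
  open import Data.Nat.Primality
  open import Data.Nat.Primality.Factorisation using (factorise)
  open import Data.Nat.Combinatorics using (_C_; k>n⇒nCk≡0; nCk+nC[k+1]≡[n+1]C[k+1]; nC1≡n)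
  open import Data.Nat.Induction using (<-wellFounded)
  open import Data.Nat.Tactic.RingSolver using (solve-∀)
  open import Induction.WellFounded using (Acc; acc)
  open import Data.List.Base using ([]; _∷_)
  open import Data.List.Relation.Unary.All using (_∷_)
  open import Data.Product using (∃; ∃₂; _,_; _×_)
  open import Data.Sum using (inj₁; inj₂; [_,_])
  open import Data.Empty using (⊥; ⊥-elim)
  open import Relation.Nullary
  open import Relation.Binary.PropositionalEquality hiding ([_])

  -- Prime powers dividing binomial coefficients

  absorption : ∀ n k → suc k * (suc n C suc k) ≡ suc n * (n C k)
  absorption zero zero = refl
  absorption zero (suc k) rewrite k>n⇒nCk≡0 {1} {suc (suc k)} (s≤s (s≤s z≤n)) | k>n⇒nCk≡0 {0} {suc k} (s≤s z≤n) = *-zeroʳ (suc (suc k))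
  absorption (suc n) zero rewrite nC1≡n (suc (suc n)) = trans (+-identityʳ _) (sym (*-identityʳ _))
  absorption (suc n) (suc k) = begin
    suc (suc k) * (suc (suc n) C suc (suc k)) ≡⟨ cong (suc (suc k) *_) (sym (nCk+nC[k+1]≡[n+1]C[k+1] (suc n) (suc k))) ⟩
    suc (suc k) * (A + (suc n C suc (suc k))) ≡⟨ *-distribˡ-+ (suc (suc k)) A _ ⟩
    suc (suc k) * A + suc (suc k) * (suc n C suc (suc k)) ≡⟨ cong (suc (suc k) * A +_) (absorption n (suc k)) ⟩
    suc (suc k) * A + suc n * (n C suc k) ≡⟨ +-assoc A (suc k * A) _ ⟩
    A + (suc k * A + suc n * (n C suc k)) ≡⟨ cong (λ t → A + (t + suc n * (n C suc k))) (absorption n k) ⟩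
    A + (suc n * (n C k) + suc n * (n C suc k)) ≡⟨ cong (A +_) (sym (*-distribˡ-+ (suc n) (n C k) _)) ⟩
    A + suc n * (n C k + n C suc k) ≡⟨ cong (λ t → A + suc n * t) (nCk+nC[k+1]≡[n+1]C[k+1] n k) ⟩
    A + suc n * A ∎
    where open ≡-Reasoning
          A = suc n C suc k

  -- With L n k = 1 / (k · (n C k)), the identity L (n-1) k = L n k + L n (k+1) of the Leibniz
  -- harmonic triangle shows inductively that d · L n k is an integer.
  *C-∣ : ∀ n k d → (∀ j → 1 ≤ j → j ≤ n → j ∣ d) → k < n → suc k * (n C suc k) ∣ d
  *C-∣ (suc n) zero d h _ rewrite nC1≡n (suc n) | *-identityˡ (suc n) = h (suc n) (s≤s z≤n) ≤-refl
  *C-∣ (suc n) (suc k) d h (s≤s k<n)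
    with *C-∣ (suc n) k d h (s≤s (<⇒≤ k<n)) | *C-∣ n k d (λ j p q → h j p (m≤n⇒m≤1+n q)) k<n
  ... | divides e d≡e | divides f d≡f =
    ∣m+n∣m⇒∣n (subst (X ∣_) (*-cancelˡ-≡ (X * f) (X * e + d) (suc k) eq) (m∣m*n f)) (m∣m*n e)
    where
    X = suc (suc k) * (suc n C suc (suc k))
    A = suc n C suc k
    B = n C suc k
    X≡ : X ≡ suc n * B
    X≡ = absorption n (suc k)
    key : X + suc k * A ≡ suc n * A
    key = trans (cong₂ _+_ X≡ (absorption n k)) (trans (sym (*-distribˡ-+ (suc n) B (n C k)))
          (cong (suc n *_) (trans (+-comm B _) (nCk+nC[k+1]≡[n+1]C[k+1] n k))))
    open ≡-Reasoning
    lem₁ : ∀ n b f k → k * (n * b * f) ≡ n * (f * (k * b))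
    lem₁ = solve-∀
    lem₂ : ∀ x e k a → k * (x * e) + k * (e * (k * a)) ≡ (x + k * a) * (e * k)
    lem₂ = solve-∀
    lem₃ : ∀ n a e k → n * a * (e * k) ≡ n * (e * (k * a))
    lem₃ = solve-∀
    -- The identity of the harmonic triangle times `d`: `e` and `f` are the quotients of `d` by
    -- `suc k * A` and `suc k * B`, and d / X = f - e.
    eq : suc k * (X * f) ≡ suc k * (X * e + d)
    eq = begin
      suc k * (X * f) ≡⟨ cong (λ t → suc k * (t * f)) X≡ ⟩
      suc k * (suc n * B * f) ≡⟨ lem₁ (suc n) B f (suc k) ⟩
      suc n * (f * (suc k * B)) ≡⟨ cong (suc n *_) (trans (sym d≡f) d≡e) ⟩
      suc n * (e * (suc k * A)) ≡⟨ sym (lem₃ (suc n) A e (suc k)) ⟩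
      suc n * A * (e * suc k) ≡⟨ cong (_* (e * suc k)) (sym key) ⟩
      (X + suc k * A) * (e * suc k) ≡⟨ sym (lem₂ X e (suc k) A) ⟩
      suc k * (X * e) + suc k * (e * (suc k * A)) ≡⟨ cong (λ t → suc k * (X * e) + suc k * t) (sym d≡e) ⟩
      suc k * (X * e) + suc k * d ≡⟨ sym (*-distribˡ-+ (suc k) (X * e) d) ⟩
      suc k * (X * e + d) ∎

  module _ {p} (pr : Prime p) where
    private instance
      _ = prime⇒nonZero pr
      _ = prime⇒nonTrivial pr

    p-part : ∀ n .{{_ : NonZero n}} → Acc _<_ n → ∃₂ λ α n′ → n ≡ p ^ α * n′ × ¬ p ∣ n′
    p-part n (acc rs) with p ∣? n
    ... | no ∤ = 0 , n , sym (+-identityʳ n) , ∤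
    ... | yes p∣n with p-part (quotient p∣n) {{quotient≢0 p∣n}} (rs (quotient-< p∣n))
    ... | α , n′ , eq , ∤ = suc α , n′ , trans (m∣n⇒n≡m*quotient p∣n) (trans (cong (p *_) eq) (sym (*-assoc p (p ^ α) n′))) , ∤

    ∤-* : ∀ {m n} → ¬ p ∣ m → ¬ p ∣ n → ¬ p ∣ m * n
    ∤-* {m} {n} a b c = [ a , b ] (euclidsLemma m n pr c)

    ^-∣ : ∀ {α β} → α ≤ β → p ^ α ∣ p ^ β
    ^-∣ {α} {β} α≤β = subst (λ t → p ^ α ∣ t) (trans (sym (^-distribˡ-+-* p α (β ∸ α))) (cong (p ^_) (m+[n∸m]≡n α≤β))) (m∣m*n _)

    -- Only the power of `p` has to be economical: `t` is the largest exponent met so far, while `d`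
    -- simply collects the product of all cofactors prime to `p`.
    common-multiple : ∀ n → 1 ≤ n → ∃₂ λ t d → p ^ t ≤ n × ¬ p ∣ d × (∀ j → 1 ≤ j → j ≤ n → j ∣ p ^ t * d)
    common-multiple (suc zero) _ = 0 , 1 , s≤s z≤n , >⇒∤ (nonTrivial⇒n>1 p) , λ { (suc zero) _ _ → ∣-refl ; (suc (suc _)) _ (s≤s ()) }
    common-multiple (suc n@(suc _)) _ with common-multiple n (s≤s z≤n) | p-part (suc n) (<-wellFounded _)
    ... | t , d , t≤ , ∤d , h | α , n′ , eq , ∤n′ = t ⊔ α , d * n′ , bound , ∤-* ∤d ∤n′ , h′
      where
      bound : p ^ (t ⊔ α) ≤ suc n
      bound with ⊔-sel t α
      ... | inj₁ e rewrite e = m≤n⇒m≤1+n t≤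
      ... | inj₂ e rewrite e = ∣⇒≤ (divides n′ (trans eq (*-comm (p ^ α) n′)))
      h′ : ∀ j → 1 ≤ j → j ≤ suc n → j ∣ p ^ (t ⊔ α) * (d * n′)
      h′ j 1≤j j≤ with m≤n⇒m<n∨m≡n j≤
      ... | inj₁ (s≤s j≤n) = ∣-trans (h j 1≤j j≤n) (*-pres-∣ (^-∣ (m≤m⊔n t α)) (m∣m*n n′))
      ... | inj₂ refl rewrite eq = *-pres-∣ (^-∣ (m≤n⊔m t α)) (n∣m*n d)

    ^-∣⇒≤ : ∀ k t {d} → ¬ p ∣ d → p ^ k ∣ p ^ t * d → k ≤ t
    ^-∣⇒≤ zero t _ _ = z≤n
    ^-∣⇒≤ (suc k) zero {d} ∤d h = ⊥-elim (∤d (∣-trans (m∣m*n (p ^ k)) (subst (p ^ suc k ∣_) (+-identityʳ d) h)))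
    ^-∣⇒≤ (suc k) (suc t) {d} ∤d h = s≤s (^-∣⇒≤ k t ∤d (*-cancelˡ-∣ p (subst (p ^ suc k ∣_) (*-assoc p (p ^ t) d) h)))

    -- This takes the place of Legendre's formula: the binomial coefficient divides every common
    -- multiple of 1, ..., n, and there is one whose `p`-part is at most `n`.
    prime-power-∣C : ∀ n i k → i < n → p ^ k ∣ n C suc i → p ^ k ≤ n
    prime-power-∣C n i k i<n h with common-multiple n (≤-trans (s≤s z≤n) i<n)
    ... | t , d , t≤ , ∤d , c =
      ≤-trans (^-monoʳ-≤ p (^-∣⇒≤ k t ∤d (∣-trans h (∣-trans (n∣m*n (suc i)) (*C-∣ n i _ c i<n))))) t≤

    -- Induction on the row by Pascal's rule, starting in row `p`, where absorption supplies the
    -- factor `p` and `j < p` cannot cancel it. Both summands of a later row again satisfy the bound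
    -- `n < p + j`.
    prime-∣C : ∀ n j → 1 ≤ j → j < p → p ≤ n → n < p + j → p ∣ n C j
    prime-∣C zero (suc j) _ _ p≤n _ = ⊥-elim (<⇒≱ (nonTrivial⇒n>1 p) (≤-trans p≤n z≤n))
    prime-∣C (suc n) (suc j) _ j<p p≤n n<p+j with m≤n⇒m<n∨m≡n p≤n
    ... | inj₂ refl = [ (λ d → ⊥-elim (>⇒∤ j<p d)) , (λ d → d) ] (euclidsLemma (suc j) _ pr (subst (p ∣_) (sym (absorption n j)) (m∣m*n _)))
    ... | inj₁ (s≤s p≤n′) = subst (p ∣_) (nCk+nC[k+1]≡[n+1]C[k+1] n j)
            (∣m∣n⇒∣m+n (first j refl) (prime-∣C n (suc j) (s≤s z≤n) j<p p≤n′ (<-trans (n<1+n n) n<p+j)))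
      where
      n<p+j′ : n < p + j
      n<p+j′ = s≤s⁻¹ (subst (suc n <_) (+-suc p j) n<p+j)
      first : ∀ i → i ≡ j → p ∣ n C i
      first zero refl = ⊥-elim (<⇒≱ n<p+j′ (subst (_≤ n) (sym (+-identityʳ p)) p≤n′))
      first (suc i) refl = prime-∣C n (suc i) (s≤s z≤n) (<-trans (n<1+n _) j<p) p≤n′ n<p+j′

  -- Products over primes and the primorial

  ∏ₚ : (ℕ → ℕ) → ℕ → ℕ
  ∏ₚ f zero = 1
  ∏ₚ f (suc n) with prime? (suc n)
  ... | yes _ = f (suc n) * ∏ₚ f n
  ... | no _ = ∏ₚ f n

  ∃-prime-divisor : ∀ n → 2 ≤ n → ∃ λ p → Prime p × p ∣ n
  ∃-prime-divisor (suc zero) (s≤s ())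
  ∃-prime-divisor n@(suc (suc _)) _ with factorise n
  ... | record { factors = [] ; isFactorisation = () }
  ... | record { factors = p ∷ ps ; isFactorisation = eq ; factorsPrime = pr ∷ _ } = p , pr , subst (p ∣_) (sym eq) (m∣m*n _)

  -- `M` is the product of its prime power parts; each step splits off the part belonging to the
  -- largest candidate prime.
  smooth-bound : ∀ (f : ℕ → ℕ) n M .{{_ : NonZero M}} →
    (∀ {p} → Prime p → p ∣ M → p ≤ n) → (∀ {p} → Prime p → ∀ k → p ^ k ∣ M → p ^ k ≤ f p) → M ≤ ∏ₚ f n
  smooth-bound f zero (suc zero) _ _ = ≤-refl
  smooth-bound f zero M@(suc (suc _)) small _ with ∃-prime-divisor M (s≤s (s≤s z≤n))
  ... | p , pr , p∣M = ⊥-elim (<⇒≱ (nonTrivial⇒n>1 p {{prime⇒nonTrivial pr}}) (≤-trans (small pr p∣M) z≤n))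
  smooth-bound f (suc n) M small h with prime? (suc n)
  ... | no ¬pr = smooth-bound f n M (λ {p} pr d → [ s≤s⁻¹ , (λ { refl → ⊥-elim (¬pr pr) }) ] (m≤n⇒m<n∨m≡n (small pr d))) h
  ... | yes pr with p-part pr M (<-wellFounded M)
  ... | α , M′ , refl , ∤ = *-mono-≤ (h pr α (m∣m*n M′))
    (smooth-bound f n M′ {{m*n≢0⇒n≢0 (suc n ^ α)}}
      (λ pr′ d → [ s≤s⁻¹ , (λ { refl → ⊥-elim (∤ d) }) ] (m≤n⇒m<n∨m≡n (small pr′ (∣n⇒∣m*n (suc n ^ α) d))))
      (λ pr′ k d → h pr′ k (∣n⇒∣m*n (suc n ^ α) d)))

  ∏ₚ-≤^ : ∀ f X n → 1 ≤ X → (∀ p → p ≤ n → f p ≤ X) → ∏ₚ f n ≤ X ^ n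
  ∏ₚ-≤^ f X zero _ _ = ≤-refl
  ∏ₚ-≤^ f X (suc n) 1≤X h with prime? (suc n)
  ... | yes _ = *-mono-≤ (h (suc n) ≤-refl) (∏ₚ-≤^ f X n 1≤X (λ p q → h p (m≤n⇒m≤1+n q)))
  ... | no _ = ≤-trans (∏ₚ-≤^ f X n 1≤X (λ p q → h p (m≤n⇒m≤1+n q))) (m≤n*m (X ^ n) X {{>-nonZero 1≤X}})

  primorial : ℕ → ℕ
  primorial = ∏ₚ (λ p → p)

  primorial>0 : ∀ n → 0 < primorial n
  primorial>0 zero = s≤s z≤n
  primorial>0 (suc n) with prime? (suc n)
  ... | yes _ = *-mono-≤ {1} {suc n} {1} {primorial n} (s≤s z≤n) (primorial>0 n)
  ... | no _ = primorial>0 n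

  -- Chebyshev's split: up to the square root of the top of the binomial coefficient a prime power
  -- may be as large as `X`, beyond it primes occur only once and are collected in the primorial.
  -- The small primes are counted in both factors, which does no harm to an upper bound.
  ∏ₚ-split : ∀ f X s t → 1 ≤ X → (∀ p → p ≤ s → f p ≤ X) → (∀ p → s < p → f p ≤ p) →
    ∏ₚ f (t + s) ≤ X ^ s * primorial (t + s)
  ∏ₚ-split f X s zero 1≤X lo hi = ≤-trans (∏ₚ-≤^ f X s 1≤X lo) (m≤m*n (X ^ s) _ {{>-nonZero (primorial>0 s)}})
  ∏ₚ-split f X s (suc t) 1≤X lo hi with prime? (suc (t + s))
  ... | no _ = ∏ₚ-split f X s t 1≤X lo hi
  ... | yes _ = ≤-trans (*-mono-≤ (hi (suc (t + s)) (s≤s (m≤n+m s t))) (∏ₚ-split f X s t 1≤X lo hi))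
                (≤-reflexive (swap (suc (t + s)) (X ^ s) (primorial (t + s))))
    where
    swap : ∀ a b c → a * (b * c) ≡ b * (a * c)
    swap = solve-∀

  ∤-primorial : ∀ {q} → Prime q → ∀ n → n < q → ¬ q ∣ primorial n
  ∤-primorial {q} pr zero _ d = >⇒∤ (nonTrivial⇒n>1 q {{prime⇒nonTrivial pr}}) d
  ∤-primorial {q} pr (suc n) n<q d with prime? (suc n)
  ... | no _ = ∤-primorial pr n (<-trans (n<1+n n) n<q) d
  ... | yes _ = ∤-* pr (>⇒∤ n<q) (∤-primorial pr n (<-trans (n<1+n n) n<q)) d

  -- A new prime divides the product `e * primorial (t + k)` but not the primorial of smaller
  -- numbers, so it divides the cofactor `e`.
  primorial-∣ : ∀ M k t → (∀ {p} → Prime p → k < p → p ≤ t + k → p ∣ M) → primorial (t + k) ∣ primorial k * M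
  primorial-∣ M k zero h = m∣m*n M
  primorial-∣ M k (suc t) h with prime? (suc (t + k)) | primorial-∣ M k t (λ pr a b → h pr a (m≤n⇒m≤1+n b))
  ... | no _ | d = d
  ... | yes pr | divides e eq with euclidsLemma e (primorial (t + k)) pr (subst (suc (t + k) ∣_) eq (∣n⇒∣m*n (primorial k) (h pr (s≤s (m≤n+m k t)) ≤-refl)))
  ... | inj₂ d = ⊥-elim (∤-primorial pr (t + k) ≤-refl d)
  ... | inj₁ d = subst (suc (t + k) * primorial (t + k) ∣_) (sym eq) (*-monoˡ-∣ (primorial (t + k)) d)

  C≤2^ : ∀ n k → n C k ≤ 2 ^ n
  C≤2^ zero zero = ≤-refl
  C≤2^ zero (suc k) rewrite k>n⇒nCk≡0 {0} {suc k} (s≤s z≤n) = z≤n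
  C≤2^ (suc n) zero = m^n>0 2 (suc n)
  C≤2^ (suc n) (suc k) = begin
    suc n C suc k ≡⟨ nCk+nC[k+1]≡[n+1]C[k+1] n k ⟨
    n C k + n C suc k ≤⟨ +-mono-≤ (C≤2^ n k) (C≤2^ n (suc k)) ⟩
    2 ^ n + 2 ^ n ≡⟨ cong (2 ^ n +_) (+-identityʳ (2 ^ n)) ⟨
    2 ^ suc n ∎
    where open ≤-Reasoning

  -- By Pascal's rule the next central coefficient is a sum of two entries, each at least the
  -- present one. The weak base 2 is enough because the primorial will be taken only up to an eighth
  -- of `m`.
  2^≤central : ∀ m → 2 ^ m ≤ (m + m) C m
  2^≤central zero = ≤-refl
  2^≤central (suc m) rewrite +-suc m m = begin
    2 ^ m + (2 ^ m + 0) ≡⟨ cong (2 ^ m +_) (+-identityʳ (2 ^ m)) ⟩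
    2 ^ m + 2 ^ m ≤⟨ +-mono-≤ (≤-trans (2^≤central m) (lo m)) (≤-trans (2^≤central m) hi) ⟩
    suc (m + m) C m + suc (m + m) C suc m ≡⟨ nCk+nC[k+1]≡[n+1]C[k+1] (suc (m + m)) m ⟩
    suc (suc (m + m)) C suc m ∎
    where
    open ≤-Reasoning
    lo : ∀ i → (m + m) C i ≤ suc (m + m) C i
    lo zero = ≤-refl
    lo (suc i) = ≤-trans (m≤n+m _ ((m + m) C i)) (≤-reflexive (nCk+nC[k+1]≡[n+1]C[k+1] (m + m) i))
    hi : (m + m) C m ≤ suc (m + m) C suc m
    hi = ≤-trans (m≤m+n _ _) (≤-reflexive (nCk+nC[k+1]≡[n+1]C[k+1] (m + m) m))

  -- Every prime in (k, 2k] divides the central coefficient of row 2k.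
  primorial-double : ∀ k → 1 ≤ k → primorial (k + k) ≤ primorial k * 2 ^ (k + k)
  primorial-double k 1≤k = ≤-trans
    (∣⇒≤ {{>-nonZero (*-mono-≤ (primorial>0 k) (≤-trans (m^n>0 2 k) (2^≤central k)))}}
      (primorial-∣ ((k + k) C k) k k λ pr k<p p≤ → prime-∣C pr (k + k) k 1≤k k<p p≤ (+-monoˡ-< k k<p)))
    (*-monoʳ-≤ (primorial k) (C≤2^ (k + k) k))

  -- Repeated doubling adds the exponents 2 + 4 + ... + 2^i, which stay below twice 2^i.
  primorial-2^ : ∀ i → primorial (2 ^ i) ≤ 2 ^ (2 ^ i + 2 ^ i)
  primorial-2^ zero = s≤s z≤n
  primorial-2^ (suc i) rewrite +-identityʳ (2 ^ i) = begin
    primorial (y + y) ≤⟨ primorial-double y (m^n>0 2 i) ⟩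
    primorial y * 2 ^ (y + y) ≤⟨ *-monoˡ-≤ (2 ^ (y + y)) (primorial-2^ i) ⟩
    2 ^ (y + y) * 2 ^ (y + y) ≡⟨ ^-distribˡ-+-* 2 (y + y) (y + y) ⟨
    2 ^ (y + y + (y + y)) ∎
    where open ≤-Reasoning
          y = 2 ^ i

  linear<2^ : ∀ i → 8 * (4 + i) + 16 < 6 * 2 ^ (4 + i)
  linear<2^ zero = ≤ᵇ⇒≤ _ _ _
  linear<2^ (suc i) = begin-strict
    8 * (5 + i) + 16 ≡⟨ eq i ⟩
    (8 * (4 + i) + 16) + 8 <⟨ +-mono-<-≤ (linear<2^ i) (≤-trans (m≤m+n 8 40) (≤-trans (m≤n+m 48 (8 * i)) (≤-trans (≤-reflexive (eq′ i)) (<⇒≤ (linear<2^ i))))) ⟩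
    6 * 2 ^ (4 + i) + 6 * 2 ^ (4 + i) ≡⟨ *-distribˡ-+ 6 (2 ^ (4 + i)) (2 ^ (4 + i)) ⟨
    6 * (2 ^ (4 + i) + 2 ^ (4 + i)) ≡⟨ cong (λ t → 6 * (2 ^ (4 + i) + t)) (+-identityʳ (2 ^ (4 + i))) ⟨
    6 * 2 ^ (5 + i) ∎
    where
    open ≤-Reasoning
    eq : ∀ i → 8 * (5 + i) + 16 ≡ (8 * (4 + i) + 16) + 8
    eq = solve-∀
    eq′ : ∀ i → 8 * i + 48 ≡ 8 * (4 + i) + 16
    eq′ = solve-∀

  -- A prime between y² and 16y²

  module _ (i : ℕ) where
    private
      j = 4 + i
      y = 2 ^ j
      -- With this `m` the row 2m = 16y² is the square of `s` = 4y, and the lower bound 2^(8y²)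
      -- leaves room for the factor 2^(2y²) of the primorial of y².
      m = 8 * (y * y)
      s = 4 * y
      X = m + m
      M = X C m

      instance
        y≢0 : NonZero y
        y≢0 = >-nonZero (m^n>0 2 j)

      2^2j : 2 ^ (j + j) ≡ y * y
      2^2j = ^-distribˡ-+-* 2 j j

      X≡s² : X ≡ s * s
      X≡s² = h y where
        h : ∀ y → 8 * (y * y) + 8 * (y * y) ≡ 4 * y * (4 * y)
        h = solve-∀

      X≡2^ : X ≡ 2 ^ (4 + (j + j))
      X≡2^ = trans (h y) (sym (trans (^-distribˡ-+-* 2 4 (j + j)) (cong (16 *_) 2^2j))) where
        h : ∀ y → 8 * (y * y) + 8 * (y * y) ≡ 16 * (y * y)
        h = solve-∀

      m>0 : 0 < m
      m>0 = *-mono-≤ {1} {8} (s≤s z≤n) (*-mono-≤ (m^n>0 2 j) (m^n>0 2 j))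

      power≤X : ∀ {p} → Prime p → ∀ k → p ^ k ∣ M → p ^ k ≤ X
      power≤X pr k h with m | m>0
      ... | suc m′ | _ = prime-power-∣C pr _ m′ k (m≤m+n (suc m′) _) h

      f : ℕ → ℕ
      f p with p ≤? s
      ... | yes _ = X
      ... | no _ = p

      bound : ∀ {p} → Prime p → ∀ k → p ^ k ∣ M → p ^ k ≤ f p
      bound {p} pr k h with p ≤? s
      ... | yes _ = power≤X pr k h
      ... | no p≰s with k ≤? 1
      ...   | yes k≤1 = ≤-trans (^-monoʳ-≤ p {{prime⇒nonZero pr}} k≤1) (≤-reflexive (^-identityʳ p))
      ...   | no k≰1 = ⊥-elim (<⇒≱ (*-mono-< (≰⇒> p≰s) (≰⇒> p≰s)) (begin
          p * p ≡⟨ cong (p *_) (sym (^-identityʳ p)) ⟩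
          p ^ 2 ≤⟨ ^-monoʳ-≤ p {{prime⇒nonZero pr}} (≰⇒> k≰1) ⟩
          p ^ k ≤⟨ power≤X pr k h ⟩
          X ≡⟨ X≡s² ⟩
          s * s ∎))
        where open ≤-Reasoning

      f-lo : ∀ p → p ≤ s → f p ≤ X
      f-lo p p≤s with p ≤? s
      ... | yes _ = ≤-refl
      ... | no p≰s = ⊥-elim (p≰s p≤s)

      f-hi : ∀ p → s < p → f p ≤ p
      f-hi p s<p with p ≤? s
      ... | yes p≤s = ⊥-elim (<⇒≱ s<p p≤s)
      ... | no _ = ≤-refl

      s≤y² : s ≤ y * y
      s≤y² = *-monoˡ-≤ y (≤-trans (^-monoʳ-≤ 2 {2} {j} (s≤s (s≤s z≤n))) ≤-refl)

      -- In powers of two, 8y² would be at most (4 + 2j)4y + 2y², that is 6y ≤ 8j + 16, against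
      -- `linear<2^`.
      absurd-bound : M ≤ X ^ s * primorial (y * y) → ⊥
      absurd-bound h = <⇒≱ exponents (2^-cancel (begin
        2 ^ m ≤⟨ 2^≤central m ⟩
        M ≤⟨ h ⟩
        X ^ s * primorial (y * y) ≤⟨ *-monoʳ-≤ (X ^ s) (subst (λ t → primorial t ≤ 2 ^ (t + t)) 2^2j (primorial-2^ (j + j))) ⟩
        X ^ s * 2 ^ (y * y + y * y) ≡⟨ cong (λ t → t ^ s * 2 ^ (y * y + y * y)) X≡2^ ⟩
        (2 ^ (4 + (j + j))) ^ s * 2 ^ (y * y + y * y) ≡⟨ cong (_* 2 ^ (y * y + y * y)) (^-*-assoc 2 (4 + (j + j)) s) ⟩
        2 ^ ((4 + (j + j)) * s) * 2 ^ (y * y + y * y) ≡⟨ ^-distribˡ-+-* 2 ((4 + (j + j)) * s) (y * y + y * y) ⟨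
        2 ^ ((4 + (j + j)) * s + (y * y + y * y)) ∎))
        where
        open ≤-Reasoning
        2^-cancel : ∀ {a b} → 2 ^ a ≤ 2 ^ b → a ≤ b
        2^-cancel {a} {b} h = ≮⇒≥ λ b<a → <⇒≱ (^-monoʳ-< 2 (s≤s (s≤s z≤n)) b<a) h
        eq₁ : ∀ j y → (4 + (j + j)) * (4 * y) + (y * y + y * y) ≡ (8 * j + 16) * y + 2 * (y * y)
        eq₁ = solve-∀
        eq₂ : ∀ y → 6 * y * y + 2 * (y * y) ≡ 8 * (y * y)
        eq₂ = solve-∀
        exponents : (4 + (j + j)) * s + (y * y + y * y) < m
        exponents = begin-strict
          (4 + (j + j)) * s + (y * y + y * y) ≡⟨ eq₁ j y ⟩
          (8 * j + 16) * y + 2 * (y * y) <⟨ +-monoˡ-< (2 * (y * y)) (*-monoˡ-< y (linear<2^ i)) ⟩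
          6 * y * y + 2 * (y * y) ≡⟨ eq₂ y ⟩
          m ∎

    -- Prime factors of `M` are at most `X` = 16y². If none lay above y², the split at `s` would
    -- bound `M` by the primorial of y² times `X ^ s`, which is too small.
    prime-between : ∃ λ p → Prime p × y * y < p × p ≤ 16 * (y * y)
    prime-between with anyUpTo? (λ p → prime? p ×-dec (y * y <? p)) (suc X)
    ... | yes (p , s≤s p≤X , pr , lo) = p , pr , lo , ≤-trans p≤X (≤-reflexive (h y))
      where
      h : ∀ y → 8 * (y * y) + 8 * (y * y) ≡ 16 * (y * y)
      h = solve-∀
    ... | no ∄ = ⊥-elim (absurd-bound (≤-trans
        (smooth-bound f (y * y) M {{>-nonZero (≤-trans (m^n>0 2 m) (2^≤central m))}} small bound)
        (subst (λ t → ∏ₚ f t ≤ X ^ s * primorial t) (m∸n+n≡m s≤y²)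
          (∏ₚ-split f X s (y * y ∸ s) (≤-trans m>0 (m≤m+n m m)) f-lo f-hi))))
      where
      small : ∀ {p} → Prime p → p ∣ M → p ≤ y * y
      small {p} pr d = ≮⇒≥ λ lo → ∄ (p , s≤s (subst (_≤ X) (^-identityʳ p) (power≤X pr 1 (subst (_∣ M) (sym (^-identityʳ p)) d))) , pr , lo)

-- Closed polygons over a cubic norm ring

module CubicNorm where
  open import Level using (0ℓ)
  open import Algebra.Bundles using (CommutativeRing; RawRing)
  open import Algebra.Solver.Ring.AlmostCommutativeRing using (fromCommutativeRing; _-Raw-AlmostCommutative⟶_)
  import Algebra.Solver.Ring as RingSolver
  import Algebra.Solver.CommutativeMonoid as CommutativeMonoidSolver
  open import Data.Nat.Base using (zero; suc)
  open import Data.Integer.Base as ℤ using (ℤ; 0ℤ; 1ℤ)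
  import Data.Integer.Properties as ℤ
  open import Data.Fin.Base using (Fin; zero; suc)
  open import Data.Fin.Patterns using (0F; 1F; 2F; 3F; 4F)
  open import Data.Maybe using (Maybe; just; nothing)
  open import Data.Sum using (_⊎_; inj₁; inj₂; [_,_]′)
  open import Data.Empty using (⊥; ⊥-elim)
  open import Relation.Nullary using (¬_; yes; no)
  import Relation.Binary.PropositionalEquality as ≡

  -- A cubic extension: x ♯ is the adjoint of x, so that x * x ♯ is its norm; _⋇_ is the polarisation
  -- of _♯, T is the trace form and ι embeds the scalars.
  record CubicNormRing : Set₁ where
    field
      commutativeRing : CommutativeRing 0ℓ 0ℓ
    open CommutativeRing commutativeRing public
    infixl 7 _⋇_
    infix 8 _♯
    field
      ι    : ℤ → Carrier
      ι-+  : ∀ m n → ι (m ℤ.+ n) ≈ ι m + ι n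
      ι-*  : ∀ m n → ι (m ℤ.* n) ≈ ι m * ι n
      ι-neg : ∀ m → ι (ℤ.- m) ≈ - ι m
      ι-0  : ι 0ℤ ≈ 0#
      ι-1  : ι 1ℤ ≈ 1#

      _♯  : Carrier → Carrier
      _⋇_ : Carrier → Carrier → Carrier
      T   : Carrier → Carrier → Carrier
      norm : Carrier → ℤ

      ♯-cong  : ∀ {x y} → x ≈ y → x ♯ ≈ y ♯
      ⋇-congˡ : ∀ {x y z} → x ≈ y → x ⋇ z ≈ y ⋇ z
      T-congˡ : ∀ {x y z} → x ≈ y → T x z ≈ T y z

      ♯-+     : ∀ x y → (x + y) ♯ ≈ x ♯ + x ⋇ y + y ♯
      ♯-scale : ∀ n x → (ι n * x) ♯ ≈ ι n * ι n * x ♯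
      ♯-*     : ∀ x y → (x * y) ♯ ≈ x ♯ * y ♯
      *-♯     : ∀ x → x * x ♯ ≈ ι (norm x)

      ⋇-comm   : ∀ x y → x ⋇ y ≈ y ⋇ x
      ⋇-+ˡ     : ∀ x y z → (x + y) ⋇ z ≈ x ⋇ z + y ⋇ z
      ⋇-scaleˡ : ∀ n x z → (ι n * x) ⋇ z ≈ ι n * (x ⋇ z)

      T-comm   : ∀ x y → T x y ≈ T y x
      T-+ˡ     : ∀ x y z → T (x + y) z ≈ T x z + T y z
      T-scaleˡ : ∀ n x z → T (ι n * x) z ≈ ι n * T x z
      T-♯      : ∀ x y → T (x ♯) y ≈ x * (x ⋇ y) + x ♯ * y
      T-⋇      : ∀ x y z → T x (y ⋇ z) ≈ T (x ⋇ y) z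

      domain    : ∀ x y → x * y ≈ 0# → x ≈ 0# ⊎ y ≈ 0#
      ♯-reflects-0 : ∀ x → x ♯ ≈ 0# → x ≈ 0#
      halve     : ∀ x → x + x ≈ 0# → x ≈ 0#

  module Polygons (R : CubicNormRing) where
    open CubicNormRing R
    open import Relation.Binary.Reasoning.Setoid setoid
    open import Algebra.Properties.Semiring.Sum semiring using (sum; sum-cong-≋; ∑-distrib-+)

    private
      ℤ-raw : RawRing 0ℓ 0ℓ
      ℤ-raw = record { Carrier = ℤ ; _≈_ = ≡._≡_ ; _+_ = ℤ._+_ ; _*_ = ℤ._*_ ; -_ = ℤ.-_ ; 0# = 0ℤ ; 1# = 1ℤ }

      ι-morphism : ℤ-raw -Raw-AlmostCommutative⟶ fromCommutativeRing commutativeRing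
      ι-morphism = record { ⟦_⟧ = ι ; +-homo = ι-+ ; *-homo = ι-* ; -‿homo = ι-neg ; 0-homo = ι-0 ; 1-homo = ι-1 }

      ι≟ : ∀ m n → Maybe (ι m ≈ ι n)
      ι≟ m n with m ℤ.≟ n
      ... | yes eq = just (reflexive (≡.cong ι eq))
      ... | no _ = nothing

    open RingSolver ℤ-raw (fromCommutativeRing commutativeRing) ι-morphism ι≟
      using (solve; _:=_; _:+_; _:*_; _:-_; :-_; con)

    private
      module Monomials = CommutativeMonoidSolver *-commutativeMonoid
    open Monomials using (_⊜_) renaming (_⊕_ to _•_)

    infixr 6 _⊕_
    infixr 7 _⊙_

    -- Most identities below are proved in one pattern: the solver, to which `_♯`, `_⋇_` and `T` are
    -- opaque atoms, writes a difference as a combination of differences of equal terms, and `_⊕_`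
    -- and `_⊙_` make the combination vanish.
    _⊕_ : ∀ {x y} → x ≈ 0# → y ≈ 0# → x + y ≈ 0#
    p ⊕ q = trans (+-cong p q) (+-identityˡ 0#)

    _⊙_ : ∀ c {x} → x ≈ 0# → c * x ≈ 0#
    c ⊙ p = trans (*-congˡ p) (zeroʳ c)

    diff : ∀ {x y} → x ≈ y → x - y ≈ 0#
    diff {x} {y} p = trans (+-congʳ p) (-‿inverseʳ y)

    undiff : ∀ {x y} → x - y ≈ 0# → x ≈ y
    undiff {x} {y} p = begin
      x ≈⟨ solve 2 (λ x y → x := x :- y :+ y) refl x y ⟩
      x - y + y ≈⟨ +-congʳ p ⟩
      0# + y ≈⟨ +-identityˡ y ⟩
      y ∎

    record Linear (f : Carrier → Carrier) : Set where
      field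
        f-cong : ∀ {x y} → x ≈ y → f x ≈ f y
        f-+ : ∀ x y → f (x + y) ≈ f x + f y
        f-scale : ∀ n x → f (ι n * x) ≈ ι n * f x

      f-0 : f 0# ≈ 0#
      f-0 = begin
        f 0# ≈⟨ f-cong (sym (zeroʳ (ι 0ℤ))) ⟩
        f (ι 0ℤ * 0#) ≈⟨ f-scale 0ℤ 0# ⟩
        ι 0ℤ * f 0# ≈⟨ *-congʳ ι-0 ⟩
        0# * f 0# ≈⟨ zeroˡ _ ⟩
        0# ∎

      f-neg : ∀ x → f (- x) ≈ - f x
      f-neg x = begin
        f (- x) ≈⟨ f-cong (solve 1 (λ x → :- x := con (ℤ.- 1ℤ) :* x) refl x) ⟩
        f (ι (ℤ.- 1ℤ) * x) ≈⟨ f-scale (ℤ.- 1ℤ) x ⟩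
        ι (ℤ.- 1ℤ) * f x ≈⟨ solve 1 (λ x → con (ℤ.- 1ℤ) :* x := :- x) refl (f x) ⟩
        - f x ∎

      f-- : ∀ x y → f (x - y) ≈ f x - f y
      f-- x y = trans (f-+ x (- y)) (+-congˡ (f-neg y))

      f-vanish : ∀ {x} → x ≈ 0# → f x ≈ 0#
      f-vanish p = trans (f-cong p) f-0

    open Linear

    ⋇-congʳ : ∀ {x y z} → x ≈ y → z ⋇ x ≈ z ⋇ y
    ⋇-congʳ p = trans (⋇-comm _ _) (trans (⋇-congˡ p) (⋇-comm _ _))

    T-congʳ : ∀ {x y z} → x ≈ y → T z x ≈ T z y
    T-congʳ p = trans (T-comm _ _) (trans (T-congˡ p) (T-comm _ _))

    ⋇ˡ : ∀ z → Linear (_⋇ z)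
    ⋇ˡ z = record { f-cong = ⋇-congˡ ; f-+ = λ x y → ⋇-+ˡ x y z ; f-scale = λ n x → ⋇-scaleˡ n x z }

    ⋇ʳ : ∀ z → Linear (z ⋇_)
    ⋇ʳ z = record
      { f-cong = ⋇-congʳ
      ; f-+ = λ x y → trans (⋇-comm z _) (trans (⋇-+ˡ x y z) (+-cong (⋇-comm x z) (⋇-comm y z)))
      ; f-scale = λ n x → trans (⋇-comm z _) (trans (⋇-scaleˡ n x z) (*-congˡ (⋇-comm x z))) }

    Tˡ : ∀ z → Linear (λ x → T x z)
    Tˡ z = record { f-cong = T-congˡ ; f-+ = λ x y → T-+ˡ x y z ; f-scale = λ n x → T-scaleˡ n x z }

    Tʳ : ∀ z → Linear (T z)
    Tʳ z = record
      { f-cong = T-congʳ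
      ; f-+ = λ x y → trans (T-comm z _) (trans (T-+ˡ x y z) (+-cong (T-comm x z) (T-comm y z)))
      ; f-scale = λ n x → trans (T-comm z _) (trans (T-scaleˡ n x z) (*-congˡ (T-comm x z))) }

    two : Carrier → Carrier
    two x = x + x

    ♯-0 : 0# ♯ ≈ 0#
    ♯-0 = trans (♯-cong (sym (zeroʳ (ι 0ℤ)))) (trans (♯-scale 0ℤ 0#) (trans (*-congʳ (trans (*-congʳ ι-0) (zeroˡ _))) (zeroˡ _)))

    ♯-vanish : ∀ {x} → x ≈ 0# → x ♯ ≈ 0#
    ♯-vanish p = trans (♯-cong p) ♯-0

    ♯-neg : ∀ x → (- x) ♯ ≈ x ♯
    ♯-neg x = begin
      (- x) ♯ ≈⟨ ♯-cong (solve 1 (λ x → :- x := con (ℤ.- 1ℤ) :* x) refl x) ⟩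
      (ι (ℤ.- 1ℤ) * x) ♯ ≈⟨ ♯-scale (ℤ.- 1ℤ) x ⟩
      ι (ℤ.- 1ℤ) * ι (ℤ.- 1ℤ) * x ♯ ≈⟨ solve 1 (λ x → con (ℤ.- 1ℤ) :* con (ℤ.- 1ℤ) :* x := x) refl (x ♯) ⟩
      x ♯ ∎

    -- `(x + x) ♯` computed by polarisation and by scaling with 2 gives 2x♯ + x ⋇ x = 4x♯.
    ⋇-self : ∀ x → x ⋇ x ≈ two (x ♯)
    ⋇-self x = undiff (begin
      x ⋇ x - two (x ♯) ≈⟨ solve 4 (λ m s d e → m :- (s :+ s) := con (ℤ.- 1ℤ) :* (d :- (s :+ m :+ s)) :+ (d :- (con (ℤ.+ 2) :* con (ℤ.+ 2)) :* s)) refl (x ⋇ x) (x ♯) ((x + x) ♯) 0# ⟩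
      ι (ℤ.- 1ℤ) * ((x + x) ♯ - (x ♯ + x ⋇ x + x ♯)) + ((x + x) ♯ - (ι (ℤ.+ 2) * ι (ℤ.+ 2)) * x ♯)
        ≈⟨ (_ ⊙ diff (♯-+ x x)) ⊕ diff (trans (♯-cong (solve 1 (λ x → x :+ x := con (ℤ.+ 2) :* x) refl x)) (♯-scale (ℤ.+ 2) x)) ⟩
      0# ∎)

    N : Carrier → Carrier
    N x = x * x ♯

    N-cong : ∀ {x y} → x ≈ y → N x ≈ N y
    N-cong p = *-cong p (♯-cong p)

    N-+ : ∀ x y → N (x + y) ≈ N x + T (x ♯) y + T (y ♯) x + N y
    N-+ x y = undiff (begin
      N (x + y) - (N x + T (x ♯) y + T (y ♯) x + N y)
        ≈⟨ solve 9 (λ x y xs ys m m′ s t t′ →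
             (x :+ y) :* s :- (x :* xs :+ t :+ t′ :+ y :* ys) :=
             (x :+ y) :* (s :- (xs :+ m :+ ys)) :+ (y :* (m :- m′)
               :+ (con (ℤ.- 1ℤ) :* (t :- (x :* m :+ xs :* y)) :+ con (ℤ.- 1ℤ) :* (t′ :- (y :* m′ :+ ys :* x)))))
             refl x y (x ♯) (y ♯) (x ⋇ y) (y ⋇ x) ((x + y) ♯) (T (x ♯) y) (T (y ♯) x) ⟩
      _ ≈⟨ ((x + y) ⊙ diff (♯-+ x y)) ⊕ (y ⊙ diff (⋇-comm x y)) ⊕ (_ ⊙ diff (T-♯ x y)) ⊕ (_ ⊙ diff (T-♯ y x)) ⟩
      0# ∎)

    -- Along a segment from u to u + x the height h + α (u - ·) is affine with slope -α; these are
    -- the integrals of h and of h ♯ along it.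
    area-term : ℤ → Carrier → Carrier → Carrier → Carrier
    area-term α k X Y = k ⋇ X - ι α * Y

    moment-term : ℤ → Carrier → Carrier → Carrier → Carrier → Carrier
    moment-term α k X Y W = T (k ♯) X - ι α * T k Y + ι α * ι α * W

    -- The intercept `h + ι α * u` is constant along the segment, so it can be read off at the
    -- shared vertex. Expressed by the height `h` at the starting point instead, the area, and
    -- likewise the moment below, no longer depends on the position `u`.
    area-segment : ∀ α h u x → area-term α (h + ι α * u) x ((u + x) ♯ - u ♯) ≈ h ⋇ x - ι α * x ♯
    area-segment α h u x = undiff (begin
      _ ≈⟨ solve 8 (λ A hx ux us xs s m m′ →
             (m :- A :* (s :- us)) :- (hx :- A :* xs) :=
             (m :- (hx :+ m′)) :+ ((m′ :- A :* ux) :+ (:- A) :* (s :- (us :+ ux :+ xs))))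
           refl (ι α) (h ⋇ x) (u ⋇ x) (u ♯) (x ♯) ((u + x) ♯) ((h + ι α * u) ⋇ x) ((ι α * u) ⋇ x) ⟩
      _ ≈⟨ diff (⋇-+ˡ h (ι α * u) x) ⊕ diff (⋇-scaleˡ α u x) ⊕ (_ ⊙ diff (♯-+ u x)) ⟩
      0# ∎)

    moment-segment : ∀ α h u x → moment-term α (h + ι α * u) x ((u + x) ♯ - u ♯) (N (u + x) - N u)
                               ≈ moment-term α h x (x ♯) (N x)
    moment-segment α h u x = begin
      T (k ♯) x - A * T k Y + A * A * (N (u + x) - N u)
        ≈⟨ +-cong (+-cong e₁ (-‿cong (*-congˡ e₂))) (*-congˡ (+-congʳ (N-+ u x))) ⟩
      (T (h ♯) x + A * T h (u ⋇ x) + A * A * T (u ♯) x)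
        - A * (T h (u ⋇ x) + T h (x ♯) + A * (two (T (u ♯) x) + T u (x ♯)))
        + A * A * (N u + T (u ♯) x + T (x ♯) u + N x - N u)
        ≈⟨ +-congˡ (*-congˡ (+-congʳ (+-congʳ (+-congˡ (T-comm (x ♯) u))))) ⟩
      (T (h ♯) x + A * T h (u ⋇ x) + A * A * T (u ♯) x)
        - A * (T h (u ⋇ x) + T h (x ♯) + A * (two (T (u ♯) x) + T u (x ♯)))
        + A * A * (N u + T (u ♯) x + T u (x ♯) + N x - N u)
        ≈⟨ solve 8 (λ A a b c d e f g →
            (a :+ A :* b :+ A :* A :* c) :- A :* (b :+ d :+ A :* ((c :+ c) :+ e)) :+ A :* A :* (f :+ c :+ e :+ g :- f)
            := a :- A :* d :+ A :* A :* g) refl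
            A (T (h ♯) x) (T h (u ⋇ x)) (T (u ♯) x) (T h (x ♯)) (T u (x ♯)) (N u) (N x) ⟩
      T (h ♯) x - A * T h (x ♯) + A * A * N x ∎
      where
      A = ι α
      k = h + A * u
      Y = (u + x) ♯ - u ♯
      e₁ : T (k ♯) x ≈ T (h ♯) x + A * T h (u ⋇ x) + A * A * T (u ♯) x
      e₁ = begin
        T (k ♯) x ≈⟨ T-congˡ (♯-+ h (A * u)) ⟩
        T (h ♯ + h ⋇ (A * u) + (A * u) ♯) x ≈⟨ trans (T-+ˡ _ _ x) (+-congʳ (T-+ˡ _ _ x)) ⟩
        T (h ♯) x + T (h ⋇ (A * u)) x + T ((A * u) ♯) x
          ≈⟨ +-cong (+-congˡ (trans (T-congˡ (f-scale (⋇ʳ h) α u)) (trans (T-scaleˡ α _ x) (*-congˡ (sym (T-⋇ h u x))))))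
                    (trans (T-congˡ (trans (♯-scale α u) (*-assoc A A (u ♯)))) (trans (T-scaleˡ α _ x) (trans (*-congˡ (T-scaleˡ α _ x)) (sym (*-assoc A A _))))) ⟩
        T (h ♯) x + A * T h (u ⋇ x) + A * A * T (u ♯) x ∎
      Y≈ : Y ≈ u ⋇ x + x ♯
      Y≈ = trans (+-congʳ (♯-+ u x)) (solve 3 (λ a b c → a :+ b :+ c :- a := b :+ c) refl (u ♯) (u ⋇ x) (x ♯))
      Tuux : T u (u ⋇ x) ≈ two (T (u ♯) x)
      Tuux = trans (T-⋇ u u x) (trans (T-congˡ (⋇-self u)) (T-+ˡ _ _ x))
      e₂ : T k Y ≈ T h (u ⋇ x) + T h (x ♯) + A * (two (T (u ♯) x) + T u (x ♯))
      e₂ = begin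
        T k Y ≈⟨ T-+ˡ h (A * u) Y ⟩
        T h Y + T (A * u) Y ≈⟨ +-cong (T-congʳ Y≈) (trans (T-scaleˡ α u Y) (*-congˡ (T-congʳ Y≈))) ⟩
        T h (u ⋇ x + x ♯) + A * T u (u ⋇ x + x ♯) ≈⟨ +-cong (f-+ (Tʳ h) _ _) (*-congˡ (trans (f-+ (Tʳ u) _ _) (+-congʳ Tuux))) ⟩
        T h (u ⋇ x) + T h (x ♯) + A * (two (T (u ♯) x) + T u (x ♯)) ∎

    contribution : ℤ → Carrier → Carrier → Carrier → Carrier → Carrier
    contribution α k u u′ s = s * area-term α k (u′ - u) (u′ ♯ - u ♯) - moment-term α k (u′ - u) (u′ ♯ - u ♯) (N u′ - N u)

    area-term-cong : ∀ α {k k′ X X′ Y Y′} → k ≈ k′ → X ≈ X′ → Y ≈ Y′ → area-term α k X Y ≈ area-term α k′ X′ Y′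
    area-term-cong α p q r = +-cong (trans (⋇-congˡ p) (⋇-congʳ q)) (-‿cong (*-congˡ r))

    moment-term-cong : ∀ α {k k′ X X′ Y Y′ W W′} → k ≈ k′ → X ≈ X′ → Y ≈ Y′ → W ≈ W′ →
      moment-term α k X Y W ≈ moment-term α k′ X′ Y′ W′
    moment-term-cong α p q r s = +-cong (+-cong (trans (T-congˡ (♯-cong p)) (T-congʳ q)) (-‿cong (*-congˡ (trans (T-congˡ p) (T-congʳ r))))) (*-congˡ s)

    -- `T-♯` turns the traces into products in E. Since `h - ι α * x` is the height at the end, the
    -- first product vanishes for a segment ending at height `s`, and the second for one starting at
    -- height 0.
    contribution-≈ : ∀ α {k} h u u′ s → k ≈ h + ι α * u → let x = u′ - u in
      contribution α k u u′ s ≈ (s - (h - ι α * x)) * (h ⋇ x - ι α * x ♯) - h ♯ * x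
    contribution-≈ α {k} h u u′ s k≈ = begin
      s * area-term α k x (u′ ♯ - u ♯) - moment-term α k x (u′ ♯ - u ♯) (N u′ - N u)
        ≈⟨ +-cong (*-congˡ (trans (area-term-cong α k≈ refl (+-congʳ (♯-cong u′≈))) (area-segment α h u x)))
                  (-‿cong (trans (moment-term-cong α k≈ refl (+-congʳ (♯-cong u′≈)) (+-congʳ (N-cong u′≈))) (moment-segment α h u x))) ⟩
      s * (h ⋇ x - A * x ♯) - (T (h ♯) x - A * T h (x ♯) + A * A * (x * x ♯))
        ≈⟨ +-congˡ (-‿cong (+-congʳ (+-cong (T-♯ h x) (-‿cong (*-congˡ (trans (T-comm h (x ♯)) (trans (T-♯ x h) (+-congʳ (*-congˡ (⋇-comm x h))))))))))  ⟩
      s * (h ⋇ x - A * x ♯) - (h * (h ⋇ x) + h ♯ * x - A * (x * (h ⋇ x) + x ♯ * h) + A * A * (x * x ♯))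
        ≈⟨ solve 7 (λ A s h x m hs xs →
            s :* (m :- A :* xs) :- (h :* m :+ hs :* x :- A :* (x :* m :+ xs :* h) :+ A :* A :* (x :* xs))
            := (s :- (h :- A :* x)) :* (m :- A :* xs) :- hs :* x) refl A s h x (h ⋇ x) (h ♯) (x ♯) ⟩
      (s - (h - A * x)) * (h ⋇ x - A * x ♯) - h ♯ * x ∎
      where
      A = ι α
      x = u′ - u
      u′≈ : u′ ≈ u + x
      u′≈ = solve 2 (λ u u′ → u′ := u :+ (u′ :- u)) refl u u′

    contribution-reverse : ∀ α k u u′ s → contribution α k u u′ s ≈ - contribution α k u′ u s
    contribution-reverse α k u u′ s = begin
      s * (k ⋇ (u′ - u) - A * (u′ ♯ - u ♯)) - (T (k ♯) (u′ - u) - A * T k (u′ ♯ - u ♯) + A * A * (N u′ - N u))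
        ≈⟨ +-cong (*-congˡ (+-congʳ (neg (⋇ʳ k) u u′))) (-‿cong (+-congʳ (+-cong (neg (Tʳ (k ♯)) u u′) (-‿cong (*-congˡ (neg (Tʳ k) (u ♯) (u′ ♯))))))) ⟩
      _ ≈⟨ solve 9 (λ A s a b c d e f g →
             s :* (:- a :- A :* (b :- c)) :- (:- d :- A :* (:- e) :+ A :* A :* (f :- g))
             := :- (s :* (a :- A :* (c :- b)) :- (d :- A :* e :+ A :* A :* (g :- f))))
           refl A s (k ⋇ (u - u′)) (u′ ♯) (u ♯) (T (k ♯) (u - u′)) (T k (u ♯ - u′ ♯)) (N u′) (N u) ⟩
      - contribution α k u′ u s ∎
      where
      A = ι α
      neg : ∀ {f} → Linear f → ∀ x y → f (y - x) ≈ - f (x - y)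
      neg L x y = trans (f-cong L (solve 2 (λ x y → y :- x := :- (x :- y)) refl x y)) (f-neg L _)

    -- Two consecutive segments starting on the base line (height 0) and ending at height s.
    path-contribution : ∀ α β {k m} u₀ u₁ u₂ s → let x = u₁ - u₀ ; y = u₂ - u₁ in
      k ≈ ι α * u₀ → m ≈ - (ι α * x) + ι β * u₁ → s ≈ - (ι α * x) - ι β * y →
      contribution α k u₀ u₁ s + contribution β m u₁ u₂ s ≈ ι α * (ι β - ι α) * (x ♯ * y)
    path-contribution α β {k} {m} u₀ u₁ u₂ s k≈ m≈ s≈ = begin
      contribution α k u₀ u₁ s + contribution β m u₁ u₂ s
        ≈⟨ +-cong (contribution-≈ α (ι 0ℤ) u₀ u₁ s (trans k≈ (sym (trans (+-congʳ ι-0) (+-identityˡ _))))) (contribution-≈ β (- (A * x)) u₁ u₂ s m≈) ⟩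
      ((s - (ι 0ℤ - A * x)) * (ι 0ℤ ⋇ x - A * x ♯) - ι 0ℤ ♯ * x) + ((s - (- (A * x) - B * y)) * ((- (A * x)) ⋇ y - B * y ♯) - (- (A * x)) ♯ * y)
        -- The first segment contributes (s + αx)(-αx♯) with s + αx = -βy; the second contributes
        -- only -(αx)♯ y.
        ≈⟨ undiff (begin
          _ ≈⟨ solve 11 (λ A B s x y xs ys p q r m →
                ((s :- (con 0ℤ :- A :* x)) :* (p :- A :* xs) :- q :* x) :+ ((s :- (:- (A :* x) :- B :* y)) :* (m :- B :* ys) :- r :* y)
                  :- A :* (B :- A) :* (xs :* y)
                := ((m :- B :* ys) :- A :* xs) :* (s :- (:- (A :* x) :- B :* y))
                   :+ ((s :+ A :* x) :* p :+ ((:- x) :* q :+ (:- y) :* (r :- A :* A :* xs))))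
                refl A B s x y (x ♯) (y ♯) (ι 0ℤ ⋇ x) (ι 0ℤ ♯) ((- (A * x)) ♯) ((- (A * x)) ⋇ y) ⟩
          _ ≈⟨ (_ ⊙ diff s≈) ⊕ (_ ⊙ f-vanish (⋇ˡ x) ι-0) ⊕ (_ ⊙ ♯-vanish ι-0) ⊕ (_ ⊙ diff (trans (♯-neg (A * x)) (♯-scale α x))) ⟩
          0# ∎) ⟩
      A * (B - A) * (x ♯ * y) ∎
      where
      A = ι α
      B = ι β
      x = u₁ - u₀
      y = u₂ - u₁

    relative-area : ∀ a b q p X Y → area-term (a ℤ.- b) (q - p) X Y ≈ area-term a q X Y + (- (p ⋇ X) + ι b * Y)
    relative-area a b q p X Y = begin
      (q - p) ⋇ X - ι (a ℤ.- b) * Y ≈⟨ +-cong (f-- (⋇ˡ X) q p) (-‿cong (*-congʳ (trans (ι-+ a (ℤ.- b)) (+-congˡ (ι-neg b))))) ⟩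
      q ⋇ X - p ⋇ X - (ι a - ι b) * Y ≈⟨ solve 5 (λ A B Y m n → m :- n :- (A :- B) :* Y := (m :- A :* Y) :+ (:- n :+ B :* Y)) refl (ι a) (ι b) Y (q ⋇ X) (p ⋇ X) ⟩
      _ ∎

    -- The coefficient of `ι b` when the slope of the moment is lowered from `a` to `a - b`.
    cross-term : ℤ → Carrier → Carrier → Carrier → Carrier
    cross-term a q Y W = T q Y - two (ι a * W)

    -- Apart from `cross-term`, each correction is a fixed linear image of the area or of an
    -- increment of `u`, `u ♯` or `N u`, and so sums to zero around a polygon. The cross term is
    -- what the coordinate `z` has to close.
    relative-moment : ∀ a b q p X Y W → moment-term (a ℤ.- b) (q - p) X Y W ≈
      moment-term a q X Y W + (ι b * cross-term a q Y W + (- T p (area-term a q X Y) + (T (p ♯) X + (- (ι b * T p Y) + ι b * ι b * W))))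
    relative-moment a b q p X Y W = begin
      T ((q - p) ♯) X - ι (a ℤ.- b) * T (q - p) Y + ι (a ℤ.- b) * ι (a ℤ.- b) * W
        ≈⟨ +-cong (+-cong e₁ (-‿cong (*-cong ι- (f-- (Tˡ Y) q p)))) (*-congʳ (*-cong ι- ι-)) ⟩
      (T (q ♯) X - T p (q ⋇ X) + T (p ♯) X) - (A - B) * (T q Y - T p Y) + (A - B) * (A - B) * W
        ≈⟨ undiff (trans (solve 9 (λ A B W a b c d e f →
             (a :- b :+ c) :- (A :- B) :* (d :- e) :+ (A :- B) :* (A :- B) :* W
             :- ((a :- A :* d :+ A :* A :* W) :+ (B :* (d :- (A :* W :+ A :* W)) :+ (:- f :+ (c :+ (:- (B :* e) :+ B :* B :* W)))))
             := f :- (b :- A :* e)) refl A B W (T (q ♯) X) (T p (q ⋇ X)) (T (p ♯) X) (T q Y) (T p Y) (T p (area-term a q X Y)))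
             (diff (trans (f-- (Tʳ p) _ _) (+-congˡ (-‿cong (f-scale (Tʳ p) a Y)))))) ⟩
      _ ∎
      where
      A = ι a
      B = ι b
      ι- : ι (a ℤ.- b) ≈ A - B
      ι- = trans (ι-+ a (ℤ.- b)) (+-congˡ (ι-neg b))
      e₁ : T ((q - p) ♯) X ≈ T (q ♯) X - T p (q ⋇ X) + T (p ♯) X
      e₁ = begin
        T ((q - p) ♯) X ≈⟨ T-congˡ (♯-+ q (- p)) ⟩
        T (q ♯ + q ⋇ (- p) + (- p) ♯) X ≈⟨ trans (T-+ˡ _ _ X) (+-congʳ (T-+ˡ _ _ X)) ⟩
        T (q ♯) X + T (q ⋇ (- p)) X + T ((- p) ♯) X
          ≈⟨ +-cong (+-congˡ (trans (T-congˡ (trans (f-neg (⋇ʳ q) p) (-‿cong (⋇-comm q p)))) (trans (f-neg (Tˡ X) _) (-‿cong (sym (T-⋇ p q X)))))) (T-congˡ (♯-neg p)) ⟩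
        T (q ♯) X - T p (q ⋇ X) + T (p ♯) X ∎

    *ˡ : ∀ c → Linear (c *_)
    *ˡ c = record { f-cong = *-congˡ ; f-+ = distribˡ c
                  ; f-scale = λ n x → solve 3 (λ c n x → c :* (n :* x) := n :* (c :* x)) refl c (ι n) x }

    -ˡ : Linear (λ x → - x)
    -ˡ = record { f-cong = -‿cong ; f-+ = solve 2 (λ x y → :- (x :+ y) := :- x :+ :- y) refl
                ; f-scale = λ n x → solve 2 (λ n x → :- (n :* x) := n :* (:- x)) refl (ι n) x }

    _∘ˡ_ : ∀ {f g} → Linear f → Linear g → Linear (λ x → f (g x))
    F ∘ˡ G = record { f-cong = λ p → f-cong F (f-cong G p)
                    ; f-+ = λ x y → trans (f-cong F (f-+ G x y)) (f-+ F _ _)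
                    ; f-scale = λ n x → trans (f-cong F (f-scale G n x)) (f-scale F n _) }

    -- A record instead of the bare equation, so that the summand `f` can be inferred.
    record Σ≈0 {n} (f : Fin n → Carrier) : Set where
      constructor vanishes
      field
        sum≈0 : sum f ≈ 0#
    open Σ≈0

    Σ-cong : ∀ {n} {f g : Fin n → Carrier} → (∀ i → f i ≈ g i) → Σ≈0 g → Σ≈0 f
    Σ-cong h (vanishes p) = vanishes (trans (sum-cong-≋ h) p)

    Σ-+ : ∀ {n} {f g : Fin n → Carrier} → Σ≈0 f → Σ≈0 g → Σ≈0 (λ i → f i + g i)
    Σ-+ {f = f} {g} (vanishes p) (vanishes q) = vanishes (trans (∑-distrib-+ f g) (p ⊕ q))

    linear-sum : ∀ {f} → Linear f → ∀ {n} (g : Fin n → Carrier) → f (sum g) ≈ sum (λ i → f (g i))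
    linear-sum L {zero} g = f-0 L
    linear-sum L {suc n} g = trans (f-+ L _ _) (+-congˡ (linear-sum L (λ i → g (suc i))))

    Σ-linear : ∀ {f} → Linear f → ∀ {n} {g : Fin n → Carrier} → Σ≈0 g → Σ≈0 (λ i → f (g i))
    Σ-linear L {g = g} (vanishes p) = vanishes (trans (sym (linear-sum L g)) (f-vanish L p))

    rot : Fin 5 → Fin 5
    rot 0F = 1F
    rot 1F = 2F
    rot 2F = 3F
    rot 3F = 4F
    rot 4F = 0F

    Σ-rot : ∀ (f : Fin 5 → Carrier) → Σ≈0 (λ i → f (rot i) - f i)
    Σ-rot f = vanishes (solve 6 (λ a b c d e o → (b :- a) :+ ((c :- b) :+ ((d :- c) :+ ((e :- d) :+ ((a :- e) :+ o)))) := o) refl (f 0F) (f 1F) (f 2F) (f 3F) (f 4F) 0#)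

    Σ₅ : ∀ {f : Fin 5 → Carrier} → Σ≈0 f → f 0F + f 1F + f 2F + f 3F + f 4F ≈ 0#
    Σ₅ {f} (vanishes p) = trans (solve 6 (λ a b c d e o → a :+ b :+ c :+ d :+ e := (a :+ (b :+ (c :+ (d :+ (e :+ o))))) :- o) refl (f 0F) (f 1F) (f 2F) (f 3F) (f 4F) 0#) (diff p)

    record Line : Set where
      constructor line
      field
        u v w z t : Carrier
    open Line

    slope-term : ℤ → Line → Carrier
    slope-term a l = v l + ι a * u l

    -- Meet a l m says that l and m have the same point of class a: its coordinates are v + a u, and w, z, t
    -- shifted by potentials whose increments along a segment of slope a are its area and moments.
    record Meet (a : ℤ) (l m : Line) : Set where
      field
        meet-v : slope-term a l ≈ slope-term a m
        meet-w : w l + (slope-term a l ⋇ u l - ι a * u l ♯) ≈ w m + (slope-term a m ⋇ u m - ι a * u m ♯)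
        meet-z : z l + cross-term a (slope-term a l) (u l ♯) (N (u l)) ≈ z m + cross-term a (slope-term a m) (u m ♯) (N (u m))
        meet-t : t l + moment-term a (slope-term a l) (u l) (u l ♯) (N (u l)) ≈ t m + moment-term a (slope-term a m) (u m) (u m ♯) (N (u m))
    open Meet

    ι-- : ∀ a b → ι (a ℤ.- b) ≈ ι a - ι b
    ι-- a b = trans (ι-+ a (ℤ.- b)) (+-congˡ (ι-neg b))

    -- The law of a closed pentagon

    module Pentagon (a : Fin 5 → ℤ) (l : Fin 5 → Line) (meet : ∀ i → Meet (a i) (l i) (l (rot i))) where

      U V X Y W q : Fin 5 → Carrier
      U i = u (l i)
      V i = v (l i)
      X i = U (rot i) - U i
      Y i = U (rot i) ♯ - U i ♯
      W i = N (U (rot i)) - N (U i)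
      q i = slope-term (a i) (l i)

      closes : ∀ (f : Line → Carrier) (s : Fin 5 → Carrier) → (∀ i → f (l i) - f (l (rot i)) ≈ s i) → Σ≈0 s
      closes f s h = Σ-cong (λ i → trans (sym (h i)) (solve 2 (λ x y → x :- y := :- (y :- x)) refl (f (l i)) (f (l (rot i)))))
                           (Σ-linear -ˡ (Σ-rot (λ i → f (l i))))

      area-closes : Σ≈0 (λ i → area-term (a i) (q i) (X i) (Y i))
      area-closes = closes w _ λ i → undiff (begin
        _ ≈⟨ solve 9 (λ w w′ A s s′ m m′ m″ n → w :- w′ :- (n :- A :* (s′ :- s)) :=
               (w :+ (m :- A :* s) :- (w′ :+ (m″ :- A :* s′))) :+ ((m″ :- m′) :+ (m′ :- m :- n)))
             refl (w (l i)) (w (l (rot i))) (ι (a i)) (U i ♯) (U (rot i) ♯) (q i ⋇ U i) (q i ⋇ U (rot i)) (slope-term (a i) (l (rot i)) ⋇ U (rot i)) (q i ⋇ X i) ⟩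
        _ ≈⟨ diff (meet-w (meet i)) ⊕ diff (⋇-congˡ (sym (meet-v (meet i)))) ⊕ diff (sym (f-- (⋇ʳ (q i)) (U (rot i)) (U i))) ⟩
        0# ∎)

      cross-closes : Σ≈0 (λ i → cross-term (a i) (q i) (Y i) (W i))
      cross-closes = closes z _ λ i → undiff (begin
        _ ≈⟨ solve 9 (λ w w′ A s s′ m m′ m″ n → w :- w′ :- (n :- (A :* (s′ :- s) :+ A :* (s′ :- s))) :=
               (w :+ (m :- (A :* s :+ A :* s)) :- (w′ :+ (m″ :- (A :* s′ :+ A :* s′)))) :+ ((m″ :- m′) :+ (m′ :- m :- n)))
             refl (z (l i)) (z (l (rot i))) (ι (a i)) (N (U i)) (N (U (rot i))) (T (q i) (U i ♯)) (T (q i) (U (rot i) ♯)) (T (slope-term (a i) (l (rot i))) (U (rot i) ♯)) (T (q i) (Y i)) ⟩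
        _ ≈⟨ diff (meet-z (meet i)) ⊕ diff (T-congˡ (sym (meet-v (meet i)))) ⊕ diff (sym (f-- (Tʳ (q i)) _ _)) ⟩
        0# ∎)

      moment-closes : Σ≈0 (λ i → moment-term (a i) (q i) (X i) (Y i) (W i))
      moment-closes = closes t _ λ i → let q′ = slope-term (a i) (l (rot i)) ; A = ι (a i) in begin
        t (l i) - t (l (rot i))
          ≈⟨ undiff (trans (solve 5 (λ t t′ m m′ m″ → t :- t′ :- (m′ :- m) := (t :+ m :- (t′ :+ m″)) :+ (m″ :- m′)) refl _ _ _ _ _)
               (diff (meet-t (meet i)) ⊕ diff (moment-term-cong (a i) (sym (meet-v (meet i))) refl refl refl))) ⟩
        moment-term (a i) (q i) (U (rot i)) (U (rot i) ♯) (N (U (rot i))) - moment-term (a i) (q i) (U i) (U i ♯) (N (U i))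
          ≈⟨ solve 7 (λ A p p′ r r′ n n′ → (p′ :- A :* r′ :+ A :* A :* n′) :- (p :- A :* r :+ A :* A :* n)
                      := (p′ :- p) :- A :* (r′ :- r) :+ A :* A :* (n′ :- n)) refl A _ _ _ _ _ _ ⟩
        _ ≈⟨ +-congʳ (+-cong (sym (f-- (Tʳ (q i ♯)) _ _)) (-‿cong (*-congˡ (sym (f-- (Tʳ (q i)) _ _))))) ⟩
        moment-term (a i) (q i) (X i) (Y i) (W i) ∎

      -- Side 2, joining corners 2 and 3, becomes the base: relative to its slope and intercept it
      -- lies at height 0, and corner 0 is the opposite one.
      b : ℤ
      b = a 2F

      p : Carrier
      p = q 2F

      α : Fin 5 → ℤ
      α i = a i ℤ.- b

      k : Fin 5 → Carrier
      k i = q i - p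

      relative-area-closes : Σ≈0 (λ i → area-term (α i) (k i) (X i) (Y i))
      relative-area-closes = Σ-cong (λ i → relative-area (a i) b (q i) p (X i) (Y i))
        (Σ-+ area-closes (Σ-+ (Σ-linear (-ˡ ∘ˡ ⋇ʳ p) (Σ-rot U)) (Σ-linear (*ˡ (ι b)) (Σ-rot (λ i → U i ♯)))))

      relative-moment-closes : Σ≈0 (λ i → moment-term (α i) (k i) (X i) (Y i) (W i))
      relative-moment-closes = Σ-cong (λ i → relative-moment (a i) b (q i) p (X i) (Y i) (W i))
        (Σ-+ moment-closes (Σ-+ (Σ-linear (*ˡ (ι b)) cross-closes) (Σ-+ (Σ-linear (-ˡ ∘ˡ Tʳ p) area-closes)
          (Σ-+ (Σ-linear (Tʳ (p ♯)) (Σ-rot U)) (Σ-+ (Σ-linear (-ˡ ∘ˡ (*ˡ (ι b) ∘ˡ Tʳ p)) (Σ-rot (λ i → U i ♯)))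
            (Σ-linear (*ˡ (ι b * ι b)) (Σ-rot (λ i → N (U i)))))))))

      -- The height of line 0 above the base line through lines 2 and 3. Summing height * area - moment
      -- over the segments leaves one product at each of the corners 1 and 4.
      height : Carrier
      height = - (ι (α 1F) * (U 1F - U 2F)) - ι (α 0F) * (U 0F - U 1F)

      C : Fin 5 → Carrier
      C i = contribution (α i) (k i) (U i) (U (rot i)) height

      C-closes : Σ≈0 C
      C-closes = Σ-+ (Σ-linear (*ˡ height) relative-area-closes) (Σ-linear -ˡ relative-moment-closes)

      C₂≈0 : C 2F ≈ 0#
      C₂≈0 = trans (+-cong (*-congˡ (trans (+-cong (f-vanish (⋇ˡ (X 2F)) k≈0) (-‿cong (trans (*-congʳ α≈0) (zeroˡ _)))) 0-0))
          (-‿cong (trans (+-cong (+-cong (f-vanish (Tˡ (X 2F)) (♯-vanish k≈0)) (-‿cong (trans (*-congʳ α≈0) (zeroˡ _)))) (trans (*-congʳ (trans (*-congʳ α≈0) (zeroˡ _))) (zeroˡ _)))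
            (trans (+-identityʳ _) 0-0))))
        (trans (+-congʳ (zeroʳ height)) 0-0)
        where
        k≈0 : k 2F ≈ 0#
        k≈0 = -‿inverseʳ p
        α≈0 : ι (α 2F) ≈ 0#
        α≈0 = trans (ι-- b b) (-‿inverseʳ (ι b))
        0-0 : 0# - 0# ≈ 0#
        0-0 = -‿inverseʳ 0#

      V-step : ∀ i → V i - V (rot i) ≈ ι (a i) * X i
      V-step i = undiff (trans (solve 5 (λ v v′ A u u′ → v :- v′ :- A :* (u′ :- u) := (v :+ A :* u) :- (v′ :+ A :* u′)) refl (V i) (V (rot i)) (ι (a i)) (U i) (U (rot i)))
                 (diff (meet-v (meet i))))

      private
        A : Fin 5 → Carrier
        A i = ι (a i)
        α≈ : ∀ i → ι (α i) ≈ A i - A 2F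
        α≈ i = ι-- (a i) b

      -- `path-contribution` expects a path that leaves the base line. Corners 2, 1, 0 are therefore
      -- run against the orientation, whence the sign.
      left : C 0F + C 1F ≈ - (ι (α 1F) * (ι (α 0F) - ι (α 1F)) * ((U 1F - U 2F) ♯ * (U 0F - U 1F)))
      left = begin
        C 0F + C 1F ≈⟨ +-cong (contribution-reverse (α 0F) (k 0F) (U 0F) (U 1F) height) (contribution-reverse (α 1F) (k 1F) (U 1F) (U 2F) height) ⟩
        _ ≈⟨ solve 2 (λ x y → (:- x) :+ (:- y) := :- (y :+ x)) refl _ _ ⟩
        _ ≈⟨ -‿cong (path-contribution (α 1F) (α 0F) (U 2F) (U 1F) (U 0F) height
               (undiff (trans (solve 7 (λ v₁ v₂ u₁ u₂ A₁ A₂ b → (v₁ :+ A₁ :* u₁ :- (v₂ :+ A₂ :* u₂)) :- b :* u₂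
                  := (v₁ :- v₂ :- A₁ :* (u₂ :- u₁)) :+ (:- u₂) :* (b :- (A₁ :- A₂))) refl (V 1F) (V 2F) (U 1F) (U 2F) (A 1F) (A 2F) (ι (α 1F)))
                 (diff (V-step 1F) ⊕ (_ ⊙ diff (α≈ 1F)))))
               (undiff (trans (solve 11 (λ v₀ v₁ v₂ u₀ u₁ u₂ A₀ A₁ A₂ b c → (v₀ :+ A₀ :* u₀ :- (v₂ :+ A₂ :* u₂)) :- (:- (b :* (u₁ :- u₂)) :+ c :* u₁)
                  := (v₀ :- v₁ :- A₀ :* (u₁ :- u₀)) :+ ((v₁ :- v₂ :- A₁ :* (u₂ :- u₁)) :+ ((u₁ :- u₂) :* (b :- (A₁ :- A₂)) :+ (:- u₁) :* (c :- (A₀ :- A₂)))))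
                  refl (V 0F) (V 1F) (V 2F) (U 0F) (U 1F) (U 2F) (A 0F) (A 1F) (A 2F) (ι (α 1F)) (ι (α 0F)))
                 (diff (V-step 0F) ⊕ diff (V-step 1F) ⊕ (_ ⊙ diff (α≈ 1F)) ⊕ (_ ⊙ diff (α≈ 0F)))))
               refl) ⟩
        _ ∎

      slopes-close : Σ≈0 (λ i → A i * X i)
      slopes-close = closes v _ V-step

      relative-slopes-close : Σ≈0 (λ i → ι (α i) * X i)
      relative-slopes-close = Σ-cong (λ i → trans (*-congʳ (α≈ i)) (solve 3 (λ a b x → (a :- b) :* x := a :* x :+ :- (b :* x)) refl (A i) (A 2F) (X i)))
        (Σ-+ slopes-close (Σ-linear (-ˡ ∘ˡ *ˡ (A 2F)) (Σ-rot U)))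

      -- `height` was defined along the other path; that corners 3, 4, 0 climb to the same height is
      -- the closing of the relative slopes.
      right : C 3F + C 4F ≈ ι (α 3F) * (ι (α 4F) - ι (α 3F)) * ((U 4F - U 3F) ♯ * (U 0F - U 4F))
      right = path-contribution (α 3F) (α 4F) (U 3F) (U 4F) (U 0F) height
        (undiff (trans (solve 7 (λ v₂ v₃ u₂ u₃ A₂ A₃ b → (v₃ :+ A₃ :* u₃ :- (v₂ :+ A₂ :* u₂)) :- b :* u₃
           := con (ℤ.- 1ℤ) :* (v₂ :- v₃ :- A₂ :* (u₃ :- u₂)) :+ (:- u₃) :* (b :- (A₃ :- A₂))) refl (V 2F) (V 3F) (U 2F) (U 3F) (A 2F) (A 3F) (ι (α 3F)))
          ((_ ⊙ diff (V-step 2F)) ⊕ (_ ⊙ diff (α≈ 3F)))))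
        (undiff (trans (solve 11 (λ v₂ v₃ v₄ u₂ u₃ u₄ A₂ A₃ A₄ b c → (v₄ :+ A₄ :* u₄ :- (v₂ :+ A₂ :* u₂)) :- (:- (b :* (u₄ :- u₃)) :+ c :* u₄)
           := con (ℤ.- 1ℤ) :* (v₂ :- v₃ :- A₂ :* (u₃ :- u₂)) :+ (con (ℤ.- 1ℤ) :* (v₃ :- v₄ :- A₃ :* (u₄ :- u₃))
              :+ ((u₄ :- u₃) :* (b :- (A₃ :- A₂)) :+ (:- u₄) :* (c :- (A₄ :- A₂)))))
           refl (V 2F) (V 3F) (V 4F) (U 2F) (U 3F) (U 4F) (A 2F) (A 3F) (A 4F) (ι (α 3F)) (ι (α 4F)))
          ((_ ⊙ diff (V-step 2F)) ⊕ (_ ⊙ diff (V-step 3F)) ⊕ (_ ⊙ diff (α≈ 3F)) ⊕ (_ ⊙ diff (α≈ 4F)))))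
        (undiff (trans (solve 10 (λ u₀ u₁ u₂ u₃ u₄ α₀ α₁ α₂ α₃ α₄ →
             (:- (α₁ :* (u₁ :- u₂)) :- α₀ :* (u₀ :- u₁)) :- (:- (α₃ :* (u₄ :- u₃)) :- α₄ :* (u₀ :- u₄))
             := (α₀ :* (u₁ :- u₀) :+ α₁ :* (u₂ :- u₁) :+ α₂ :* (u₃ :- u₂) :+ α₃ :* (u₄ :- u₃) :+ α₄ :* (u₀ :- u₄)) :+ (u₂ :- u₃) :* α₂)
             refl (U 0F) (U 1F) (U 2F) (U 3F) (U 4F) (ι (α 0F)) (ι (α 1F)) (ι (α 2F)) (ι (α 3F)) (ι (α 4F)))
          (Σ₅ relative-slopes-close ⊕ (_ ⊙ trans (α≈ 2F) (-‿inverseʳ (A 2F))))))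

      d : Fin 5 → Carrier
      d i = ι (a i) - ι (a (rot i))

      law : d 0F * d 1F * (X 1F ♯ * X 0F) + d 2F * d 3F * (X 3F ♯ * X 4F) ≈ 0#
      law = begin
        d 0F * d 1F * (X 1F ♯ * X 0F) + d 2F * d 3F * (X 3F ♯ * X 4F)
          ≈⟨ solve 9 (λ A₀ A₁ A₂ A₃ A₄ s x s′ x′ →
               (A₀ :- A₁) :* (A₁ :- A₂) :* (s :* x) :+ (A₂ :- A₃) :* (A₃ :- A₄) :* (s′ :* x′)
               := :- ((A₁ :- A₂) :* ((A₀ :- A₂) :- (A₁ :- A₂)) :* (s :* (:- x))) :+ (A₃ :- A₂) :* ((A₄ :- A₂) :- (A₃ :- A₂)) :* (s′ :* x′))
               refl (A 0F) (A 1F) (A 2F) (A 3F) (A 4F) (X 1F ♯) (X 0F) (X 3F ♯) (X 4F) ⟩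
        - ((A 1F - A 2F) * ((A 0F - A 2F) - (A 1F - A 2F)) * (X 1F ♯ * (- X 0F))) + (A 3F - A 2F) * ((A 4F - A 2F) - (A 3F - A 2F)) * (X 3F ♯ * X 4F)
          ≈⟨ +-cong (-‿cong (*-cong (*-cong (sym (α≈ 1F)) (+-cong (sym (α≈ 0F)) (-‿cong (sym (α≈ 1F)))))
                      (*-cong (trans (sym (♯-neg (X 1F))) (♯-cong (flip (U 1F) (U 2F)))) (flip (U 0F) (U 1F)))))
                    (*-congʳ (*-cong (sym (α≈ 3F)) (+-cong (sym (α≈ 4F)) (-‿cong (sym (α≈ 3F)))))) ⟩
        _ ≈⟨ +-cong (sym left) (sym right) ⟩
        C 0F + C 1F + (C 3F + C 4F) ≈⟨ undiff (trans (solve 5 (λ a b c d e → (a :+ b :+ (d :+ e)) :- (a :+ b :+ c :+ d :+ e) := con (ℤ.- 1ℤ) :* c) refl (C 0F) (C 1F) (C 2F) (C 3F) (C 4F)) (_ ⊙ C₂≈0)) ⟩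
        C 0F + C 1F + C 2F + C 3F + C 4F ≈⟨ Σ₅ C-closes ⟩
        0# ∎
        where
        flip : ∀ x y → - (y - x) ≈ x - y
        flip = solve 2 (λ x y → :- (y :- x) := x :- y) refl

    _≉0 : Carrier → Set
    x ≉0 = ¬ (x ≈ 0#)

    *-≉0 : ∀ {x y} → x ≉0 → y ≉0 → (x * y) ≉0
    *-≉0 p q r with domain _ _ r
    ... | inj₁ s = p s
    ... | inj₂ s = q s

    ♯-≉0 : ∀ {x} → x ≉0 → (x ♯) ≉0
    ♯-≉0 p q = p (♯-reflects-0 _ q)

    module _ (a : Fin 5 → ℤ) (l : Fin 5 → Line) (meet : ∀ i → Meet (a i) (l i) (l (rot i))) where
      private
        d x : Fin 5 → Carrier
        d i = ι (a i) - ι (a (rot i))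
        x i = u (l (rot i)) - u (l i)

      -- The side from corner 4 to corner 0 is zero, which kills the second product of the law.
      -- Triangles are covered too, with corners 3 and 4 both placed at corner 0.
      no-quadrilateral : u (l 4F) ≈ u (l 0F) → d 0F ≉0 → d 1F ≉0 → x 0F ≉0 → x 1F ≉0 → ⊥
      no-quadrilateral e d₀ d₁ x₀ x₁ = *-≉0 (*-≉0 d₀ d₁) (*-≉0 (♯-≉0 x₁) x₀) (begin
        d 0F * d 1F * (x 1F ♯ * x 0F) ≈⟨ solve 4 (λ p c s y → p := (p :+ c :* (s :* y)) :+ (:- (c :* s)) :* y) refl _ (d 2F * d 3F) (x 3F ♯) (x 4F) ⟩
        _ ≈⟨ Pentagon.law a l meet ⊕ (_ ⊙ diff (sym e)) ⟩
        0# ∎)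

      -- The product of the laws of the five rotations reads Π = - Π.
      no-pentagon : (∀ i → d i ≉0) → (∀ i → x i ≉0) → ⊥
      no-pentagon d≉ x≉ =
        *-≉0 (*-≉0 D D) X
          (halve _ (trans (+-cong left right) (alternate law₀ law₁ law₂ law₃ law₄)))
        where
        P : (Fin 5 → Fin 5) → Carrier
        P σ = d (σ 0F) * d (σ 1F) * (x (σ 1F) ♯ * x (σ 0F))
        Q : (Fin 5 → Fin 5) → Carrier
        Q σ = d (σ 2F) * d (σ 3F) * (x (σ 3F) ♯ * x (σ 4F))
        r₀ r₁ r₂ r₃ r₄ : Fin 5 → Fin 5
        r₀ i = i
        r₁ i = rot i
        r₂ i = rot (rot i)
        r₃ i = rot (rot (rot i))
        r₄ i = rot (rot (rot (rot i)))
        opp : ∀ {p q} → p + q ≈ 0# → p ≈ - q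
        opp {p} {q} h = undiff (trans (solve 2 (λ p q → p :- (:- q) := p :+ q) refl p q) h)
        ΠD ΠX : Carrier
        ΠD = d 0F * (d 1F * (d 2F * (d 3F * d 4F)))
        ΠX = x 0F * (x 1F * (x 2F * (x 3F * x 4F))) * (x 0F ♯ * (x 1F ♯ * (x 2F ♯ * (x 3F ♯ * x 4F ♯))))
        D : ΠD ≉0
        D = *-≉0 (d≉ 0F) (*-≉0 (d≉ 1F) (*-≉0 (d≉ 2F) (*-≉0 (d≉ 3F) (d≉ 4F))))
        X : ΠX ≉0
        X = *-≉0 (*-≉0 (x≉ 0F) (*-≉0 (x≉ 1F) (*-≉0 (x≉ 2F) (*-≉0 (x≉ 3F) (x≉ 4F)))))
                 (*-≉0 (♯-≉0 (x≉ 0F)) (*-≉0 (♯-≉0 (x≉ 1F)) (*-≉0 (♯-≉0 (x≉ 2F)) (*-≉0 (♯-≉0 (x≉ 3F)) (♯-≉0 (x≉ 4F))))))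
        -- Over the five rotations each `d` occurs twice and each `x` and `x ♯` once, in the product
        -- of the `P` as well as in that of the `Q`.
        left : ΠD * ΠD * ΠX ≈ P r₀ * (P r₁ * (P r₂ * (P r₃ * P r₄)))
        left = Monomials.solve 15 (λ a b c d e f g h i j k l m n o →
          ((a • (b • (c • (d • e)))) • (a • (b • (c • (d • e))))) • ((f • (g • (h • (i • j)))) • (k • (l • (m • (n • o)))))
          ⊜ ((a • b) • (l • f)) • (((b • c) • (m • g)) • (((c • d) • (n • h)) • (((d • e) • (o • i)) • ((e • a) • (k • j))))))
          refl (d 0F) (d 1F) (d 2F) (d 3F) (d 4F) (x 0F) (x 1F) (x 2F) (x 3F) (x 4F) (x 0F ♯) (x 1F ♯) (x 2F ♯) (x 3F ♯) (x 4F ♯)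
        right : ΠD * ΠD * ΠX ≈ Q r₀ * (Q r₁ * (Q r₂ * (Q r₃ * Q r₄)))
        right = Monomials.solve 15 (λ a b c d e f g h i j k l m n o →
          ((a • (b • (c • (d • e)))) • (a • (b • (c • (d • e))))) • ((f • (g • (h • (i • j)))) • (k • (l • (m • (n • o)))))
          ⊜ ((c • d) • (n • j)) • (((d • e) • (o • f)) • (((e • a) • (k • g)) • (((a • b) • (l • h)) • ((b • c) • (m • i))))))
          refl (d 0F) (d 1F) (d 2F) (d 3F) (d 4F) (x 0F) (x 1F) (x 2F) (x 3F) (x 4F) (x 0F ♯) (x 1F ♯) (x 2F ♯) (x 3F ♯) (x 4F ♯)
        law₀ : P r₀ + Q r₀ ≈ 0#
        law₀ = Pentagon.law a l meet
        law₁ : P r₁ + Q r₁ ≈ 0#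
        law₁ = Pentagon.law (λ i → a (r₁ i)) (λ i → l (r₁ i)) (λ i → meet (r₁ i))
        law₂ : P r₂ + Q r₂ ≈ 0#
        law₂ = Pentagon.law (λ i → a (r₂ i)) (λ i → l (r₂ i)) (λ i → meet (r₂ i))
        law₃ : P r₃ + Q r₃ ≈ 0#
        law₃ = Pentagon.law (λ i → a (r₃ i)) (λ i → l (r₃ i)) (λ i → meet (r₃ i))
        law₄ : P r₄ + Q r₄ ≈ 0#
        law₄ = Pentagon.law (λ i → a (r₄ i)) (λ i → l (r₄ i)) (λ i → meet (r₄ i))
        alternate : ∀ {p₀ p₁ p₂ p₃ p₄ q₀ q₁ q₂ q₃ q₄} → p₀ + q₀ ≈ 0# → p₁ + q₁ ≈ 0# → p₂ + q₂ ≈ 0# → p₃ + q₃ ≈ 0# → p₄ + q₄ ≈ 0# →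
          p₀ * (p₁ * (p₂ * (p₃ * p₄))) + q₀ * (q₁ * (q₂ * (q₃ * q₄))) ≈ 0#
        alternate {q₀ = q₀} {q₁} {q₂} {q₃} {q₄} h₀ h₁ h₂ h₃ h₄ = begin
          _ ≈⟨ +-congʳ (*-cong (opp h₀) (*-cong (opp h₁) (*-cong (opp h₂) (*-cong (opp h₃) (opp h₄))))) ⟩
          (- q₀) * ((- q₁) * ((- q₂) * ((- q₃) * (- q₄)))) + q₀ * (q₁ * (q₂ * (q₃ * q₄)))
            ≈⟨ solve 5 (λ a b c d e → (:- a) :* ((:- b) :* ((:- c) :* ((:- d) :* (:- e)))) :+ a :* (b :* (c :* (d :* e))) := con 0ℤ) refl q₀ q₁ q₂ q₃ q₄ ⟩
          ι 0ℤ ≈⟨ ι-0 ⟩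
          0# ∎

    -- Triangles and quadrilaterals for girth five

    rot₄ : Fin 4 → Fin 4
    rot₄ 0F = 1F
    rot₄ 1F = 2F
    rot₄ 2F = 3F
    rot₄ 3F = 0F

    record Touch (a : ℤ) (l m : Line) : Set where
      field
        touch-v : v l + ι a * u l ≈ v m + ι a * u m
        touch-w : w l + ι a * u l ♯ ≈ w m + ι a * u m ♯
        touch-z : z l + ι a * N (u l) ≈ z m + ι a * N (u m)
    open Touch

    module Quadrilateral (a : Fin 4 → ℤ) (l : Fin 4 → Line) (touch : ∀ i → Touch (a i) (l i) (l (rot₄ i))) where

      A U : Fin 4 → Carrier
      A i = ι (a i)
      U i = u (l i)

      -- The change of slope at each corner, which summation by parts attaches to the corner as its
      -- weight.
      e : Fin 4 → ℤ
      e 0F = a 3F ℤ.- a 0F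
      e 1F = a 0F ℤ.- a 1F
      e 2F = a 1F ℤ.- a 2F
      e 3F = a 2F ℤ.- a 3F

      Σ-rot₄ : ∀ (f : Fin 4 → Carrier) → Σ≈0 (λ i → f i - f (rot₄ i))
      Σ-rot₄ f = vanishes (solve 5 (λ a b c d o → (a :- b) :+ ((b :- c) :+ ((c :- d) :+ ((d :- a) :+ o))) := o) refl (f 0F) (f 1F) (f 2F) (f 3F) 0#)

      -- Summation by parts: `A i` times the increment of `g` is minus the increment of `f`, and the
      -- latter telescopes.
      abel : ∀ (f g : Line → Carrier) → (∀ i → f (l i) + A i * g (l i) ≈ f (l (rot₄ i)) + A i * g (l (rot₄ i))) → Σ≈0 (λ i → ι (e i) * g (l i))
      abel f g h = vanishes (begin
        ι (e 0F) * g₀ + (ι (e 1F) * g₁ + (ι (e 2F) * g₂ + (ι (e 3F) * g₃ + 0#)))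
          ≈⟨ +-cong (*-congʳ (ι-- (a 3F) (a 0F))) (+-cong (*-congʳ (ι-- (a 0F) (a 1F))) (+-cong (*-congʳ (ι-- (a 1F) (a 2F))) (+-cong (*-congʳ (ι-- (a 2F) (a 3F))) refl))) ⟩
        (A 3F - A 0F) * g₀ + ((A 0F - A 1F) * g₁ + ((A 1F - A 2F) * g₂ + ((A 2F - A 3F) * g₃ + 0#)))
          ≈⟨ solve 9 (λ A₀ A₁ A₂ A₃ g₀ g₁ g₂ g₃ o →
               (A₃ :- A₀) :* g₀ :+ ((A₀ :- A₁) :* g₁ :+ ((A₁ :- A₂) :* g₂ :+ ((A₂ :- A₃) :* g₃ :+ o)))
               := A₀ :* (g₁ :- g₀) :+ (A₁ :* (g₂ :- g₁) :+ (A₂ :* (g₃ :- g₂) :+ (A₃ :* (g₀ :- g₃) :+ o))))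
               refl (A 0F) (A 1F) (A 2F) (A 3F) g₀ g₁ g₂ g₃ 0# ⟩
        _ ≈⟨ sum≈0 (Σ-cong step (Σ-rot₄ (λ i → f (l i)))) ⟩
        0# ∎)
        where
        g₀ = g (l 0F)
        g₁ = g (l 1F)
        g₂ = g (l 2F)
        g₃ = g (l 3F)
        step : ∀ i → A i * (g (l (rot₄ i)) - g (l i)) ≈ f (l i) - f (l (rot₄ i))
        step i = undiff (trans (solve 5 (λ A g g′ f f′ → A :* (g′ :- g) :- (f :- f′) := con (ℤ.- 1ℤ) :* ((f :+ A :* g) :- (f′ :+ A :* g′)))
          refl (A i) (g (l i)) (g (l (rot₄ i))) (f (l i)) (f (l (rot₄ i)))) (_ ⊙ diff (h i)))

      abel-const : ∀ c → Σ≈0 (λ i → ι (e i) * c)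
      abel-const c = abel (λ _ → 0#) (λ _ → c) (λ _ → refl)

      push : ∀ {f} → Linear f → {g : Fin 4 → Carrier} → Σ≈0 (λ i → ι (e i) * g i) → Σ≈0 (λ i → ι (e i) * f (g i))
      push L {g} p = Σ-cong (λ i → sym (f-scale L (e i) (g i))) (Σ-linear L p)

      e-+ : ∀ {f g : Fin 4 → Carrier} → Σ≈0 (λ i → ι (e i) * f i) → Σ≈0 (λ i → ι (e i) * g i) → Σ≈0 (λ i → ι (e i) * (f i + g i))
      e-+ p q = Σ-cong (λ i → distribˡ (ι (e i)) _ _) (Σ-+ p q)

      e-cong : ∀ {f g : Fin 4 → Carrier} → (∀ i → f i ≈ g i) → Σ≈0 (λ i → ι (e i) * g i) → Σ≈0 (λ i → ι (e i) * f i)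
      e-cong h = Σ-cong (λ i → *-congˡ (h i))

      module _ (s : Carrier) where
        -- The weights annihilate constants, `u`, `u ♯` and `N u`; expanding at `U i + s` stays
        -- within these up to linear maps, so any corner can be moved to the origin.
        shifted-♯ : Σ≈0 (λ i → ι (e i) * (U i + s) ♯)
        shifted-♯ = e-cong (λ i → ♯-+ (U i) s)
          (e-+ (e-+ (abel w (λ l → u l ♯) (λ i → touch-w (touch i))) (push (⋇ˡ s) (abel v u (λ i → touch-v (touch i))))) (abel-const (s ♯)))

        shifted-N : Σ≈0 (λ i → ι (e i) * N (U i + s))
        shifted-N = e-cong (λ i → N-+ (U i) s)
          (e-+ (e-+ (e-+ (abel z (λ l → N (u l)) (λ i → touch-z (touch i))) (push (Tˡ s) (abel w (λ l → u l ♯) (λ i → touch-w (touch i)))))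
            (push (Tʳ (s ♯)) (abel v u (λ i → touch-v (touch i))))) (abel-const (N s)))

      x : Fin 4 → Carrier
      x i = U (rot₄ i) - U i

      drop-first : ∀ {f : Fin 4 → Carrier} → f 0F ≈ 0# → Σ≈0 f → f 1F + f 2F + f 3F ≈ 0#
      drop-first {f} p (vanishes q) = trans (solve 5 (λ a b c d o → b :+ c :+ d := (a :+ (b :+ (c :+ (d :+ o))) :- o) :- a) refl (f 0F) (f 1F) (f 2F) (f 3F) 0#)
        (trans (+-congʳ (diff q)) (diff (sym p)))

      -- With corner 0 at the origin the weight `e 0F` drops out, and `Z` times the relation for
      -- `_♯` minus the relation for `N` eliminates `e 2F`.
      law : ι (e 1F) * (x 0F ♯ * x 1F) ≈ ι (e 3F) * (x 3F ♯ * x 2F)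
      law = undiff (begin
        ι (e 1F) * (x 0F ♯ * x 1F) - ι (e 3F) * (x 3F ♯ * x 2F)
          ≈⟨ +-cong (*-congˡ (*-congˡ (difference (U 1F) (U 2F))))
                    (-‿cong (*-congˡ (*-cong (trans (sym (♯-neg (x 3F))) (♯-cong (solve 2 (λ x y → :- (x :- y) := y :- x) refl (U 0F) (U 3F)))) (difference (U 2F) (U 3F))))) ⟩
        ι (e 1F) * (X ♯ * (Z - X)) - ι (e 3F) * (Y ♯ * (Y - Z))
          ≈⟨ solve 9 (λ e₁ e₂ e₃ X Y Z xs ys zs →
               e₁ :* (xs :* (Z :- X)) :- e₃ :* (ys :* (Y :- Z))
               := Z :* (e₁ :* xs :+ e₂ :* zs :+ e₃ :* ys) :+ con (ℤ.- 1ℤ) :* (e₁ :* (X :* xs) :+ e₂ :* (Z :* zs) :+ e₃ :* (Y :* ys)))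
               refl (ι (e 1F)) (ι (e 2F)) (ι (e 3F)) X Y Z (X ♯) (Y ♯) (Z ♯) ⟩
        _ ≈⟨ (Z ⊙ drop-first (_ ⊙ ♯-vanish (-‿inverseʳ (U 0F))) (shifted-♯ (- U 0F)))
           ⊕ (_ ⊙ drop-first (_ ⊙ trans (*-congʳ (-‿inverseʳ (U 0F))) (zeroˡ _)) (shifted-N (- U 0F))) ⟩
        0# ∎)
        where
        X = U 1F - U 0F
        Y = U 3F - U 0F
        Z = U 2F - U 0F
        difference : ∀ a b → b - a ≈ (b - U 0F) - (a - U 0F)
        difference a b = solve 3 (λ a b c → b :- a := (b :- c) :- (a :- c)) refl a b (U 0F)

    cancelˡ : ∀ {c x y} → c ≉0 → c * x ≈ c * y → x ≈ y
    cancelˡ {c} {x} {y} c≉ p with domain c (x - y) (trans (solve 3 (λ c x y → c :* (x :- y) := c :* x :- c :* y) refl c x y) (diff p))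
    ... | inj₁ q = ⊥-elim (c≉ q)
    ... | inj₂ q = undiff q

    module _ (a : Fin 4 → ℤ) (l : Fin 4 → Line) (touch : ∀ i → Touch (a i) (l i) (l (rot₄ i))) where
      open Quadrilateral a l touch using (U; e; x; law)
      private
        module Q₁ = Quadrilateral (λ i → a (rot₄ i)) (λ i → l (rot₄ i)) (λ i → touch (rot₄ i))
        module Q₂ = Quadrilateral (λ i → a (rot₄ (rot₄ i))) (λ i → l (rot₄ (rot₄ i))) (λ i → touch (rot₄ (rot₄ i)))

      -- The law rotated by two corners has the factor `x 3F` on one side, and this is zero when
      -- corners 3 and 0 coincide.
      no-touching-triangle : u (l 3F) ≈ u (l 0F) → ι (e 1F) ≉0 → x 0F ≉0 → x 1F ≉0 → ⊥
      no-touching-triangle p e≉ x₀ x₁ = *-≉0 e≉ (*-≉0 (♯-≉0 x₁) x₀) (begin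
        ι (e 1F) * (x 1F ♯ * x 0F) ≈⟨ Q₂.law ⟨
        ι (e 3F) * (x 2F ♯ * x 3F) ≈⟨ *-congˡ (_ ⊙ diff (sym p)) ⟩
        ι (e 3F) * 0# ≈⟨ zeroʳ _ ⟩
        0# ∎)

      module _ (e≉ : ∀ i → ι (e i) ≉0) (x≉ : ∀ i → x i ≉0) (odd≉ : (ι (e 1F) + ι (e 3F)) ≉0) (even≉ : (ι (e 0F) + ι (e 2F)) ≉0) where
        private
          P S s τ : Carrier
          P = x 1F * x 3F
          S = x 0F * x 2F
          -- Kept as images of integers, because `♯-scale` applies to scalars only.
          s = ι (e 1F ℤ.* norm (x 0F))
          τ = ι (e 3F ℤ.* norm (x 3F))

          scalar : ∀ m y → ι (m ℤ.* norm y) ≈ ι m * N y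
          scalar m y = trans (ι-* m (norm y)) (*-congˡ (sym (*-♯ y)))

          τ≉0 : τ ≉0
          τ≉0 p = *-≉0 (e≉ 3F) (*-≉0 (x≉ 3F) (♯-≉0 (x≉ 3F))) (trans (sym (scalar (e 3F) (x 3F))) p)

          -- The law times `x 0F * x 3F`: on each side an element meets its adjoint and becomes a
          -- norm, so `P` and `S` are proportional over the scalars.
          sP≈τS : s * P ≈ τ * S
          sP≈τS = begin
            s * P ≈⟨ *-congʳ (scalar (e 1F) (x 0F)) ⟩
            _ ≈⟨ solve 5 (λ c x xs y z → c :* (x :* xs) :* (y :* z) := x :* z :* (c :* (xs :* y))) refl (ι (e 1F)) (x 0F) (x 0F ♯) (x 1F) (x 3F) ⟩
            _ ≈⟨ *-congˡ law ⟩
            _ ≈⟨ solve 5 (λ c x y ys z → x :* y :* (c :* (ys :* z)) := c :* (y :* ys) :* (x :* z)) refl (ι (e 3F)) (x 0F) (x 3F) (x 3F ♯) (x 2F) ⟩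
            _ ≈⟨ *-congʳ (scalar (e 3F) (x 3F)) ⟨
            τ * S ∎

          -- The law times its rotation by two corners, with the adjoints combined by
          -- multiplicativity.
          S♯P≈P♯S : S ♯ * P ≈ P ♯ * S
          S♯P≈P♯S = cancelˡ (*-≉0 (e≉ 1F) (e≉ 3F)) (begin
            ι (e 1F) * ι (e 3F) * (S ♯ * P) ≈⟨ *-congˡ (*-congʳ (♯-* (x 0F) (x 2F))) ⟩
            _ ≈⟨ solve 6 (λ c d xs ys y z → c :* d :* ((xs :* ys) :* (y :* z)) := (c :* (xs :* y)) :* (d :* (ys :* z))) refl (ι (e 1F)) (ι (e 3F)) (x 0F ♯) (x 2F ♯) (x 1F) (x 3F) ⟩
            _ ≈⟨ *-cong law Q₂.law ⟩
            _ ≈⟨ solve 6 (λ c d xs ys y z → (d :* (ys :* z)) :* (c :* (xs :* y)) := c :* d :* ((xs :* ys) :* (y :* z))) refl (ι (e 1F)) (ι (e 3F)) (x 1F ♯) (x 3F ♯) (x 0F) (x 2F) ⟩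
            _ ≈⟨ *-congˡ (*-congʳ (♯-* (x 1F) (x 3F))) ⟨
            ι (e 1F) * ι (e 3F) * (P ♯ * S) ∎)

          -- The adjoint is multiplicative and quadratic, which forces the factor s / τ relating P to S to be 1.
          s≈τ : s ≈ τ
          s≈τ = cancelˡ (*-≉0 τ≉0 (*-≉0 (♯-≉0 S≉0) S≉0)) (begin
            τ * (S ♯ * S) * s ≈⟨ solve 4 (λ τ r S s → τ :* (r :* S) :* s := s :* r :* (τ :* S)) refl τ (S ♯) S s ⟩
            s * S ♯ * (τ * S) ≈⟨ *-congˡ sP≈τS ⟨
            s * S ♯ * (s * P) ≈⟨ solve 3 (λ s r P → s :* r :* (s :* P) := s :* s :* (r :* P)) refl s (S ♯) P ⟩
            s * s * (S ♯ * P) ≈⟨ *-congˡ S♯P≈P♯S ⟩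
            s * s * (P ♯ * S) ≈⟨ *-assoc (s * s) (P ♯) S ⟨
            s * s * P ♯ * S ≈⟨ *-congʳ (trans (sym (♯-scale _ P)) (trans (♯-cong sP≈τS) (♯-scale _ S))) ⟩
            τ * τ * S ♯ * S ≈⟨ solve 3 (λ τ r S → τ :* τ :* r :* S := τ :* (r :* S) :* τ) refl τ (S ♯) S ⟩
            τ * (S ♯ * S) * τ ∎)
            where
            S≉0 : S ≉0
            S≉0 = *-≉0 (x≉ 0F) (x≉ 2F)

          P≈S : P ≈ S
          P≈S = cancelˡ τ≉0 (trans (*-congʳ (sym s≈τ)) sP≈τS)

          -- x₀ and x₂ have the same sum and product as -x₁ and -x₃.
          factor : (x 0F + x 1F) * (x 0F + x 3F) ≈ 0#
          factor = trans (solve 4 (λ a b c d → (b :- a :+ (c :- b)) :* (b :- a :+ (a :- d)) := (c :- b) :* (a :- d) :- (b :- a) :* (d :- c)) refl (U 0F) (U 1F) (U 2F) (U 3F)) (diff P≈S)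

          -- The adjoint is even while `p` and `q` have opposite signs, so the two sides of the law
          -- differ by the factor -1 apart from their weights.
          opposite : ∀ {c d y y′ p q} → y + y′ ≈ 0# → p + q ≈ 0# → (c + d) ≉0 → y ≉0 → p ≉0 →
            c * (y ♯ * p) ≈ d * (y′ ♯ * q) → ⊥
          opposite {c} {d} {y} {y′} {p} {q} yy′ pq c+d≉ y≉ p≉ h = *-≉0 c+d≉ (*-≉0 (♯-≉0 y≉) p≉) (begin
            (c + d) * (y ♯ * p) ≈⟨ solve 6 (λ c d s s′ p q → (c :+ d) :* (s :* p) :=
                (c :* (s :* p) :- d :* (s′ :* q)) :+ (d :* p :* (s :- s′) :+ d :* s′ :* (p :+ q))) refl c d (y ♯) (y′ ♯) p q ⟩
            _ ≈⟨ diff h ⊕ (_ ⊙ diff y♯≈) ⊕ (_ ⊙ pq) ⟩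
            0# ∎)
            where
            y♯≈ : y ♯ ≈ y′ ♯
            y♯≈ = trans (♯-cong (undiff (trans (solve 2 (λ y y′ → y :- (:- y′) := y :+ y′) refl y y′) yy′))) (♯-neg y′)

          around : ∀ {p q r s} → p + q + (r + s) ≈ 0# → p + q ≈ 0# → r + s ≈ 0#
          around {p} {q} {r} {s} h k = trans (solve 4 (λ p q r s → r :+ s := (p :+ q :+ (r :+ s)) :- (p :+ q)) refl p q r s) (trans (+-cong h (-‿cong k)) (-‿inverseʳ 0#))

          cycle : ∀ a b c d → b - a + (c - b) + (d - c + (a - d)) ≈ 0#
          cycle a b c d = trans (solve 4 (λ a b c d → b :- a :+ (c :- b) :+ (d :- c :+ (a :- d)) := con 0ℤ) refl a b c d) ι-0

          cycle′ : ∀ a b c d → b - a + (a - d) + (c - b + (d - c)) ≈ 0#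
          cycle′ a b c d = trans (solve 4 (λ a b c d → b :- a :+ (a :- d) :+ (c :- b :+ (d :- c)) := con 0ℤ) refl a b c d) ι-0

        no-touching-quadrilateral : ⊥
        no-touching-quadrilateral = [ even , odd ]′ (domain (x 0F + x 1F) (x 0F + x 3F) factor)
          where
          even : x 0F + x 1F ≈ 0# → ⊥
          even p = opposite {ι (e 2F)} {ι (e 0F)} {x 1F} {x 0F} {x 2F} {x 3F} (trans (+-comm (x 1F) (x 0F)) p)
            (around {x 0F} {x 1F} {x 2F} {x 3F} (cycle (U 0F) (U 1F) (U 2F) (U 3F)) p)
            (λ q → even≉ (trans (+-comm (ι (e 0F)) (ι (e 2F))) q)) (x≉ 1F) (x≉ 2F) Q₁.law
          odd : x 0F + x 3F ≈ 0# → ⊥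
          odd p = opposite {ι (e 1F)} {ι (e 3F)} {x 0F} {x 3F} {x 1F} {x 2F} p
            (around {x 0F} {x 3F} {x 1F} {x 2F} (cycle′ (U 0F) (U 1F) (U 2F) (U 3F)) p) odd≉ (x≉ 0F) (x≉ 1F) law

    touch-refl : ∀ {a l} → Touch a l l
    touch-refl = record { touch-v = refl ; touch-w = refl ; touch-z = refl }

    meet-refl : ∀ {a l} → Meet a l l
    meet-refl = record { meet-v = refl ; meet-w = refl ; meet-z = refl ; meet-t = refl }

    slope-terms-≈⇒u≈ : ∀ {a b l m} → (ι a - ι b) ≉0 → slope-term a l ≈ slope-term a m → slope-term b l ≈ slope-term b m → u l ≈ u m
    slope-terms-≈⇒u≈ {a} {b} {l} {m} a≉b p q = cancelˡ a≉b (undiff (trans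
      (solve 6 (λ A B u u′ v v′ → (A :- B) :* u :- (A :- B) :* u′ := (v :+ A :* u :- (v′ :+ A :* u′)) :+ con (ℤ.- 1ℤ) :* (v :+ B :* u :- (v′ :+ B :* u′)))
        refl (ι a) (ι b) (u l) (u m) (v l) (v m)) (diff p ⊕ (_ ⊙ diff q))))

    strip : ∀ {x x′ y y′} → x + y ≈ x′ + y′ → y ≈ y′ → x ≈ x′
    strip {x} {x′} {y} {y′} p q = undiff (trans (solve 4 (λ x x′ y y′ → x :- x′ := (x :+ y :- (x′ :+ y′)) :+ con (ℤ.- 1ℤ) :* (y :- y′)) refl x x′ y y′) (diff p ⊕ (_ ⊙ diff q)))

    module _ {a l m} (h : Touch a l m) (u≈ : u l ≈ u m) where
      touch-v≈ : v l ≈ v m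
      touch-v≈ = strip (touch-v h) (*-congˡ u≈)

      touch-w≈ : w l ≈ w m
      touch-w≈ = strip (touch-w h) (*-congˡ (♯-cong u≈))

      touch-z≈ : z l ≈ z m
      touch-z≈ = strip (touch-z h) (*-congˡ (N-cong u≈))

    module _ {a l m} (h : Meet a l m) (u≈ : u l ≈ u m) where
      meet-v≈ : v l ≈ v m
      meet-v≈ = strip (meet-v h) (*-congˡ u≈)

      meet-w≈ : w l ≈ w m
      meet-w≈ = strip (meet-w h) (area-term-cong a (meet-v h) u≈ (♯-cong u≈))

      meet-z≈ : z l ≈ z m
      meet-z≈ = strip (meet-z h) (+-cong (trans (T-congˡ (meet-v h)) (T-congʳ (♯-cong u≈))) (-‿cong (+-cong (*-congˡ (N-cong u≈)) (*-congˡ (N-cong u≈)))))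

      meet-t≈ : t l ≈ t m
      meet-t≈ = strip (meet-t h) (moment-term-cong a (meet-v h) u≈ (♯-cong u≈) (N-cong u≈))

-- The cubic algebra in coordinates and its exact identities

module Cubic where
  open import Level using (0ℓ)
  open import Algebra.Bundles using (CommutativeRing)
  open import Algebra.Structures using (IsCommutativeRing)
  open import Algebra.Solver.Ring.AlmostCommutativeRing using (fromCommutativeRing; _-Raw-AlmostCommutative⟶_)
  import Algebra.Solver.Ring as RingSolver
  open import Data.Integer.Base as ℤ using (ℤ; 0ℤ; 1ℤ)
  import Data.Integer.Properties as ℤ
  open import Data.Fin.Patterns using (0F; 1F; 2F; 3F; 4F; 5F; 6F; 7F; 8F; 9F)
  open import Data.Vec.Base using (Vec; []; _∷_)
  open import Relation.Binary.Consequences using (dec⇒weaklyDec)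
  open import Relation.Binary.PropositionalEquality using (_≡_; refl)

  record Triple (A : Set) : Set where
    constructor ⟨_,_,_⟩
    field
      c₀ c₁ c₂ : A
  open Triple

  -- Coordinates in the basis 1, θ, θ² of A[θ] / (θ³ - θ - c).
  module CubicExtension {A : Set} (add mul : A → A → A) (neg : A → A) (c : A) where
    private
      infixl 6 _∔_
      infixl 7 _∙_
      _∔_ _∙_ : A → A → A
      _∔_ = add
      _∙_ = mul

    infixl 6 _⊞_
    infixl 7 _⊠_ _⋇_
    infix 8 _♯

    _⊞_ _⊠_ _⋇_ : Triple A → Triple A → Triple A
    ⟨ x , y , z ⟩ ⊞ ⟨ x′ , y′ , z′ ⟩ = ⟨ x ∔ x′ , y ∔ y′ , z ∔ z′ ⟩
    ⟨ x , y , z ⟩ ⊠ ⟨ x′ , y′ , z′ ⟩ =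
      ⟨ x ∙ x′ ∔ c ∙ (y ∙ z′ ∔ z ∙ y′)
      , x ∙ y′ ∔ y ∙ x′ ∔ (y ∙ z′ ∔ z ∙ y′) ∔ c ∙ (z ∙ z′)
      , x ∙ z′ ∔ y ∙ y′ ∔ z ∙ x′ ∔ z ∙ z′ ⟩
    ⟨ x , y , z ⟩ ⋇ ⟨ x′ , y′ , z′ ⟩ =
      ⟨ x ∙ x′ ∔ x ∙ x′ ∔ (x ∙ z′ ∔ z ∙ x′) ∔ (x ∙ z′ ∔ z ∙ x′) ∔ (z ∙ z′ ∔ z ∙ z′) ∔ (neg (y ∙ y′ ∔ y ∙ y′)) ∔ (neg (c ∙ (y ∙ z′ ∔ z ∙ y′)))
      , c ∙ (z ∙ z′ ∔ z ∙ z′) ∔ (neg (x ∙ y′ ∔ y ∙ x′))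
      , y ∙ y′ ∔ y ∙ y′ ∔ (neg (x ∙ z′ ∔ z ∙ x′)) ∔ (neg (z ∙ z′ ∔ z ∙ z′)) ⟩

    ⊟_ _♯ : Triple A → Triple A
    ⊟ ⟨ x , y , z ⟩ = ⟨ neg x , neg y , neg z ⟩
    ⟨ x , y , z ⟩ ♯ =
      ⟨ x ∙ x ∔ (x ∙ z ∔ x ∙ z) ∔ z ∙ z ∔ (neg (y ∙ y)) ∔ (neg (c ∙ (y ∙ z)))
      , c ∙ (z ∙ z) ∔ (neg (x ∙ y))
      , y ∙ y ∔ (neg (x ∙ z)) ∔ (neg (z ∙ z)) ⟩

    trace norm : Triple A → A
    trace ⟨ x , y , z ⟩ = x ∔ x ∔ x ∔ (z ∔ z)
    norm x = c₀ (x ⊠ x ♯)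

    module _ (o : A) where
      embed : A → Triple A
      embed x = ⟨ x , o , o ⟩

      T : Triple A → Triple A → Triple A
      T x y = embed (trace (x ⊠ y))

  triple≡ : ∀ {A : Set} {x y : Triple A} → c₀ x ≡ c₀ y → c₁ x ≡ c₁ y → c₂ x ≡ c₂ y → x ≡ y
  triple≡ refl refl refl = refl

  -- ℤ with operations that do not compute, which keeps the terms of the ring solver small.
  abstract
    infixl 6 _⊹_
    infixl 7 _·_
    infix 8 ~_

    _⊹_ _·_ : ℤ → ℤ → ℤ
    _⊹_ = ℤ._+_
    _·_ = ℤ._*_

    ~_ : ℤ → ℤ
    ~_ = ℤ.-_

    ⊹-def : ∀ a b → a ℤ.+ b ≡ a ⊹ b
    ⊹-def a b = refl

    ·-def : ∀ a b → a ℤ.* b ≡ a · b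
    ·-def a b = refl

    ~-def : ∀ a → ℤ.- a ≡ ~ a
    ~-def a = refl

    ⊹-·-isCommutativeRing : IsCommutativeRing _≡_ _⊹_ _·_ ~_ 0ℤ 1ℤ
    ⊹-·-isCommutativeRing = ℤ.+-*-isCommutativeRing

  ⊹-·-commutativeRing : CommutativeRing 0ℓ 0ℓ
  ⊹-·-commutativeRing = record { isCommutativeRing = ⊹-·-isCommutativeRing }

  ⊹-·-morphism : CommutativeRing.rawRing ℤ.+-*-commutativeRing -Raw-AlmostCommutative⟶ fromCommutativeRing ⊹-·-commutativeRing
  ⊹-·-morphism = record { ⟦_⟧ = λ a → a ; +-homo = ⊹-def ; *-homo = ·-def ; -‿homo = ~-def ; 0-homo = refl ; 1-homo = refl }

  module ⊹-·-Solver = RingSolver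
    (CommutativeRing.rawRing ℤ.+-*-commutativeRing) (fromCommutativeRing ⊹-·-commutativeRing) ⊹-·-morphism (dec⇒weaklyDec ℤ._≟_)

  -- These are polynomial identities in `c` and the coordinates. The same formulas are instantiated
  -- at polynomials in ten variables, one for `c` and three for each of `x`, `y`, `z`, and compared
  -- by normal forms.
  module ExactLaws (c : ℤ) where
    open CubicExtension _⊹_ _·_ ~_ c
    open ⊹-·-Solver using (Polynomial; var; con; _:+_; _:*_; :-_; ⟦_⟧; ⟦_⟧↓; prove)
    private
      module P = CubicExtension {Polynomial 10} _:+_ _:*_ (λ p → :- p) (var 0F)
      X Y Z : Triple (Polynomial 10)
      X = ⟨ var 1F , var 2F , var 3F ⟩
      Y = ⟨ var 4F , var 5F , var 6F ⟩
      Z = ⟨ var 7F , var 8F , var 9F ⟩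
      O : Polynomial 10
      O = con 0ℤ
      S : Triple (Polynomial 10)
      -- A scalar `n` enters the environment as the third triple `embed 0ℤ n`, whose first
      -- coordinate is this variable.
      S = ⟨ var 7F , O , O ⟩

      ρ : (x y z : Triple ℤ) → Vec ℤ 10
      ρ x y z = c ∷ c₀ x ∷ c₁ x ∷ c₂ x ∷ c₀ y ∷ c₁ y ∷ c₂ y ∷ c₀ z ∷ c₁ z ∷ c₂ z ∷ []

      module _ (x y z : Triple ℤ) where
        value : Triple (Polynomial 10) → Triple ℤ
        value ⟨ p , q , r ⟩ = ⟨ ⟦ p ⟧ (ρ x y z) , ⟦ q ⟧ (ρ x y z) , ⟦ r ⟧ (ρ x y z) ⟩

        law : ∀ l r → ⟦ c₀ l ⟧↓ (ρ x y z) ≡ ⟦ c₀ r ⟧↓ (ρ x y z) → ⟦ c₁ l ⟧↓ (ρ x y z) ≡ ⟦ c₁ r ⟧↓ (ρ x y z) →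
              ⟦ c₂ l ⟧↓ (ρ x y z) ≡ ⟦ c₂ r ⟧↓ (ρ x y z) → value l ≡ value r
        law l r p q s = triple≡ (prove _ (c₀ l) (c₀ r) p) (prove _ (c₁ l) (c₁ r) q) (prove _ (c₂ l) (c₂ r) s)

    O₃ : Triple ℤ
    O₃ = ⟨ 0ℤ , 0ℤ , 0ℤ ⟩

    abstract
      ⊠-assoc : ∀ x y z → (x ⊠ y) ⊠ z ≡ x ⊠ (y ⊠ z)
      ⊠-assoc x y z = law x y z ((X P.⊠ Y) P.⊠ Z) (X P.⊠ (Y P.⊠ Z)) refl refl refl

      ⊠-comm : ∀ x y → x ⊠ y ≡ y ⊠ x
      ⊠-comm x y = law x y O₃ (X P.⊠ Y) (Y P.⊠ X) refl refl refl

      ⊠-⊞ : ∀ x y z → x ⊠ (y ⊞ z) ≡ x ⊠ y ⊞ x ⊠ z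
      ⊠-⊞ x y z = law x y z (X P.⊠ (Y P.⊞ Z)) (X P.⊠ Y P.⊞ X P.⊠ Z) refl refl refl

      ⊠-identityˡ : ∀ x → embed 0ℤ 1ℤ ⊠ x ≡ x
      ⊠-identityˡ x = law x O₃ O₃ (P.embed O (con 1ℤ) P.⊠ X) X refl refl refl

      embed-* : ∀ a b → embed 0ℤ (a · b) ≡ embed 0ℤ a ⊠ embed 0ℤ b
      embed-* a b = law (embed 0ℤ a) (embed 0ℤ b) O₃ (P.embed O (c₀ X :* c₀ Y)) (P.embed O (c₀ X) P.⊠ P.embed O (c₀ Y)) refl refl refl

      ♯-⊞ : ∀ x y → (x ⊞ y) ♯ ≡ x ♯ ⊞ x ⋇ y ⊞ y ♯
      ♯-⊞ x y = law x y O₃ ((X P.⊞ Y) P.♯) (X P.♯ P.⊞ X P.⋇ Y P.⊞ Y P.♯) refl refl refl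

      ♯-embed : ∀ n x → (embed 0ℤ n ⊠ x) ♯ ≡ embed 0ℤ n ⊠ embed 0ℤ n ⊠ x ♯
      ♯-embed n x = law x O₃ (embed 0ℤ n) ((S P.⊠ X) P.♯) (S P.⊠ S P.⊠ X P.♯) refl refl refl

      ♯-⊠ : ∀ x y → (x ⊠ y) ♯ ≡ x ♯ ⊠ y ♯
      ♯-⊠ x y = law x y O₃ ((X P.⊠ Y) P.♯) (X P.♯ P.⊠ Y P.♯) refl refl refl

      ⊠-♯ : ∀ x → x ⊠ x ♯ ≡ embed 0ℤ (norm x)
      ⊠-♯ x = law x O₃ O₃ (X P.⊠ X P.♯) (P.embed O (P.norm X)) refl refl refl

      ♯-♯ : ∀ x → x ♯ ♯ ≡ embed 0ℤ (norm x) ⊠ x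
      ♯-♯ x = law x O₃ O₃ (X P.♯ P.♯) (P.embed O (P.norm X) P.⊠ X) refl refl refl

      ⋇-comm : ∀ x y → x ⋇ y ≡ y ⋇ x
      ⋇-comm x y = law x y O₃ (X P.⋇ Y) (Y P.⋇ X) refl refl refl

      ⋇-⊞ : ∀ x y z → (x ⊞ y) ⋇ z ≡ x ⋇ z ⊞ y ⋇ z
      ⋇-⊞ x y z = law x y z ((X P.⊞ Y) P.⋇ Z) (X P.⋇ Z P.⊞ Y P.⋇ Z) refl refl refl

      ⋇-embed : ∀ n x y → (embed 0ℤ n ⊠ x) ⋇ y ≡ embed 0ℤ n ⊠ (x ⋇ y)
      ⋇-embed n x y = law x y (embed 0ℤ n) ((S P.⊠ X) P.⋇ Y) (S P.⊠ (X P.⋇ Y)) refl refl refl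

      T-comm : ∀ x y → T 0ℤ x y ≡ T 0ℤ y x
      T-comm x y = law x y O₃ (P.T O X Y) (P.T O Y X) refl refl refl

      T-⊞ : ∀ x y z → T 0ℤ (x ⊞ y) z ≡ T 0ℤ x z ⊞ T 0ℤ y z
      T-⊞ x y z = law x y z (P.T O (X P.⊞ Y) Z) (P.T O X Z P.⊞ P.T O Y Z) refl refl refl

      T-embed : ∀ n x y → T 0ℤ (embed 0ℤ n ⊠ x) y ≡ embed 0ℤ n ⊠ T 0ℤ x y
      T-embed n x y = law x y (embed 0ℤ n) (P.T O (S P.⊠ X) Y) (S P.⊠ P.T O X Y) refl refl refl

      T-♯ : ∀ x y → T 0ℤ (x ♯) y ≡ x ⊠ (x ⋇ y) ⊞ x ♯ ⊠ y
      T-♯ x y = law x y O₃ (P.T O (X P.♯) Y) (X P.⊠ (X P.⋇ Y) P.⊞ X P.♯ P.⊠ Y) refl refl refl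

      T-⋇ : ∀ x y z → T 0ℤ x (y ⋇ z) ≡ T 0ℤ (x ⋇ y) z
      T-⋇ x y z = law x y z (P.T O X (Y P.⋇ Z)) (P.T O (X P.⋇ Y) Z) refl refl refl

-- Arithmetic modulo p and the cubic field

module Residues where
  open import Level using (0ℓ)
  open import Algebra.Bundles using (CommutativeRing)
  open import Data.Nat.Base as ℕ using (ℕ; zero; suc)
  import Data.Nat.Properties as ℕ
  import Data.Nat.Divisibility as ℕ
  open import Data.Nat.Primality using (Prime; euclidsLemma; prime⇒irreducible; prime⇒nonZero; prime⇒nonTrivial)
  open import Data.Nat.Coprimality using (Coprime; coprime-Bézout)
  import Data.Nat.GCD as GCD
  open import Data.Integer.Base as ℤ using (ℤ; +_; ∣_∣; 0ℤ; 1ℤ; _+_; _*_; _-_; -_)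
  import Data.Integer.Properties as ℤ
  open import Data.Integer.Divisibility.Signed
  open import Data.Integer.DivMod using (_%ℕ_; _/ℕ_; n%ℕd<d; a≡a%ℕn+[a/ℕn]*n)
  open import Data.Integer.Tactic.RingSolver using (solve-∀)
  open import Data.Fin.Base using (Fin; toℕ; fromℕ<) renaming (zero to fzero; suc to fsuc)
  open import Data.Fin.Properties as Fin using (toℕ-fromℕ<; toℕ-injective; toℕ<n; any?; ¬∀⟶∃¬; injective⇒≤)
  open import Data.Product using (∃; _,_; _×_; proj₁; proj₂)
  open import Data.Sum as Sum using (_⊎_; inj₁; inj₂; [_,_]′)
  open import Data.Empty using (⊥-elim)
  open import Function.Base using (_∘_)
  open import Function.Definitions using (Injective)
  open import Relation.Nullary using (¬_; Dec; yes; no)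
  open import Relation.Binary.Structures using (IsEquivalence)
  open import Relation.Binary.PropositionalEquality as ≡ using (_≡_; _≢_; refl; cong; cong₂; subst₂)
  open CubicNorm using (CubicNormRing)
  open Cubic
  open ⊹-·-Solver using (solve; _:=_; _:+_; _:*_; :-_; con)

  -- Pigeonhole: the section `h` is injective, and if it missed some `e`, then `e` together with `h`
  -- would inject `Fin (suc n)` into `Fin n`.
  surjective⇒injective : ∀ {n} (g h : Fin n → Fin n) → (∀ c → g (h c) ≡ c) → Injective _≡_ _≡_ g
  surjective⇒injective {n} g h gh {x} {y} eq = ≡.trans (≡.sym (hg x)) (≡.trans (cong h eq) (hg y))
    where
    hg : ∀ e → h (g e) ≡ e
    hg e with h (g e) Fin.≟ e
    ... | yes p = p
    ... | no e∉ = ⊥-elim (ℕ.<⇒≱ ℕ.≤-refl (injective⇒≤ {f = f} f-injective))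
      where
      misses : ∀ c → h c ≢ e
      misses c refl = e∉ (cong h (gh c))
      f : Fin (suc n) → Fin n
      f fzero = e
      f (fsuc c) = h c
      f-injective : Injective _≡_ _≡_ f
      f-injective {fzero} {fzero} _ = refl
      f-injective {fzero} {fsuc c} p = ⊥-elim (misses c (≡.sym p))
      f-injective {fsuc c} {fzero} p = ⊥-elim (misses c p)
      f-injective {fsuc c} {fsuc d} p = cong fsuc (≡.trans (≡.sym (gh c)) (≡.trans (cong g p) (gh d)))

  module Modular (p : ℕ) (prime : Prime p) where
    private instance
      _ = prime⇒nonZero prime
      _ = prime⇒nonTrivial prime

    infix 4 _≋_

    record _≋_ (a b : ℤ) : Set where
      constructor mod
      field
        p∣- : + p ∣ a - b
    open _≋_ public

    ≋-reflexive : ∀ {a b} → a ≡ b → a ≋ b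
    ≋-reflexive {a} refl = mod (divides 0ℤ (ℤ.+-inverseʳ a))

    ≋-refl : ∀ {a} → a ≋ a
    ≋-refl = ≋-reflexive refl

    ≋-sym : ∀ {a b} → a ≋ b → b ≋ a
    ≋-sym {a} {b} (mod h) = mod (≡.subst (+ p ∣_) (lemma a b) (∣m⇒∣-m h))
      where
      lemma : ∀ a b → - (a - b) ≡ b - a
      lemma = solve-∀

    ≋-trans : ∀ {a b c} → a ≋ b → b ≋ c → a ≋ c
    ≋-trans {a} {b} {c} (mod h) (mod k) = mod (≡.subst (+ p ∣_) (lemma a b c) (∣m∣n⇒∣m+n h k))
      where
      lemma : ∀ a b c → a - b + (b - c) ≡ a - c
      lemma = solve-∀

    ≋-+ : ∀ {a b c d} → a ≋ b → c ≋ d → a + c ≋ b + d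
    ≋-+ {a} {b} {c} {d} (mod h) (mod k) = mod (≡.subst (+ p ∣_) (lemma a b c d) (∣m∣n⇒∣m+n h k))
      where
      lemma : ∀ a b c d → a - b + (c - d) ≡ a + c - (b + d)
      lemma = solve-∀

    ≋-* : ∀ {a b c d} → a ≋ b → c ≋ d → a * c ≋ b * d
    ≋-* {a} {b} {c} {d} (mod h) (mod k) = mod (≡.subst (+ p ∣_) (lemma a b c d) (∣m∣n⇒∣m+n (∣m⇒∣m*n c h) (∣n⇒∣m*n b k)))
      where
      lemma : ∀ a b c d → (a - b) * c + b * (c - d) ≡ a * c - b * d
      lemma = solve-∀

    ≋-neg : ∀ {a b} → a ≋ b → - a ≋ - b
    ≋-neg {a} {b} (mod h) = mod (≡.subst (+ p ∣_) (lemma a b) (∣m⇒∣-m h))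
      where
      lemma : ∀ a b → - (a - b) ≡ - a - - b
      lemma = solve-∀

    ≋0⇒∣ : ∀ {a} → a ≋ 0ℤ → + p ∣ a
    ≋0⇒∣ {a} (mod h) = ≡.subst (+ p ∣_) (ℤ.+-identityʳ a) h

    ∣⇒≋0 : ∀ {a} → + p ∣ a → a ≋ 0ℤ
    ∣⇒≋0 {a} h = mod (≡.subst (+ p ∣_) (≡.sym (ℤ.+-identityʳ a)) h)

    _≋0? : ∀ a → Dec (a ≋ 0ℤ)
    a ≋0? with + p ∣? a
    ... | yes h = yes (∣⇒≋0 h)
    ... | no h = no (h ∘ ≋0⇒∣)

    ≋0-* : ∀ a b → a * b ≋ 0ℤ → a ≋ 0ℤ ⊎ b ≋ 0ℤ
    ≋0-* a b h with euclidsLemma ∣ a ∣ ∣ b ∣ prime (≡.subst (p ℕ.∣_) (ℤ.abs-* a b) (∣⇒∣ᵤ (≋0⇒∣ h)))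
    ... | inj₁ d = inj₁ (∣⇒≋0 (∣ᵤ⇒∣ d))
    ... | inj₂ d = inj₂ (∣⇒≋0 (∣ᵤ⇒∣ d))

    inverse : ∀ a → ¬ a ≋ 0ℤ → ∃ λ b → b * a ≋ 1ℤ
    inverse a a≢0 = from∣∣ (unit (coprime-Bézout coprime))
      where
      coprime : Coprime p ∣ a ∣
      coprime (d∣p , d∣a) with prime⇒irreducible prime d∣p
      ... | inj₁ d≡1 = d≡1
      ... | inj₂ refl = ⊥-elim (a≢0 (∣⇒≋0 (∣ᵤ⇒∣ d∣a)))
      unit : GCD.Bézout.Identity 1 p ∣ a ∣ → ∃ λ b → b * + ∣ a ∣ ≋ 1ℤ
      unit (GCD.Bézout.+- x y eq) = - + y , mod (divides (- + x) (≡.trans (lemma (+ y) (+ ∣ a ∣)) (≡.trans (cong -_ eq′) (ℤ.neg-distribˡ-* (+ x) (+ p)))))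
        where
        eq′ : 1ℤ + + y * + ∣ a ∣ ≡ + x * + p
        eq′ = ≡.trans (cong (λ t → 1ℤ + t) (≡.sym (ℤ.pos-* y ∣ a ∣))) (≡.trans (cong (λ n → + n) eq) (ℤ.pos-* x p))
        lemma : ∀ y a → - y * a - 1ℤ ≡ - (1ℤ + y * a)
        lemma = solve-∀
      unit (GCD.Bézout.-+ x y eq) = + y , mod (divides (+ x) (≡.trans (cong (λ t → t - 1ℤ) (≡.sym eq′)) (lemma (+ x * + p))))
        where
        eq′ : 1ℤ + + x * + p ≡ + y * + ∣ a ∣
        eq′ = ≡.trans (cong (λ t → 1ℤ + t) (≡.sym (ℤ.pos-* x p))) (≡.trans (cong (λ n → + n) eq) (ℤ.pos-* y ∣ a ∣))
        lemma : ∀ t → 1ℤ + t - 1ℤ ≡ t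
        lemma = solve-∀
      from∣∣ : (∃ λ b → b * + ∣ a ∣ ≋ 1ℤ) → ∃ λ b → b * a ≋ 1ℤ
      from∣∣ (b , h) with ℤ.+∣i∣≡i⊎+∣i∣≡-i a
      ... | inj₁ eq = b , ≋-trans (≋-reflexive (cong (λ t → b * t) (≡.sym eq))) h
      ... | inj₂ eq = - b , ≋-trans (≋-reflexive (≡.trans (lemma b a) (cong (λ t → b * t) (≡.sym eq)))) h
        where
        lemma : ∀ b a → - b * a ≡ b * - a
        lemma = solve-∀

    small-≋ : ∀ {m n} → m ℕ.< p → n ℕ.< p → + m ≋ + n → m ≡ n
    small-≋ {m} {n} m<p n<p (mod h) = ℕ.∣m-n∣≡0⇒m≡n (zero-multiple _ d (ℕ.≤-<-trans (ℕ.∣m-n∣≤m⊔n m n) (ℕ.⊔-lub m<p n<p)))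
      where
      ∣⊖∣ : ∀ m n → ∣ m ℤ.⊖ n ∣ ≡ ℕ.∣ m - n ∣
      ∣⊖∣ zero zero = refl
      ∣⊖∣ zero (suc n) = refl
      ∣⊖∣ (suc m) zero = refl
      ∣⊖∣ (suc m) (suc n) = ≡.trans (cong ∣_∣ (ℤ.[1+m]⊖[1+n]≡m⊖n m n)) (∣⊖∣ m n)
      zero-multiple : ∀ k → p ℕ.∣ k → k ℕ.< p → k ≡ 0
      zero-multiple zero _ _ = refl
      zero-multiple k@(suc _) d k<p = ⊥-elim (ℕ.>⇒∤ k<p d)
      d : p ℕ.∣ ℕ.∣ m - n ∣
      d = ≡.subst (p ℕ.∣_) (≡.trans (cong ∣_∣ (ℤ.m-n≡m⊖n m n)) (∣⊖∣ m n)) (∣⇒∣ᵤ h)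

    abstract
      lift : Fin p → ℤ
      lift i = + toℕ i

      lift-injective : ∀ {i j} → lift i ≋ lift j → i ≡ j
      lift-injective {i} {j} h = toℕ-injective (small-≋ (toℕ<n i) (toℕ<n j) h)

      residue : ℤ → Fin p
      residue a = fromℕ< (n%ℕd<d a p)

      lift-residue : ∀ a → lift (residue a) ≋ a
      lift-residue a = ≋-sym (mod (divides (a /ℕ p) (≡.trans (cong₂ _-_ (a≡a%ℕn+[a/ℕn]*n a p) (cong (λ n → + n) (toℕ-fromℕ< (n%ℕd<d a p))))
        (lemma (+ (a %ℕ p)) ((a /ℕ p) * + p)))))
        where
        lemma : ∀ r q → r + q - r ≡ q
        lemma = solve-∀

    residue-≡ : ∀ {a b} → residue a ≡ residue b → a ≋ b
    residue-≡ {a} {b} eq = ≋-trans (≋-sym (lift-residue a)) (≋-trans (≋-reflexive (cong lift eq)) (lift-residue b))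

    ≋-⊹ : ∀ {a b c d} → a ≋ b → c ≋ d → a ⊹ c ≋ b ⊹ d
    ≋-⊹ {a} {b} {c} {d} p q = subst₂ _≋_ (⊹-def a c) (⊹-def b d) (≋-+ {a} {b} {c} {d} p q)

    ≋-· : ∀ {a b c d} → a ≋ b → c ≋ d → a · c ≋ b · d
    ≋-· {a} {b} {c} {d} p q = subst₂ _≋_ (·-def a c) (·-def b d) (≋-* {a} {b} {c} {d} p q)

    ≋-~ : ∀ {a b} → a ≋ b → ~ a ≋ ~ b
    ≋-~ {a} {b} p = subst₂ _≋_ (~-def a) (~-def b) (≋-neg {a} {b} p)

    ≋0-· : ∀ a b → a · b ≋ 0ℤ → a ≋ 0ℤ ⊎ b ≋ 0ℤ
    ≋0-· a b h = ≋0-* a b (≡.subst (_≋ 0ℤ) (≡.sym (·-def a b)) h)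

    inverse-· : ∀ a → ¬ a ≋ 0ℤ → ∃ λ b → b · a ≋ 1ℤ
    inverse-· a a≢0 = proj₁ (inverse a a≢0) , ≡.subst (_≋ 1ℤ) (·-def (proj₁ (inverse a a≢0)) a) (proj₂ (inverse a a≢0))

    cubic : ℤ → ℤ
    cubic t = t · t · t ⊹ ~ t

    cubic-cong : ∀ {s t} → s ≋ t → cubic s ≋ cubic t
    cubic-cong h = ≋-⊹ (≋-· (≋-· h h) h) (≋-~ h)

    RootFree : ℤ → Set
    RootFree c = ∀ t → ¬ cubic t ≋ c

    cubic-residue : Fin p → Fin p
    cubic-residue t = residue (cubic (lift t))

    cubic-residue-lift : ∀ t → lift (cubic-residue (residue t)) ≋ cubic t
    cubic-residue-lift t = ≋-trans (lift-residue (cubic (lift (residue t)))) (cubic-cong (lift-residue t))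

    residue-0≢1 : residue 0ℤ ≢ residue 1ℤ
    residue-0≢1 eq = ℕ.0≢1+n (small-≋ {0} {1} (ℕ.>-nonZero⁻¹ p) (ℕ.nonTrivial⇒n>1 p) (residue-≡ {0ℤ} {1ℤ} eq))

    cubic-0≡1 : cubic 0ℤ ≡ cubic 1ℤ
    cubic-0≡1 = solve 0 (con 0ℤ :* con 0ℤ :* con 0ℤ :+ :- con 0ℤ := con 1ℤ :* con 1ℤ :* con 1ℤ :+ :- con 1ℤ) refl

    -- t ↦ t³ - t identifies 0 and 1, so it is not onto.
    cubic-residue-misses : ∃ λ c → ¬ ∃ λ t → cubic-residue t ≡ c
    cubic-residue-misses = ¬∀⟶∃¬ p (λ c → ∃ λ t → cubic-residue t ≡ c) (λ c → any? λ t → cubic-residue t Fin.≟ c)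
      (λ onto → residue-0≢1 (surjective⇒injective cubic-residue (λ c → proj₁ (onto c)) (λ c → proj₂ (onto c))
        (lift-injective (≋-trans (cubic-residue-lift 0ℤ) (≋-trans (≋-reflexive cubic-0≡1) (≋-sym (cubic-residue-lift 1ℤ)))))))

    ∃-root-free : ∃ RootFree
    ∃-root-free = lift (proj₁ cubic-residue-misses) , λ t h →
      proj₂ cubic-residue-misses (residue t , lift-injective (≋-trans (cubic-residue-lift t) h))

    module Field (odd : ¬ p ℕ.∣ 2) (c : ℤ) (root-free : RootFree c) where
      open CubicExtension _⊹_ _·_ ~_ c
      open ExactLaws c
      private
        module Z = CommutativeRing ⊹-·-commutativeRing

      square-≋0 : ∀ a → a · a ≋ 0ℤ → a ≋ 0ℤ
      square-≋0 a h = [ (λ k → k) , (λ k → k) ]′ (≋0-· a a h)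

      -- The homogenisation of t³ - t - c.
      form : ℤ → ℤ → ℤ
      form y z = y · y · y ⊹ ~ (y · (z · z)) ⊹ ~ (c · (z · z · z))

      form-anisotropic : ∀ y z → form y z ≋ 0ℤ → y ≋ 0ℤ × z ≋ 0ℤ
      form-anisotropic y z h with z ≋0?
      ... | yes z≋0 = [ square-≋0 y , (λ k → k) ]′ (≋0-· (y · y) y (≋-trans (≋-reflexive lemma)
                        (≋-trans (≋-⊹ h (≋-· z≋0 (≋-refl {y · z ⊹ c · (z · z)}))) (≋-reflexive zero′)))) , z≋0
        where
        lemma : y · y · y ≡ form y z ⊹ z · (y · z ⊹ c · (z · z))
        lemma = solve 3 (λ c y z → y :* y :* y := (y :* y :* y :+ :- (y :* (z :* z)) :+ :- (c :* (z :* z :* z))) :+ z :* (y :* z :+ c :* (z :* z))) refl c y z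
        zero′ : 0ℤ ⊹ 0ℤ · (y · z ⊹ c · (z · z)) ≡ 0ℤ
        zero′ = solve 3 (λ c y z → con 0ℤ :+ con 0ℤ :* (y :* z :+ c :* (z :* z)) := con 0ℤ) refl c y z
      -- Dividing by z³ makes y / z a root of t³ - t = c.
      ... | no z≢0 = ⊥-elim (root-free (y · s) (≋-trans (≋-reflexive one)
                (≋-trans (≋-⊹ (≋-refl {y · s · (y · s) · (y · s)}) (≋-~ (≋-· (≋-refl {y · s}) (≋-sym (≋-· sz sz)))))
                (≋-trans (≋-reflexive lemma)
                (≋-trans (≋-⊹ (≋-· (≋-refl {s · s · s}) h) (≋-· (≋-refl {c}) (≋-· (≋-· sz sz) sz))) (≋-reflexive two))))))
        where
        s = proj₁ (inverse-· z z≢0)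
        sz = proj₂ (inverse-· z z≢0)
        one : cubic (y · s) ≡ y · s · (y · s) · (y · s) ⊹ ~ (y · s · (1ℤ · 1ℤ))
        one = solve 2 (λ y s → y :* s :* (y :* s) :* (y :* s) :+ :- (y :* s) := y :* s :* (y :* s) :* (y :* s) :+ :- (y :* s :* (con 1ℤ :* con 1ℤ))) refl y s
        two : s · s · s · 0ℤ ⊹ c · (1ℤ · 1ℤ · 1ℤ) ≡ c
        two = solve 2 (λ c s → s :* s :* s :* con 0ℤ :+ c :* (con 1ℤ :* con 1ℤ :* con 1ℤ) := c) refl c s
        lemma : y · s · (y · s) · (y · s) ⊹ ~ (y · s · (s · z · (s · z))) ≡ s · s · s · form y z ⊹ c · (s · z · (s · z) · (s · z))
        lemma = solve 4 (λ c y z s → y :* s :* (y :* s) :* (y :* s) :+ :- (y :* s :* (s :* z :* (s :* z)))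
          := s :* s :* s :* (y :* y :* y :+ :- (y :* (z :* z)) :+ :- (c :* (z :* z :* z))) :+ c :* (s :* z :* (s :* z) :* (s :* z))) refl c y z s

      infix 4 _≈_
      record _≈_ (x y : Triple ℤ) : Set where
        constructor triple
        field
          e₀ : Triple.c₀ x ≋ Triple.c₀ y
          e₁ : Triple.c₁ x ≋ Triple.c₁ y
          e₂ : Triple.c₂ x ≋ Triple.c₂ y
      open _≈_ public

      ≈-reflexive : ∀ {x y} → x ≡ y → x ≈ y
      ≈-reflexive refl = triple ≋-refl ≋-refl ≋-refl

      -- Evaluating the operations on pairs of congruent integers shows that they respect congruence.
      private
        record Pair : Set where
          constructor pair
          field
            {l r} : ℤ
            l≋r : l ≋ r
        open Pair
        module C = CubicExtension {Pair} (λ a b → pair (≋-⊹ (l≋r a) (l≋r b))) (λ a b → pair (≋-· (l≋r a) (l≋r b))) (λ a → pair (≋-~ (l≋r a))) (pair (≋-refl {c}))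

        pairs : ∀ {x y} → x ≈ y → Triple Pair
        pairs (triple p q r) = ⟨ pair p , pair q , pair r ⟩

        unpairs : (t : Triple Pair) → ⟨ l (Triple.c₀ t) , l (Triple.c₁ t) , l (Triple.c₂ t) ⟩ ≈ ⟨ r (Triple.c₀ t) , r (Triple.c₁ t) , r (Triple.c₂ t) ⟩
        unpairs t = triple (l≋r (Triple.c₀ t)) (l≋r (Triple.c₁ t)) (l≋r (Triple.c₂ t))

      ≈-refl : ∀ {x} → x ≈ x
      ≈-refl = ≈-reflexive refl

      -- `y` times the third coordinate of the adjoint minus `z` times the second is `form y z`, so
      -- `y` and `z` vanish; then the first coordinate is x².
      ♯-reflects-0 : ∀ x → x ♯ ≈ ⟨ 0ℤ , 0ℤ , 0ℤ ⟩ → x ≈ ⟨ 0ℤ , 0ℤ , 0ℤ ⟩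
      ♯-reflects-0 ⟨ x , y , z ⟩ (triple p q r) = triple (square-≋0 x (≋-trans (≋-reflexive lemma₀)
          (≋-trans (≋-⊹ (≋-⊹ p (≋-· y≋0 (≋-refl {y ⊹ c · z}))) (≋-~ (≋-· z≋0 (≋-refl {x ⊹ x ⊹ z})))) (≋-reflexive zero₀)))) y≋0 z≋0
        where
        lemma₀ : x · x ≡ x · x ⊹ (x · z ⊹ x · z) ⊹ z · z ⊹ ~ (y · y) ⊹ ~ (c · (y · z)) ⊹ y · (y ⊹ c · z) ⊹ ~ (z · (x ⊹ x ⊹ z))
        lemma₀ = solve 4 (λ c x y z → x :* x := x :* x :+ (x :* z :+ x :* z) :+ z :* z :+ :- (y :* y) :+ :- (c :* (y :* z)) :+ y :* (y :+ c :* z) :+ :- (z :* (x :+ x :+ z))) refl c x y z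
        zero₀ : 0ℤ ⊹ 0ℤ · (y ⊹ c · z) ⊹ ~ (0ℤ · (x ⊹ x ⊹ z)) ≡ 0ℤ
        zero₀ = solve 4 (λ c x y z → con 0ℤ :+ con 0ℤ :* (y :+ c :* z) :+ :- (con 0ℤ :* (x :+ x :+ z)) := con 0ℤ) refl c x y z
        lemma₁ : form y z ≡ y · (y · y ⊹ ~ (x · z) ⊹ ~ (z · z)) ⊹ (~ z) · (c · (z · z) ⊹ ~ (x · y))
        lemma₁ = solve 4 (λ c x y z → y :* y :* y :+ :- (y :* (z :* z)) :+ :- (c :* (z :* z :* z))
          := y :* (y :* y :+ :- (x :* z) :+ :- (z :* z)) :+ (:- z) :* (c :* (z :* z) :+ :- (x :* y))) refl c x y z
        zero₁ : y · 0ℤ ⊹ (~ z) · 0ℤ ≡ 0ℤ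
        zero₁ = solve 2 (λ y z → y :* con 0ℤ :+ (:- z) :* con 0ℤ := con 0ℤ) refl y z
        both : y ≋ 0ℤ × z ≋ 0ℤ
        both = form-anisotropic y z (≋-trans (≋-reflexive lemma₁) (≋-trans (≋-⊹ (≋-· (≋-refl {y}) r) (≋-· (≋-refl { ~ z}) q)) (≋-reflexive zero₁)))
        y≋0 = proj₁ both
        z≋0 = proj₂ both

      commutativeRing : CommutativeRing 0ℓ 0ℓ
      commutativeRing = record
        { Carrier = Triple ℤ ; _≈_ = _≈_ ; _+_ = _⊞_ ; _*_ = _⊠_ ; -_ = ⊟_ ; 0# = ⟨ 0ℤ , 0ℤ , 0ℤ ⟩ ; 1# = ⟨ 1ℤ , 0ℤ , 0ℤ ⟩
        ; isCommutativeRing = record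
          { isRing = record
            { +-isAbelianGroup = record
              { isGroup = record
                { isMonoid = record
                  { isSemigroup = record
                    { isMagma = record { isEquivalence = ≈-isEquivalence ; ∙-cong = λ p q → unpairs (pairs p C.⊞ pairs q) }
                    ; assoc = λ x y z → ≈-reflexive (triple≡ (Z.+-assoc _ _ _) (Z.+-assoc _ _ _) (Z.+-assoc _ _ _)) }
                  ; identity = (λ x → ≈-reflexive (triple≡ (Z.+-identityˡ _) (Z.+-identityˡ _) (Z.+-identityˡ _)))
                             , (λ x → ≈-reflexive (triple≡ (Z.+-identityʳ _) (Z.+-identityʳ _) (Z.+-identityʳ _))) }
                ; inverse = (λ x → ≈-reflexive (triple≡ (Z.-‿inverseˡ (Triple.c₀ x)) (Z.-‿inverseˡ (Triple.c₁ x)) (Z.-‿inverseˡ (Triple.c₂ x))))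
                          , (λ x → ≈-reflexive (triple≡ (Z.-‿inverseʳ (Triple.c₀ x)) (Z.-‿inverseʳ (Triple.c₁ x)) (Z.-‿inverseʳ (Triple.c₂ x))))
                ; ⁻¹-cong = λ p → unpairs (C.⊟ pairs p) }
              ; comm = λ x y → ≈-reflexive (triple≡ (Z.+-comm (Triple.c₀ x) _) (Z.+-comm (Triple.c₁ x) _) (Z.+-comm (Triple.c₂ x) _)) }
            ; *-cong = λ p q → unpairs (pairs p C.⊠ pairs q)
            ; *-assoc = λ x y z → ≈-reflexive (⊠-assoc x y z)
            ; *-identity = (λ x → ≈-reflexive (⊠-identityˡ x)) , (λ x → ≈-reflexive (≡.trans (⊠-comm x _) (⊠-identityˡ x)))
            ; distrib = (λ x y z → ≈-reflexive (⊠-⊞ x y z))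
                      , (λ x y z → ≈-reflexive (≡.trans (⊠-comm _ x) (≡.trans (⊠-⊞ x y z) (cong₂ _⊞_ (⊠-comm x y) (⊠-comm x z))))) }
          ; *-comm = λ x y → ≈-reflexive (⊠-comm x y) } }
        where
        ≈-isEquivalence : IsEquivalence _≈_
        ≈-isEquivalence = record
          { refl = ≈-refl
          ; sym = λ (triple p q r) → triple (≋-sym p) (≋-sym q) (≋-sym r)
          ; trans = λ (triple p q r) (triple p′ q′ r′) → triple (≋-trans p p′) (≋-trans q q′) (≋-trans r r′) }

      private
        module K = CommutativeRing commutativeRing

      embed-⊠-≈0 : ∀ n x → embed 0ℤ n ⊠ x ≈ K.0# → n ≋ 0ℤ ⊎ x ≈ K.0#
      embed-⊠-≈0 n ⟨ x , y , z ⟩ h with n ≋0?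
      ... | yes n≋0 = inj₁ n≋0
      ... | no n≢0 = inj₂ (triple (divide x (≋-trans (≋-reflexive lemma₀) (e₀ h))) (divide y (≋-trans (≋-reflexive lemma₁) (e₁ h)))
                                  (divide z (≋-trans (≋-reflexive lemma₂) (e₂ h))))
        where
        divide : ∀ a → n · a ≋ 0ℤ → a ≋ 0ℤ
        divide a k = [ (λ n≋0 → ⊥-elim (n≢0 n≋0)) , (λ a≋0 → a≋0) ]′ (≋0-· n a k)
        lemma₀ : n · x ≡ n · x ⊹ c · (0ℤ · z ⊹ 0ℤ · y)
        lemma₀ = solve 5 (λ c n x y z → n :* x := n :* x :+ c :* (con 0ℤ :* z :+ con 0ℤ :* y)) refl c n x y z
        lemma₁ : n · y ≡ n · y ⊹ 0ℤ · x ⊹ (0ℤ · z ⊹ 0ℤ · y) ⊹ c · (0ℤ · z)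
        lemma₁ = solve 5 (λ c n x y z → n :* y := n :* y :+ con 0ℤ :* x :+ (con 0ℤ :* z :+ con 0ℤ :* y) :+ c :* (con 0ℤ :* z)) refl c n x y z
        lemma₂ : n · z ≡ n · z ⊹ 0ℤ · y ⊹ 0ℤ · x ⊹ 0ℤ · z
        lemma₂ = solve 4 (λ n x y z → n :* z := n :* z :+ con 0ℤ :* y :+ con 0ℤ :* x :+ con 0ℤ :* z) refl n x y z

      -- Since `x ♯ ♯` is the norm times `x`, it vanishes with the norm, and the adjoint can be
      -- stripped off twice.
      norm-≋0 : ∀ x → norm x ≋ 0ℤ → x ≈ K.0#
      norm-≋0 x h = ♯-reflects-0 x (♯-reflects-0 (x ♯) (K.trans (≈-reflexive (♯-♯ x)) (K.trans (K.*-congʳ {x} (triple h ≋-refl ≋-refl)) (K.zeroˡ x))))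

      ring : CubicNormRing
      ring = record
        { commutativeRing = commutativeRing
        ; ι = embed 0ℤ
        ; ι-+ = λ m n → ≈-reflexive (triple≡ (⊹-def m n) (⊹-def 0ℤ 0ℤ) (⊹-def 0ℤ 0ℤ))
        ; ι-* = λ m n → ≈-reflexive (≡.trans (cong (embed 0ℤ) (·-def m n)) (embed-* m n))
        ; ι-neg = λ m → ≈-reflexive (triple≡ (~-def m) (~-def 0ℤ) (~-def 0ℤ))
        ; ι-0 = ≈-refl
        ; ι-1 = ≈-refl
        ; _♯ = _♯ ; _⋇_ = _⋇_ ; T = T 0ℤ ; norm = norm
        ; ♯-cong = λ p → unpairs (pairs p C.♯)
        ; ⋇-congˡ = λ {x} {y} {z} p → unpairs (pairs p C.⋇ pairs (≈-refl {z}))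
        ; T-congˡ = λ {x} {y} {z} p → unpairs (C.T (pair (≋-refl {0ℤ})) (pairs p) (pairs (≈-refl {z})))
        ; ♯-+ = λ x y → ≈-reflexive (♯-⊞ x y)
        ; ♯-scale = λ n x → ≈-reflexive (♯-embed n x)
        ; ♯-* = λ x y → ≈-reflexive (♯-⊠ x y)
        ; *-♯ = λ x → ≈-reflexive (⊠-♯ x)
        ; ⋇-comm = λ x y → ≈-reflexive (⋇-comm x y)
        ; ⋇-+ˡ = λ x y z → ≈-reflexive (⋇-⊞ x y z)
        ; ⋇-scaleˡ = λ n x y → ≈-reflexive (⋇-embed n x y)
        ; T-comm = λ x y → ≈-reflexive (T-comm x y)
        ; T-+ˡ = λ x y z → ≈-reflexive (T-⊞ x y z)
        ; T-scaleˡ = λ n x y → ≈-reflexive (T-embed n x y)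
        ; T-♯ = λ x y → ≈-reflexive (T-♯ x y)
        ; T-⋇ = λ x y z → ≈-reflexive (T-⋇ x y z)
        ; domain = domain
        ; ♯-reflects-0 = ♯-reflects-0
        ; halve = λ x (triple p q r) → triple (halve p) (halve q) (halve r) }
        where
        -- Multiplying by `x ♯` replaces `x` by its norm, a scalar, which can be cancelled
        -- coordinate by coordinate.
        domain : ∀ x y → x ⊠ y ≈ K.0# → x ≈ K.0# ⊎ y ≈ K.0#
        domain x y h = Sum.map (norm-≋0 x) (λ y≈0 → y≈0) (embed-⊠-≈0 (norm x) y
          (K.trans (K.*-congʳ {y} (≈-reflexive (≡.trans (≡.sym (⊠-♯ x)) (⊠-comm x (x ♯)))))
          (K.trans (K.*-assoc (x ♯) x y) (K.trans (K.*-congˡ {x ♯} h) (K.zeroʳ (x ♯))))))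
        halve : ∀ {a} → a ⊹ a ≋ 0ℤ → a ≋ 0ℤ
        halve {a} h = [ (λ k → ⊥-elim (odd (∣⇒∣ᵤ (≋0⇒∣ k)))) , (λ k → k) ]′ (≋0-· (+ 2) a (≋-trans (≋-reflexive (solve 1 (λ a → con (+ 2) :* a := a :+ a) refl a)) h))

-- Partite hypergraphs and their Berge cycles

module Hypergraphs where
  open import Defs
  open import Data.Nat.Base as ℕ using (ℕ; zero; suc)
  open import Data.Bool.Base using (true; false)
  open import Data.Fin.Base using (Fin; zero; suc; combine; inject≤)
  open import Data.Fin.Properties as Fin using (combine-injective; inject≤-injective; 0≢1+n; suc-injective)
  open import Data.Fin.Patterns using (0F; 1F)
  open import Data.Fin.Subset using (Subset; inside; _∈_; _∉_; ∣_∣; ⊥)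
  open import Data.Fin.Subset.Properties using (∉⊥; ∣⊥∣≡0)
  open import Data.Vec.Base using (_∷_; _[_]≔_; here; there)
  open import Data.Vec.Properties using ([]=⇒lookup; lookup⇒[]=; lookup∘update; lookup∘update′)
  open import Data.Product using (∃; ∃₂; _,_; _×_; proj₁; proj₂)
  open import Data.Empty using (⊥-elim)
  open import Function.Base using (_∘_)
  open import Function.Definitions using (Injective)
  open import Relation.Nullary using (¬_; yes; no)
  open import Relation.Binary.PropositionalEquality using (_≡_; _≢_; refl; sym; trans; cong; subst)

  ∣insert∣ : ∀ {n} (s : Subset n) x → x ∉ s → ∣ s [ x ]≔ inside ∣ ≡ suc ∣ s ∣
  ∣insert∣ (true ∷ s) zero x∉s = ⊥-elim (x∉s here)
  ∣insert∣ (false ∷ s) zero x∉s = refl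
  ∣insert∣ (true ∷ s) (suc x) x∉s = cong suc (∣insert∣ s x (x∉s ∘ there))
  ∣insert∣ (false ∷ s) (suc x) x∉s = ∣insert∣ s x (x∉s ∘ there)

  image : ∀ {r n} → (Fin r → Fin n) → Subset n
  image {zero} g = ⊥
  image {suc r} g = image (g ∘ suc) [ g zero ]≔ inside

  ∈-image⁺ : ∀ {r n} (g : Fin r → Fin n) i → g i ∈ image g
  ∈-image⁺ g zero = lookup⇒[]= (g zero) _ (lookup∘update (g zero) (image (g ∘ suc)) inside)
  ∈-image⁺ g (suc i) with g (suc i) Fin.≟ g zero
  ... | yes eq = subst (_∈ image g) (sym eq) (∈-image⁺ g zero)
  ... | no neq = lookup⇒[]= (g (suc i)) _ (trans (lookup∘update′ neq (image (g ∘ suc)) inside) ([]=⇒lookup (∈-image⁺ (g ∘ suc) i)))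

  ∈-image⁻ : ∀ {r n} (g : Fin r → Fin n) {x} → x ∈ image g → ∃ λ i → g i ≡ x
  ∈-image⁻ {zero} g x∈ = ⊥-elim (∉⊥ x∈)
  ∈-image⁻ {suc r} g {x} x∈ with x Fin.≟ g zero
  ... | yes eq = zero , sym eq
  ... | no neq with ∈-image⁻ (g ∘ suc) (lookup⇒[]= x _ (trans (sym (lookup∘update′ neq (image (g ∘ suc)) inside)) ([]=⇒lookup x∈)))
  ...   | i , eq = suc i , eq

  ∣image∣ : ∀ {r n} (g : Fin r → Fin n) → Injective _≡_ _≡_ g → ∣ image g ∣ ≡ r
  ∣image∣ {zero} {n} g _ = ∣⊥∣≡0 n
  ∣image∣ {suc r} g inj = trans (∣insert∣ (image (g ∘ suc)) (g zero) λ g0∈ → 0≢1+n (sym (inj (proj₂ (∈-image⁻ (g ∘ suc) g0∈)))))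
    (cong suc (∣image∣ (g ∘ suc) (suc-injective ∘ inj)))

  -- Lines are edges, and the point φ i l is the unique vertex of l in the i-th of r disjoint classes.
  module Incidence {r lines points N : ℕ} (φ : Fin r → Fin lines → Fin points) (fits : r ℕ.* points ℕ.≤ N)
    (two : ∃₂ λ (i j : Fin r) → i ≢ j)
    (linear : ∀ {i j l m} → i ≢ j → φ i l ≡ φ i m → φ j l ≡ φ j m → l ≡ m) where

    vertex : Fin lines → Fin r → Fin N
    vertex l i = inject≤ (combine i (φ i l)) fits

    vertex-injective : ∀ {l m i j} → vertex l i ≡ vertex m j → i ≡ j × φ i l ≡ φ j m
    vertex-injective eq = combine-injective _ _ _ _ (inject≤-injective fits fits _ _ eq)

    shared : ∀ {l m i j} → vertex l i ≡ vertex m j → φ i l ≡ φ i m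
    shared eq with vertex-injective eq
    ... | refl , same = same

    hypergraph : Hypergraph r N
    hypergraph = record
      { m = lines
      ; edge = image ∘ vertex
      ; distinct = λ {l} {m} eq → linear (proj₂ (proj₂ two)) (contained eq _) (contained eq _)
      ; uniform = λ l → ∣image∣ (vertex l) (proj₁ ∘ vertex-injective) }
      where
      contained : ∀ {l m} → image (vertex l) ≡ image (vertex m) → ∀ i → φ i l ≡ φ i m
      contained {l} {m} eq i = shared (sym (proj₂ (∈-image⁻ (vertex m) (subst (vertex l i ∈_) eq (∈-image⁺ (vertex l) i)))))

    -- `class t` is the class of the cycle's vertex `v (next t)`, which lies on the edges `t` and
    -- `next t`. Consecutive classes differ because an edge has one vertex in each class and the
    -- vertices of the cycle are distinct; the premise of `turns` excludes length one.
    record Cycle (k : ℕ) : Set where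
      field
        class : Fin (suc k) → Fin r
        edges : Fin (suc k) → Fin lines
        edges-injective : Injective _≡_ _≡_ edges
        meets : ∀ t → φ (class t) (edges t) ≡ φ (class t) (edges (next t))
        turns : ∀ t → next t ≢ next (next t) → class t ≢ class (next t)

    cycle : ∀ {k} → BergeCycle hypergraph (suc k) → Cycle k
    cycle (v , e , v-inj , e-inj , here∈ , next∈) = record
      { class = class ; edges = e ; edges-injective = e-inj
      ; meets = λ t → shared (trans (on t) (sym (proj₂ (∈-image⁻ (vertex (e (next t))) (here∈ (next t))))))
      ; turns = λ t neq same → neq (v-inj (trans (sym (on′ t)) (trans (cong (vertex (e (next t))) same) (on (next t))))) }
      where
      class : _ → _
      class t = proj₁ (∈-image⁻ (vertex (e t)) (next∈ t))
      on : ∀ t → vertex (e t) (class t) ≡ v (next t)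
      on t = proj₂ (∈-image⁻ (vertex (e t)) (next∈ t))
      on′ : ∀ t → vertex (e (next t)) (class t) ≡ v (next t)
      on′ t with ∈-image⁻ (vertex (e (next t))) (here∈ (next t))
      ... | i , eq = trans (cong (vertex (e (next t))) (proj₁ (vertex-injective (trans (on t) (sym eq))))) eq

    no-digon : ¬ Cycle 1
    no-digon C = 0≢1 (edges-injective (linear (turns 0F λ ()) (meets 0F) (sym (meets 1F))))
      where
      open Cycle C
      0≢1 : _≢_ {A = Fin 2} 0F 1F
      0≢1 ()

-- The two incidence structures over the cubic field

module Constructions where
  open import Defs
  open import Algebra.Bundles using (CommutativeRing)
  open import Data.Nat.Base as ℕ using (ℕ; zero; suc; s≤s)
  import Data.Nat.Divisibility as ℕ
  open import Data.Nat.Primality using (Prime)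
  open import Data.Integer.Base as ℤ using (ℤ; 0ℤ)
  open import Data.Integer.Divisibility.Signed using (_∣_)
  open import Data.Integer.Tactic.RingSolver using (solve-∀)
  open import Data.Fin.Base using (Fin; zero; suc; combine; finToFun; funToFin)
  open import Data.Fin.Properties using (funToFin-finToFin; finToFun-funToFin)
  open import Data.Fin.Patterns using (0F; 1F; 2F; 3F; 4F; 5F; 6F; 7F; 8F; 9F)
  open import Data.Product using (∃₂)
  open import Function.Base using (_∘_)
  open import Relation.Nullary using (¬_)
  open import Relation.Binary.PropositionalEquality as ≡ using (_≡_; _≢_; refl; cong; cong₂; subst)
  open CubicNorm using (CubicNormRing)
  open Cubic
  open Residues
  open Hypergraphs

  funToFin-cong : ∀ {m n} {f g : Fin m → Fin n} → (∀ i → f i ≡ g i) → funToFin f ≡ funToFin g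
  funToFin-cong {zero} h = refl
  funToFin-cong {suc m} h = cong₂ combine (h zero) (funToFin-cong (h ∘ suc))

  module Digits (p : ℕ) (prime : Prime p) where
    open Modular p prime

    digit : ∀ {n} → Fin (p ℕ.^ n) → Fin n → ℤ
    digit {n} k i = lift (finToFun {p} {n} k i)

    digit-injective : ∀ {n} {k l : Fin (p ℕ.^ n)} → (∀ i → digit {n} k i ≋ digit {n} l i) → k ≡ l
    digit-injective {n} {k} {l} h = ≡.trans (≡.sym (funToFin-finToFin {n} {p} k))
      (≡.trans (funToFin-cong (λ i → lift-injective (h i))) (funToFin-finToFin {n} {p} l))

    encode : ∀ {n} → (Fin n → ℤ) → Fin (p ℕ.^ n)
    encode f = funToFin (residue ∘ f)

    encode-≋ : ∀ {n} {f g : Fin n → ℤ} → encode f ≡ encode g → ∀ i → f i ≋ g i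
    encode-≋ {n} {f} {g} eq i = residue-≡ (≡.trans (≡.sym (finToFun-funToFin (residue ∘ f) i))
      (≡.trans (cong (λ k → finToFun {p} {n} k i) eq) (finToFun-funToFin (residue ∘ g) i)))

  module Construction (p : ℕ) (prime : Prime p) (odd : ¬ p ℕ.∣ 2) (c : ℤ) (root-free : Modular.RootFree p prime c)
    {r : ℕ} (slope : Fin r → ℤ) where
    open Modular p prime
    open Digits p prime
    open Field odd c root-free hiding (commutativeRing)
    open CubicExtension _⊹_ _·_ ~_ c
    open ExactLaws c
    open CubicNormRing ring using (commutativeRing; ι)
    module G = CubicNorm.Polygons ring
    private
      module K = CommutativeRing commutativeRing
    open G using (Line; line; Touch; Meet)

    Distinct : Set
    Distinct = ∀ {i j} → i ≢ j → ¬ slope i ≋ slope j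

    -- Only cyclic neighbours are required to differ: opposite vertices of a four-cycle may lie in
    -- the same class, so with i = k three-term progressions of slopes are excluded as well.
    Sidon : Set
    Sidon = ∀ {i j k l} → i ≢ j → j ≢ k → k ≢ l → l ≢ i → ¬ slope i ℤ.+ slope k ≋ slope j ℤ.+ slope l

    differences-≋ : ∀ a b c d → (a ℤ.- b) ⊹ (c ℤ.- d) ≋ 0ℤ → a ℤ.+ c ≋ b ℤ.+ d
    differences-≋ a b c d h = mod (subst (ℤ.+ p ∣_) (lemma a b c d) (≋0⇒∣ (subst (_≋ 0ℤ) (≡.sym (⊹-def _ _)) h)))
      where
      lemma : ∀ a b c d → (a ℤ.- b) ℤ.+ (c ℤ.- d) ≡ (a ℤ.+ c) ℤ.- (b ℤ.+ d)
      lemma = solve-∀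

    difference-≋ : ∀ a b → a ⊹ ~ b ≋ 0ℤ → a ≋ b
    difference-≋ a b h = mod (≋0⇒∣ (subst (_≋ 0ℤ) (≡.trans (cong (a ⊹_) (≡.sym (~-def b))) (≡.sym (⊹-def a (ℤ.- b)))) h))

    embed-⊹ : ∀ a b → ι (a ⊹ b) K.≈ ι a K.+ ι b
    embed-⊹ a b = K.trans (≈-reflexive (cong ι (≡.sym (⊹-def a b)))) (CubicNormRing.ι-+ ring a b)

    embed-~ : ∀ a → ι (~ a) K.≈ K.- ι a
    embed-~ a = K.trans (≈-reflexive (cong ι (≡.sym (~-def a)))) (CubicNormRing.ι-neg ring a)

    embed-· : ∀ a b → ι (a · b) K.≈ ι a K.* ι b
    embed-· a b = ≈-reflexive (embed-* a b)

    scaled-norm : ∀ a x → ι (a · norm x) K.≈ ι a K.* G.N x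
    scaled-norm a x = K.trans (embed-· a (norm x)) (K.*-congˡ {ι a} (≈-reflexive (≡.sym (⊠-♯ x))))

    module _ (distinct : Distinct) where
      slope-difference : ∀ {i j} → i ≢ j → ¬ ι (slope i ℤ.- slope j) K.≈ K.0#
      slope-difference i≢j h = distinct i≢j (mod (≋0⇒∣ (e₀ h)))

      slope-difference′ : ∀ {i j} → i ≢ j → ¬ ι (slope i) K.- ι (slope j) K.≈ K.0#
      slope-difference′ {i} {j} i≢j h = distinct i≢j (difference-≋ (slope i) (slope j) (e₀ h))

    -- Girth five: ten coordinates per edge, seven per vertex

    module Girth5 where
      coordinates : Triple ℤ → Triple ℤ → ℤ → Fin 7 → ℤ
      coordinates q w z 0F = Triple.c₀ q
      coordinates q w z 1F = Triple.c₁ q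
      coordinates q w z 2F = Triple.c₂ q
      coordinates q w z 3F = Triple.c₀ w
      coordinates q w z 4F = Triple.c₁ w
      coordinates q w z 5F = Triple.c₂ w
      coordinates q w z 6F = z

      module _ (k : Fin (p ℕ.^ 10)) where
        private
          d : Fin 10 → ℤ
          d = digit {10} k
        u v w : Triple ℤ
        u = ⟨ d 0F , d 1F , d 2F ⟩
        v = ⟨ d 3F , d 4F , d 5F ⟩
        w = ⟨ d 6F , d 7F , d 8F ⟩
        z : ℤ
        z = d 9F
        flag : Line
        flag = line u v w (ι z) K.0#

      φ : Fin r → Fin (p ℕ.^ 10) → Fin (p ℕ.^ 7)
      φ i k = encode (coordinates (v k ⊞ ι (slope i) ⊠ u k) (w k ⊞ ι (slope i) ⊠ u k ♯) (z k ⊹ slope i · norm (u k)))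

      touch : ∀ {i k l} → φ i k ≡ φ i l → Touch (slope i) (flag k) (flag l)
      touch {i} {k} {l} eq = record
        { touch-v = triple (h 0F) (h 1F) (h 2F)
        ; touch-w = triple (h 3F) (h 4F) (h 5F)
        ; touch-z = K.trans (K.sym (value k)) (K.trans (triple (h 6F) ≋-refl ≋-refl) (value l)) }
        where
        point : Fin (p ℕ.^ 10) → Fin 7 → ℤ
        point k = coordinates (v k ⊞ ι (slope i) ⊠ u k) (w k ⊞ ι (slope i) ⊠ u k ♯) (z k ⊹ slope i · norm (u k))
        h : ∀ n → point k n ≋ point l n
        h = encode-≋ {7} {point k} {point l} eq
        value : ∀ k → ι (z k ⊹ slope i · norm (u k)) K.≈ ι (z k) K.+ ι (slope i) K.* G.N (u k)
        value k = K.trans (embed-⊹ (z k) (slope i · norm (u k))) (K.+-congˡ {ι (z k)} (scaled-norm (slope i) (u k)))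

      same : ∀ {a k l} → Touch a (flag k) (flag l) → u k K.≈ u l → k ≡ l
      same {a} {k} {l} t u≈ = digit-injective {10} λ
        { 0F → e₀ u≈ ; 1F → e₁ u≈ ; 2F → e₂ u≈
        ; 3F → e₀ v≈ ; 4F → e₁ v≈ ; 5F → e₂ v≈
        ; 6F → e₀ w≈ ; 7F → e₁ w≈ ; 8F → e₂ w≈
        ; 9F → e₀ (G.touch-z≈ t u≈) }
        where
        v≈ : v k K.≈ v l
        v≈ = G.touch-v≈ t u≈
        w≈ : w k K.≈ w l
        w≈ = G.touch-w≈ t u≈

      module _ (distinct : Distinct) (sidon : Sidon) (two : ∃₂ λ (i j : Fin r) → i ≢ j) {M : ℕ} (fits : r ℕ.* p ℕ.^ 7 ℕ.≤ M) where

        linear : ∀ {i j k l} → i ≢ j → φ i k ≡ φ i l → φ j k ≡ φ j l → k ≡ l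
        linear {i} {j} {k} {l} i≢j eq eq′ = same (touch eq)
          (G.slope-terms-≈⇒u≈ {slope i} {slope j} {flag k} {flag l} (slope-difference′ distinct i≢j) (Touch.touch-v (touch eq)) (Touch.touch-v (touch eq′)))

        open Incidence φ fits two linear

        apart : ∀ {i k l} → φ i k ≡ φ i l → k ≢ l → ¬ u l K.- u k K.≈ K.0#
        apart eq k≢l h = k≢l (same (touch eq) (K.sym (G.undiff h)))

        no-triangle : ¬ Cycle 2
        no-triangle C = G.no-touching-triangle a l t K.refl (slope-difference distinct (turns 0F λ ()))
            (apart (meets 0F) (λ eq → 0≢1 (edges-injective eq))) (apart (meets 1F) (λ eq → 1≢2 (edges-injective eq)))
          where
          open Cycle C
          a : Fin 4 → ℤ
          a 0F = slope (class 0F)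
          a 1F = slope (class 1F)
          a 2F = slope (class 2F)
          -- The fourth side is degenerate, joining the first edge to itself, and may be given any
          -- slope.
          a 3F = slope (class 0F)
          l : Fin 4 → Line
          l 0F = flag (edges 0F)
          l 1F = flag (edges 1F)
          l 2F = flag (edges 2F)
          l 3F = flag (edges 0F)
          t : ∀ i → Touch (a i) (l i) (l (G.rot₄ i))
          t 0F = touch (meets 0F)
          t 1F = touch (meets 1F)
          t 2F = touch (meets 2F)
          t 3F = G.touch-refl
          0≢1 : _≢_ {A = Fin 3} 0F 1F
          0≢1 ()
          1≢2 : _≢_ {A = Fin 3} 1F 2F
          1≢2 ()

        no-quadrangle : ¬ Cycle 3
        no-quadrangle C = G.no-touching-quadrilateral a l t
            (λ { 0F → slope-difference distinct (turns 3F λ ()) ; 1F → slope-difference distinct (turns 0F λ ())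
               ; 2F → slope-difference distinct (turns 1F λ ()) ; 3F → slope-difference distinct (turns 2F λ ()) })
            (λ { 0F → apart (meets 0F) (λ eq → neq₀ (edges-injective eq)) ; 1F → apart (meets 1F) (λ eq → neq₁ (edges-injective eq))
               ; 2F → apart (meets 2F) (λ eq → neq₂ (edges-injective eq)) ; 3F → apart (meets 3F) (λ eq → neq₃ (edges-injective eq)) })
            (λ h → sidon (turns 0F λ ()) (turns 1F λ ()) (turns 2F λ ()) (turns 3F λ ()) (differences-≋ (a 0F) (a 1F) (a 2F) (a 3F) (e₀ h)))
            (λ h → sidon (turns 3F λ ()) (turns 0F λ ()) (turns 1F λ ()) (turns 2F λ ()) (differences-≋ (a 3F) (a 0F) (a 1F) (a 2F) (e₀ h)))
          where
          open Cycle C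
          a : Fin 4 → ℤ
          a i = slope (class i)
          l : Fin 4 → Line
          l i = flag (edges i)
          t : ∀ i → Touch (a i) (l i) (l (G.rot₄ i))
          t 0F = touch (meets 0F)
          t 1F = touch (meets 1F)
          t 2F = touch (meets 2F)
          t 3F = touch (meets 3F)
          neq₀ : _≢_ {A = Fin 4} 0F 1F
          neq₀ ()
          neq₁ : _≢_ {A = Fin 4} 1F 2F
          neq₁ ()
          neq₂ : _≢_ {A = Fin 4} 2F 3F
          neq₂ ()
          neq₃ : _≢_ {A = Fin 4} 3F 0F
          neq₃ ()

        free : CycFree hypergraph 5
        free 1 (s≤s ()) _ _
        free 2 _ _ B = no-digon (cycle B)
        free 3 _ _ B = no-triangle (cycle B)
        free 4 _ _ B = no-quadrangle (cycle B)
        free (suc (suc (suc (suc (suc _))))) _ (s≤s (s≤s (s≤s (s≤s (s≤s ()))))) _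

    -- Girth six: eleven coordinates per edge, eight per vertex

    module Girth6 where
      coordinates : Triple ℤ → Triple ℤ → ℤ → ℤ → Fin 8 → ℤ
      coordinates q w z t 0F = Triple.c₀ q
      coordinates q w z t 1F = Triple.c₁ q
      coordinates q w z t 2F = Triple.c₂ q
      coordinates q w z t 3F = Triple.c₀ w
      coordinates q w z t 4F = Triple.c₁ w
      coordinates q w z t 5F = Triple.c₂ w
      coordinates q w z t 6F = z
      coordinates q w z t 7F = t

      module _ (k : Fin (p ℕ.^ 11)) where
        private
          d : Fin 11 → ℤ
          d = digit {11} k
        u v w : Triple ℤ
        u = ⟨ d 0F , d 1F , d 2F ⟩
        v = ⟨ d 3F , d 4F , d 5F ⟩
        w = ⟨ d 6F , d 7F , d 8F ⟩
        z t : ℤ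
        z = d 9F
        t = d (suc 9F)
        flag : Line
        flag = line u v w (ι z) (ι t)

      module _ (a : ℤ) (k : Fin (p ℕ.^ 11)) where
        q : Triple ℤ
        q = v k ⊞ ι a ⊠ u k

        -- Integers representing `cross-term` and `moment-term`, whose values are scalars; so each
        -- takes a single coordinate of the vertex.
        cross moment : ℤ
        cross = trace (q ⊠ u k ♯) ⊹ ~ (a · norm (u k) ⊹ a · norm (u k))
        moment = trace (q ♯ ⊠ u k) ⊹ ~ (a · trace (q ⊠ u k ♯)) ⊹ a · (a · norm (u k))

        point : Fin 8 → ℤ
        point = coordinates q (w k ⊞ (q ⋇ u k ⊞ ⊟ (ι a ⊠ u k ♯))) (z k ⊹ cross) (t k ⊹ moment)

        cross-value : ι (z k ⊹ cross) K.≈ ι (z k) K.+ G.cross-term a q (u k ♯) (G.N (u k))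
        cross-value = K.trans (embed-⊹ (z k) cross) (K.+-congˡ {ι (z k)}
          (K.trans (embed-⊹ (trace (q ⊠ u k ♯)) (~ aN+aN)) (K.+-congˡ {ι (trace (q ⊠ u k ♯))}
          (K.trans (embed-~ aN+aN) (K.-‿cong (K.trans (embed-⊹ aN aN) (K.+-cong (scaled-norm a (u k)) (scaled-norm a (u k)))))))))
          where
          aN aN+aN : ℤ
          aN = a · norm (u k)
          aN+aN = aN ⊹ aN

        moment-value : ι (t k ⊹ moment) K.≈ ι (t k) K.+ G.moment-term a q (u k) (u k ♯) (G.N (u k))
        moment-value = K.trans (embed-⊹ (t k) moment) (K.+-congˡ {ι (t k)}
          (K.trans (embed-⊹ (T₁ ⊹ ~ (a · T₂)) (a · (a · norm (u k)))) (K.+-cong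
            (K.trans (embed-⊹ T₁ (~ (a · T₂))) (K.+-congˡ {ι T₁} (K.trans (embed-~ (a · T₂)) (K.-‿cong (embed-· a T₂)))))
            (K.trans (embed-· a (a · norm (u k))) (K.trans (K.*-congˡ {ι a} (scaled-norm a (u k))) (K.sym (K.*-assoc (ι a) (ι a) (G.N (u k)))))))))
          where
          T₁ T₂ : ℤ
          T₁ = trace (q ♯ ⊠ u k)
          T₂ = trace (q ⊠ u k ♯)

      φ : Fin r → Fin (p ℕ.^ 11) → Fin (p ℕ.^ 8)
      φ i k = encode (point (slope i) k)

      meet : ∀ {i k l} → φ i k ≡ φ i l → Meet (slope i) (flag k) (flag l)
      meet {i} {k} {l} eq = record
        { meet-v = triple (h 0F) (h 1F) (h 2F)
        ; meet-w = triple (h 3F) (h 4F) (h 5F)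
        ; meet-z = K.trans (K.sym (cross-value (slope i) k)) (K.trans (triple (h 6F) ≋-refl ≋-refl) (cross-value (slope i) l))
        ; meet-t = K.trans (K.sym (moment-value (slope i) k)) (K.trans (triple (h 7F) ≋-refl ≋-refl) (moment-value (slope i) l)) }
        where
        h : ∀ n → point (slope i) k n ≋ point (slope i) l n
        h = encode-≋ {8} {point (slope i) k} {point (slope i) l} eq

      same : ∀ {a k l} → Meet a (flag k) (flag l) → u k K.≈ u l → k ≡ l
      same {a} {k} {l} h u≈ = digit-injective {11} λ
        { 0F → e₀ u≈ ; 1F → e₁ u≈ ; 2F → e₂ u≈
        ; 3F → e₀ v≈ ; 4F → e₁ v≈ ; 5F → e₂ v≈
        ; 6F → e₀ w≈ ; 7F → e₁ w≈ ; 8F → e₂ w≈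
        ; 9F → e₀ (G.meet-z≈ h u≈) ; (suc 9F) → e₀ (G.meet-t≈ h u≈) }
        where
        v≈ : v k K.≈ v l
        v≈ = G.meet-v≈ h u≈
        w≈ : w k K.≈ w l
        w≈ = G.meet-w≈ h u≈

      module _ (distinct : Distinct) (two : ∃₂ λ (i j : Fin r) → i ≢ j) {M : ℕ} (fits : r ℕ.* p ℕ.^ 8 ℕ.≤ M) where

        linear : ∀ {i j k l} → i ≢ j → φ i k ≡ φ i l → φ j k ≡ φ j l → k ≡ l
        linear {i} {j} {k} {l} i≢j eq eq′ = same (meet eq)
          (G.slope-terms-≈⇒u≈ {slope i} {slope j} {flag k} {flag l} (slope-difference′ distinct i≢j) (Meet.meet-v (meet eq)) (Meet.meet-v (meet eq′)))

        open Incidence φ fits two linear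

        apart : ∀ {i k l} → φ i k ≡ φ i l → k ≢ l → ¬ u l K.- u k K.≈ K.0#
        apart eq k≢l h = k≢l (same (meet eq) (K.sym (G.undiff h)))

        no-triangle : ¬ Cycle 2
        no-triangle C = G.no-quadrilateral a l h K.refl (slope-difference′ distinct (turns 0F λ ())) (slope-difference′ distinct (turns 1F λ ()))
            (apart (meets 0F) (λ eq → 0≢1 (edges-injective eq))) (apart (meets 1F) (λ eq → 1≢2 (edges-injective eq)))
          where
          open Cycle C
          a : Fin 5 → ℤ
          a 0F = slope (class 0F)
          a 1F = slope (class 1F)
          a 2F = slope (class 2F)
          -- Sides 3 and 4 are degenerate: both join the first edge to itself.
          a 3F = slope (class 0F)
          a 4F = slope (class 0F)
          l : Fin 5 → Line
          l 0F = flag (edges 0F)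
          l 1F = flag (edges 1F)
          l 2F = flag (edges 2F)
          l 3F = flag (edges 0F)
          l 4F = flag (edges 0F)
          h : ∀ i → Meet (a i) (l i) (l (G.rot i))
          h 0F = meet (meets 0F)
          h 1F = meet (meets 1F)
          h 2F = meet (meets 2F)
          h 3F = G.meet-refl
          h 4F = G.meet-refl
          0≢1 : _≢_ {A = Fin 3} 0F 1F
          0≢1 ()
          1≢2 : _≢_ {A = Fin 3} 1F 2F
          1≢2 ()

        no-quadrangle : ¬ Cycle 3
        no-quadrangle C = G.no-quadrilateral a l h K.refl (slope-difference′ distinct (turns 0F λ ())) (slope-difference′ distinct (turns 1F λ ()))
            (apart (meets 0F) (λ eq → 0≢1 (edges-injective eq))) (apart (meets 1F) (λ eq → 1≢2 (edges-injective eq)))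
          where
          open Cycle C
          a : Fin 5 → ℤ
          a 0F = slope (class 0F)
          a 1F = slope (class 1F)
          a 2F = slope (class 2F)
          a 3F = slope (class 3F)
          a 4F = slope (class 0F)
          l : Fin 5 → Line
          l 0F = flag (edges 0F)
          l 1F = flag (edges 1F)
          l 2F = flag (edges 2F)
          l 3F = flag (edges 3F)
          l 4F = flag (edges 0F)
          h : ∀ i → Meet (a i) (l i) (l (G.rot i))
          h 0F = meet (meets 0F)
          h 1F = meet (meets 1F)
          h 2F = meet (meets 2F)
          h 3F = meet (meets 3F)
          h 4F = G.meet-refl
          0≢1 : _≢_ {A = Fin 4} 0F 1F
          0≢1 ()
          1≢2 : _≢_ {A = Fin 4} 1F 2F
          1≢2 ()

        no-pentagon : ¬ Cycle 4
        no-pentagon C = G.no-pentagon a l h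
            (λ { 0F → slope-difference′ distinct (turns 0F λ ()) ; 1F → slope-difference′ distinct (turns 1F λ ())
               ; 2F → slope-difference′ distinct (turns 2F λ ()) ; 3F → slope-difference′ distinct (turns 3F λ ())
               ; 4F → slope-difference′ distinct (turns 4F λ ()) })
            (λ { 0F → apart (meets 0F) (λ eq → neq₀ (edges-injective eq)) ; 1F → apart (meets 1F) (λ eq → neq₁ (edges-injective eq))
               ; 2F → apart (meets 2F) (λ eq → neq₂ (edges-injective eq)) ; 3F → apart (meets 3F) (λ eq → neq₃ (edges-injective eq))
               ; 4F → apart (meets 4F) (λ eq → neq₄ (edges-injective eq)) })
          where
          open Cycle C
          a : Fin 5 → ℤ
          a i = slope (class i)
          l : Fin 5 → Line
          l i = flag (edges i)
          h : ∀ i → Meet (a i) (l i) (l (G.rot i))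
          h 0F = meet (meets 0F)
          h 1F = meet (meets 1F)
          h 2F = meet (meets 2F)
          h 3F = meet (meets 3F)
          h 4F = meet (meets 4F)
          neq₀ : _≢_ {A = Fin 5} 0F 1F
          neq₀ ()
          neq₁ : _≢_ {A = Fin 5} 1F 2F
          neq₁ ()
          neq₂ : _≢_ {A = Fin 5} 2F 3F
          neq₂ ()
          neq₃ : _≢_ {A = Fin 5} 3F 4F
          neq₃ ()
          neq₄ : _≢_ {A = Fin 5} 4F 0F
          neq₄ ()

        free : CycFree hypergraph 6
        free 1 (s≤s ()) _ _
        free 2 _ _ B = no-digon (cycle B)
        free 3 _ _ B = no-triangle (cycle B)
        free 4 _ _ B = no-quadrangle (cycle B)
        free 5 _ _ B = no-pentagon (cycle B)
        free (suc (suc (suc (suc (suc (suc _)))))) _ (s≤s (s≤s (s≤s (s≤s (s≤s (s≤s ())))))) _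

-- Slopes, choice of the prime, and the final count

open import Defs
open import Data.Nat using (ℕ; zero; suc; _≤_; _<_; _*_; _^_; _+_; _⊔_; z≤n; s≤s; NonZero; >-nonZero)
open import Data.Nat.Properties
import Data.Nat.Divisibility as ℕ
open import Data.Nat.Primality using (Prime)
open import Data.Nat.Tactic.RingSolver using (solve-∀)
open import Data.Integer.Base as ℤ using (ℤ)
open import Data.Fin.Base using (Fin; toℕ; zero; suc)
open import Data.Fin.Properties using (toℕ<n; toℕ-injective)
open import Data.Product using (Σ; ∃; ∃₂; _,_; _×_; proj₁; proj₂)
open import Data.Sum using (inj₁; inj₂)
open import Data.Empty using (⊥-elim)
open import Function.Base using (_∘_)
open import Relation.Nullary using (¬_; yes; no)
open import Relation.Binary.Definitions using (tri<; tri≈; tri>)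
open import Relation.Binary.PropositionalEquality using (_≡_; _≢_; refl; sym; trans; cong; subst)
open Primes using (prime-between)
open Residues
open Constructions

-- Base 2 would fail for j = k, where the two powers add up to the next one.
3^-dominates : ∀ {i j k} → j < i → k < i → 3 ^ j + 3 ^ k < 3 ^ i
3^-dominates {suc i} {j} {k} (s≤s j≤i) (s≤s k≤i) = begin-strict
  3 ^ j + 3 ^ k ≤⟨ +-mono-≤ (^-monoʳ-≤ 3 j≤i) (^-monoʳ-≤ 3 k≤i) ⟩
  3 ^ i + 3 ^ i <⟨ m<m+n (3 ^ i + 3 ^ i) (m^n>0 3 i) ⟩
  3 ^ i + 3 ^ i + 3 ^ i ≡⟨ lemma (3 ^ i) ⟩
  3 ^ suc i ∎
  where
  open ≤-Reasoning
  lemma : ∀ x → x + x + x ≡ 3 * x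
  lemma = solve-∀

3^-⊔≤ : ∀ i k → 3 ^ (i ⊔ k) ≤ 3 ^ i + 3 ^ k
3^-⊔≤ i k with ⊔-sel i k
... | inj₁ e rewrite e = m≤m+n (3 ^ i) (3 ^ k)
... | inj₂ e rewrite e = m≤n+m (3 ^ k) (3 ^ i)

-- The sum with the larger top exponent is the larger sum, so the top exponents agree; whichever
-- indices attain them, this equates two neighbours.
3^-sidon : ∀ {i j k l} → i ≢ j → j ≢ k → k ≢ l → l ≢ i → 3 ^ i + 3 ^ k ≢ 3 ^ j + 3 ^ l
3^-sidon {i} {j} {k} {l} i≢j j≢k k≢l l≢i eq with <-cmp (i ⊔ k) (j ⊔ l)
... | tri< lt _ _ = <⇒≢ (<-≤-trans (3^-dominates (≤-<-trans (m≤m⊔n i k) lt) (≤-<-trans (m≤n⊔m i k) lt)) (3^-⊔≤ j l)) eq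
... | tri> _ _ gt = <⇒≢ (<-≤-trans (3^-dominates (≤-<-trans (m≤m⊔n j l) gt) (≤-<-trans (m≤n⊔m j l) gt)) (3^-⊔≤ i k)) (sym eq)
... | tri≈ _ e _ with ⊔-sel i k | ⊔-sel j l
...   | inj₁ p | inj₁ q = i≢j (trans (sym p) (trans e q))
...   | inj₁ p | inj₂ q = l≢i (sym (trans (sym p) (trans e q)))
...   | inj₂ p | inj₁ q = j≢k (sym (trans (sym p) (trans e q)))
...   | inj₂ p | inj₂ q = k≢l (trans (sym p) (trans e q))

3^-injective : ∀ {i j} → 3 ^ i ≡ 3 ^ j → i ≡ j
3^-injective {i} {j} eq with <-cmp i j
... | tri< lt _ _ = ⊥-elim (<⇒≢ (^-monoʳ-< 3 (s≤s (s≤s z≤n)) lt) eq)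
... | tri≈ _ e _ = e
... | tri> _ _ gt = ⊥-elim (<⇒≢ (^-monoʳ-< 3 (s≤s (s≤s z≤n)) gt) (sym eq))

module Extremal {p : ℕ} (prime : Prime p) {r : ℕ} (3≤r : 3 ≤ r) (3^r≤p : 3 ^ r ≤ p) where
  open Modular p prime

  private
    slope : Fin r → ℤ
    slope i = ℤ.+ (3 ^ toℕ i)

    odd : ¬ p ℕ.∣ 2
    odd p∣2 = <⇒≱ (<-≤-trans (^-monoʳ-< 3 (s≤s (s≤s z≤n)) {1} {r} (≤-trans (s≤s (s≤s z≤n)) 3≤r)) 3^r≤p) (≤-trans (ℕ.∣⇒≤ p∣2) (n≤1+n 2))

    open Construction p prime odd (proj₁ ∃-root-free) (proj₂ ∃-root-free) slope

    slopes-distinct : Distinct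
    slopes-distinct {i} {j} i≢j h = i≢j (toℕ-injective (3^-injective (small-≋ (below i) (below j) h)))
      where
      below : ∀ i → 3 ^ toℕ i < p
      below i = <-≤-trans (^-monoʳ-< 3 (s≤s (s≤s z≤n)) (toℕ<n i)) 3^r≤p

    sidon : Sidon
    sidon {i} {j} {k} {l} i≢j j≢k k≢l l≢i h =
      3^-sidon (i≢j ∘ toℕ-injective) (j≢k ∘ toℕ-injective) (k≢l ∘ toℕ-injective) (l≢i ∘ toℕ-injective)
        (small-≋ {3 ^ toℕ i + 3 ^ toℕ k} {3 ^ toℕ j + 3 ^ toℕ l} (below i k) (below j l) h)
      where
      -- Sums of two slopes stay below `p`, so a congruence between them is an equality of integers.
      below : ∀ i k → 3 ^ toℕ i + 3 ^ toℕ k < p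
      below i k = <-≤-trans (3^-dominates (toℕ<n i) (toℕ<n k)) 3^r≤p

    two : ∃₂ λ (i j : Fin r) → i ≢ j
    two = distinct-pair 3≤r
      where
      distinct-pair : ∀ {r} → 3 ≤ r → ∃₂ λ (i j : Fin r) → i ≢ j
      distinct-pair (s≤s (s≤s _)) = zero , suc zero , λ ()

  girth-5 : ∀ {N} → r * p ^ 7 ≤ N → ExAtLeast r N 5 (p ^ 10)
  girth-5 fits = _ , Girth5.free slopes-distinct sidon two fits , ≤-refl

  girth-6 : ∀ {N} → r * p ^ 8 ≤ N → ExAtLeast r N 6 (p ^ 11)
  girth-6 fits = _ , Girth6.free slopes-distinct two fits , ≤-refl

-- `grows` ends the search: at `i₀ + suc N` the value of `f` exceeds `N`.
bracket : ∀ (f : ℕ → ℕ) → (∀ i → i < f i) → ∀ i₀ N → f i₀ ≤ N → ∃ λ i → i₀ ≤ i × f i ≤ N × N < f (suc i)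
bracket f grows i₀ N f≤N = go (suc N) i₀ ≤-refl f≤N (<-≤-trans (n<1+n N) (≤-trans (m≤n+m (suc N) i₀) (<⇒≤ (grows (i₀ + suc N)))))
  where
  go : ∀ d i → i₀ ≤ i → f i ≤ N → N < f (i + d) → ∃ λ i → i₀ ≤ i × f i ≤ N × N < f (suc i)
  go zero i _ f≤N N<f = ⊥-elim (<⇒≱ (subst (λ t → N < f t) (+-identityʳ i) N<f) f≤N)
  go (suc d) i i₀≤i f≤N N<f with f (suc i) ≤? N
  ... | no ≰ = i , i₀≤i , f≤N , ≰⇒> ≰
  ... | yes f≤N′ = go d (suc i) (m≤n⇒m≤1+n i₀≤i) f≤N′ (subst (λ t → N < f t) (+-suc i d) N<f)

n<2^n : ∀ n → n < 2 ^ n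
n<2^n zero = s≤s z≤n
n<2^n (suc n) = begin-strict
  suc n ≤⟨ n<2^n n ⟩
  2 ^ n <⟨ m<m+n (2 ^ n) (m^n>0 2 n) ⟩
  2 ^ n + 2 ^ n ≡⟨ cong (2 ^ n +_) (+-identityʳ (2 ^ n)) ⟨
  2 ^ suc n ∎
  where open ≤-Reasoning

^-distribʳ-* : ∀ n x y → (x * y) ^ n ≡ x ^ n * y ^ n
^-distribʳ-* zero x y = refl
^-distribʳ-* (suc n) x y = trans (cong (x * y *_) (^-distribʳ-* n x y)) ([m*n]*[o*p]≡[m*o]*[n*p] x y (x ^ n) (y ^ n))

-- For an edge count t = p^s this is the bound N^(n/k) ≤ X^s t with the roots cleared; `m` is the
-- number of coordinates of a vertex.
power-bound : ∀ {N X B p} m n s k → NonZero (X * p) → N ≤ (X * B) ^ m → B ≤ p → m * n ≤ s * k →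
  N ^ n ≤ (X ^ s) ^ k * (p ^ s) ^ k
power-bound {N} {X} {B} {p} m n s k X*p≢0 N≤ B≤p mn≤sk = begin
  N ^ n ≤⟨ ^-monoˡ-≤ n (≤-trans N≤ (^-monoˡ-≤ m (*-monoʳ-≤ X B≤p))) ⟩
  ((X * p) ^ m) ^ n ≡⟨ ^-*-assoc (X * p) m n ⟩
  (X * p) ^ (m * n) ≤⟨ ^-monoʳ-≤ (X * p) {{X*p≢0}} mn≤sk ⟩
  (X * p) ^ (s * k) ≡⟨ ^-*-assoc (X * p) s k ⟨
  ((X * p) ^ s) ^ k ≡⟨ cong (_^ k) (^-distribʳ-* s X p) ⟩
  (X ^ s * p ^ s) ^ k ≡⟨ ^-distribʳ-* k (X ^ s) (p ^ s) ⟩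
  (X ^ s) ^ k * (p ^ s) ^ k ∎
  where open ≤-Reasoning

module Scale {r : ℕ} (3≤r : 3 ≤ r) (e : ℕ) where

  B : ℕ → ℕ
  B i = 2 ^ (4 + i) * 2 ^ (4 + i)

  vertices : ℕ → ℕ
  vertices i = r * (16 * B i) ^ suc e

  -- Of the factor 64, 16 is the width of the interval containing the prime and 4 the growth of `B`
  -- from one index to the next; `r` absorbs the number of classes.
  X : ℕ
  X = r * 64

  private
    r>0 : 0 < r
    r>0 = ≤-trans (s≤s z≤n) 3≤r

    B>0 : ∀ i → 0 < B i
    B>0 i = *-mono-≤ (m^n>0 2 (4 + i)) (m^n>0 2 (4 + i))

    2^i≤B : ∀ i → 2 ^ i * 2 ^ i ≤ B i
    2^i≤B i = *-mono-≤ (^-monoʳ-≤ 2 (m≤n+m i 4)) (^-monoʳ-≤ 2 (m≤n+m i 4))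

    B-suc : ∀ i → 16 * B (suc i) ≡ 64 * B i
    B-suc i = lemma (2 ^ (4 + i))
      where
      lemma : ∀ y → 16 * (2 * y * (2 * y)) ≡ 64 * (y * y)
      lemma = solve-∀

    grows : ∀ i → i < vertices i
    grows i = begin-strict
      i <⟨ n<2^n i ⟩
      2 ^ i ≤⟨ m≤m*n (2 ^ i) (2 ^ i) {{>-nonZero (m^n>0 2 i)}} ⟩
      2 ^ i * 2 ^ i ≤⟨ 2^i≤B i ⟩
      B i ≤⟨ m≤n*m (B i) 16 ⟩
      16 * B i ≤⟨ m≤m*n (16 * B i) ((16 * B i) ^ e) {{>-nonZero (m^n>0 (16 * B i) {{nonZero}} e)}} ⟩
      (16 * B i) ^ suc e ≤⟨ m≤n*m ((16 * B i) ^ suc e) r {{>-nonZero r>0}} ⟩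
      vertices i ∎
      where
      open ≤-Reasoning
      nonZero : NonZero (16 * B i)
      nonZero = >-nonZero (≤-trans (B>0 i) (m≤n*m (B i) 16))

    vertices-suc : ∀ i → vertices (suc i) ≤ (X * B i) ^ suc e
    vertices-suc i = begin
      r * (16 * B (suc i)) ^ suc e ≡⟨ cong (λ t → r * t ^ suc e) (B-suc i) ⟩
      r * (64 * B i) ^ suc e ≤⟨ *-monoˡ-≤ ((64 * B i) ^ suc e) (m≤m*n r (r ^ e) {{>-nonZero (m^n>0 r {{>-nonZero r>0}} e)}}) ⟩
      r ^ suc e * (64 * B i) ^ suc e ≡⟨ ^-distribʳ-* (suc e) r (64 * B i) ⟨
      (r * (64 * B i)) ^ suc e ≡⟨ cong (_^ suc e) (*-assoc r 64 (B i)) ⟨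
      (X * B i) ^ suc e ∎
      where open ≤-Reasoning

  X>0 : 0 < X
  X>0 = *-mono-≤ r>0 (s≤s (z≤n {63}))

  choose : ∀ N → vertices r ≤ N → ∃ λ p → Prime p × 3 ^ r ≤ p × r * p ^ suc e ≤ N ×
    (∀ n s k → suc e * n ≤ s * k → N ^ n ≤ (X ^ s) ^ k * (p ^ s) ^ k)
  choose N N₀≤N with bracket vertices grows r N N₀≤N
  ... | i , r≤i , lo , hi with prime-between i
  ...   | p , pr , B<p , p≤16B = p , pr , 3^r≤p , ≤-trans (*-monoʳ-≤ r (^-monoˡ-≤ (suc e) p≤16B)) lo ,
          λ n s k h → power-bound (suc e) n s k (>-nonZero (*-mono-≤ X>0 (≤-trans (s≤s z≤n) B<p))) (≤-trans (<⇒≤ hi) (vertices-suc i)) (<⇒≤ B<p) h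
    where
    open ≤-Reasoning
    -- The bracket starts at index `r` for this purpose: it makes `B i` at least 4^r.
    3^r≤p : 3 ^ r ≤ p
    3^r≤p = begin
      3 ^ r ≤⟨ ^-monoˡ-≤ r (n≤1+n 3) ⟩
      4 ^ r ≡⟨ ^-distribʳ-* r 2 2 ⟩
      2 ^ r * 2 ^ r ≤⟨ *-mono-≤ (^-monoʳ-≤ 2 r≤i) (^-monoʳ-≤ 2 r≤i) ⟩
      2 ^ i * 2 ^ i ≤⟨ 2^i≤B i ⟩
      B i <⟨ B<p ⟩
      p ∎

theorem1p2 : (r : ℕ) → 3 ≤ r →
    (Σ ℕ λ a → 1 ≤ a × Σ ℕ λ N₀ → (N : ℕ) → N₀ ≤ N →
    Σ ℕ λ t → ExAtLeast r N 5 t × N ^ 10 ≤ (a ^ 7) * (t ^ 7))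
    ×
    (Σ ℕ λ b → 1 ≤ b × Σ ℕ λ N₀ → (N : ℕ) → N₀ ≤ N →
    Σ ℕ λ t → ExAtLeast r N 6 t × N ^ 4 ≤ (b ^ 3) * (t ^ 3))
theorem1p2 r 3≤r = (A.X ^ 10 , m^n>0 A.X {{>-nonZero A.X>0}} 10 , A.vertices r , λ N N₀≤N →
      let p , pr , 3^r≤p , fits , bound = A.choose N N₀≤N in
      p ^ 10 , Extremal.girth-5 pr 3≤r 3^r≤p fits , bound 10 10 7 ≤-refl)
  , (B.X ^ 11 , m^n>0 B.X {{>-nonZero B.X>0}} 11 , B.vertices r , λ N N₀≤N →
      let p , pr , 3^r≤p , fits , bound = B.choose N N₀≤N in
      -- The exponent 11/8 exceeds 4/3, which appears here as 8 · 4 = 32 ≤ 33 = 11 · 3.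
      p ^ 11 , Extremal.girth-6 pr 3≤r 3^r≤p fits , bound 4 11 3 (n≤1+n 32))
  where
  module A = Scale 3≤r 6
  module B = Scale 3≤r 7
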